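{- Let $\Phi=(G,\varphi)$ be a complex unit gain graph and let $C_p^{\varphi}$ be a pendant cycle of $\Phi$ of order $p$, with $v$ the unique vertex of $C_p$ of degree $3$ in $G$. Let $F^{\varphi}=(F,\varphi)=\Phi-C_p^{\varphi}$ (delete all vertices of $C_p$) and $H^{\varphi}=(H,\varphi)=F^{\varphi}+v$ (the induced subgraph on $V(F)\cup\{v\}$). If $r(\Phi)=r(G)+2\theta(G)$, then (a) $C_p^{\varphi}$ is of Type B with $p\equiv 0\pmod 4$; (b) $r(H^{\varphi})=r(H)+2\theta(H)$ and $r(F^{\varphi})=r(F)+2\theta(F)$; (c) $r(\Phi)=p+r(F^{\varphi})$, $r(F^{\varphi})=r(H^{\varphi})$, $r(G)=p-2+r(H)$ and $r(F)=r(H)$.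
   Context: A complex unit gain graph $\Phi=(G,\varphi)$ consists of a finite simple graph $G$ with vertex set $\{v_1,\dots,v_n\}$ and a gain function $\varphi$ assigning to each oriented edge $e_{ij}$ ($v_iv_j\in E(G)$) a complex number of modulus $1$ with $\varphi(e_{ji})=\overline{\varphi(e_{ij})}$. $A(\Phi)$ is the Hermitian matrix with $(i,j)$ entry $\varphi(e_{ij})$ if $v_iv_j\in E(G)$ and $0$ otherwise; $r(\Phi)$ is its rank; $r(\cdot)$ of a simple graph is the rank of its $0$-$1$ adjacency matrix. Induced subgraphs of $\Phi$ carry the gains of $\Phi$. $\theta(G)=|E(G)|-|V(G)|+\omega(G)$, $\omega(G)$ the number of components. A pendant cycle of $G$ is an induced subgraph $C_p$ that is a cycle and has a unique vertex of degree $3$ in $G$ (its other vertices having degree $2$ in $G$). For a gain cycle with vertices $v_1,\dots,v_p$ in cyclic order, $\varphi(C_p)=\varphi(e_{12})\cdots\varphi(e_{p1})$; for $p$ even it is of Type B if $\varphi(C_p)\neq(-1)^{p/2}$. -}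

module Defs where

open import Level using (Level; _⊔_; suc)
open import Algebra.Bundles using (CommutativeRing; AbelianGroup)
open import Algebra.Construct.DirectProduct using (abelianGroup)
import Algebra.Definitions.RawMonoid as RawMonoidOps
import Algebra.Properties.Ring as RingProperties
import Algebra.Properties.Semiring.Mult.TCOptimised as Mult
import Algebra.Solver.Ring as RingSolver
import Algebra.Solver.Ring.AlmostCommutativeRing as ACR
open import Data.Bool.Base using (Bool; true; false; T; if_then_else_)
open import Data.Bool.Properties using (T?) renaming (_≟_ to _≟ᵇ_)
open import Data.Empty using (⊥-elim)
open import Data.Fin.Base as Fin using (Fin; toℕ)
open import Data.Fin.Properties as Finₚ using (all?; any?; ¬∀⟶∃¬)
open import Data.Fin.Subset using (Subset; inside; outside; ∣_∣; ∁; _∪_; ⁅_⁆; _∉_)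
open import Data.Integer.Base as ℤ using (ℤ; +_; -[1+_])
import Data.Integer.Properties as ℤₚ
open import Data.List.Base using (List; allFin; cartesianProduct; deduplicate; filter; length; map)
import Data.Maybe.Base as Maybe
open import Data.Nat.Base as ℕ using (ℕ; _≤_; _<_)
import Data.Nat.Properties as ℕₚ
open import Data.Nat.Divisibility using (_∣_)
open import Data.Nat.DivMod using (_mod_; _/_)
open import Data.Product.Base using (∃; _×_; _,_)
import Data.Sign.Base as Sign
open import Data.Sum.Base using (_⊎_; inj₁; inj₂)
open import Data.Vec.Base using (Vec; []; _∷_; tabulate; here; there)
open import Data.Vec.Properties using (≡-dec)
open import Function.Base using (_∘_)
open import Function.Bundles using (_⇔_)
open import Function.Definitions using (Injective)
open import Relation.Binary.Construct.Closure.ReflexiveTransitive using (Star; ε; _◅_; _◅◅_)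
open import Relation.Binary.Core using (Rel)
open import Relation.Binary.Definitions using (Decidable)
open import Relation.Binary.PropositionalEquality.Core as ≡ using (_≡_)
open import Relation.Binary.Structures using (IsDecTotalOrder)
open import Relation.Nullary using (¬_; Dec; yes; no; does)
open import Relation.Nullary.Decidable using (dec⇒maybe; map′; _×-dec_; _⊎-dec_)
open import Relation.Unary using (Pred)

-- The solver of Algebra.Solver.Ring with integer coefficients.
module IntegerSolver {c ℓ} (R : CommutativeRing c ℓ) where
  private
    open CommutativeRing R
    open Mult semiring using (1+×; ×-homo-+; ×1-homo-*) renaming (_×_ to _×′_)
    open RingProperties ring using (-‿distribˡ-*; -‿distribʳ-*; -0#≈0#; -‿involutive; -‿+-comm)

    ⟦_⟧ : ℤ → Carrier
    ⟦ + n ⟧      = n ×′ 1#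
    ⟦ -[1+ n ] ⟧ = - (ℕ.suc n ×′ 1#)

    -‿homo : ∀ i → ⟦ ℤ.- i ⟧ ≈ - ⟦ i ⟧
    -‿homo (+ ℕ.zero)    = sym -0#≈0#
    -‿homo (+ ℕ.suc n)   = refl
    -‿homo -[1+ n ]      = sym (-‿involutive _)

    cancel : ∀ a b → (1# + a) + - (1# + b) ≈ a + - b
    cancel a b = trans (+-cong (+-comm 1# a) (sym (-‿+-comm 1# b)))
      (trans (+-assoc a 1# _) (+-congˡ (trans (sym (+-assoc 1# (- 1#) (- b)))
        (trans (+-congʳ (-‿inverseʳ 1#)) (+-identityˡ (- b))))))

    ⊖-homo : ∀ m n → ⟦ m ℤ.⊖ n ⟧ ≈ m ×′ 1# + - (n ×′ 1#)
    ⊖-homo ℕ.zero    ℕ.zero    = sym (trans (+-identityˡ _) -0#≈0#)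
    ⊖-homo ℕ.zero    (ℕ.suc n) = sym (+-identityˡ _)
    ⊖-homo (ℕ.suc m) ℕ.zero    = sym (trans (+-congˡ -0#≈0#) (+-identityʳ _))
    ⊖-homo (ℕ.suc m) (ℕ.suc n) = trans (reflexive (≡.cong ⟦_⟧ (ℤₚ.[1+m]⊖[1+n]≡m⊖n m n)))
      (trans (⊖-homo m n) (sym (trans (+-cong (1+× m 1#) (-‿cong (1+× n 1#))) (cancel _ _))))

    +-homo : ∀ i j → ⟦ i ℤ.+ j ⟧ ≈ ⟦ i ⟧ + ⟦ j ⟧
    +-homo (+ m)    (+ n)    = ×-homo-+ 1# m n
    +-homo (+ m)    -[1+ n ] = ⊖-homo m (ℕ.suc n)
    +-homo -[1+ m ] (+ n)    = trans (⊖-homo n (ℕ.suc m)) (+-comm _ _)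
    +-homo -[1+ m ] -[1+ n ] = trans
      (-‿cong (trans (reflexive (≡.cong (λ k → ℕ.suc k ×′ 1#) (≡.sym (ℕₚ.+-suc m n))))
                     (×-homo-+ 1# (ℕ.suc m) (ℕ.suc n))))
      (sym (-‿+-comm _ _))

    +◃-homo : ∀ n → ⟦ Sign.+ ℤ.◃ n ⟧ ≈ n ×′ 1#
    +◃-homo ℕ.zero    = refl
    +◃-homo (ℕ.suc n) = refl

    -◃-homo : ∀ n → ⟦ Sign.- ℤ.◃ n ⟧ ≈ - (n ×′ 1#)
    -◃-homo ℕ.zero    = sym -0#≈0#
    -◃-homo (ℕ.suc n) = refl

    *-homo : ∀ i j → ⟦ i ℤ.* j ⟧ ≈ ⟦ i ⟧ * ⟦ j ⟧
    *-homo (+ m)    (+ n)    = trans (+◃-homo (m ℕ.* n)) (×1-homo-* m n)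
    *-homo (+ m)    -[1+ n ] = trans (-◃-homo (m ℕ.* ℕ.suc n))
      (trans (-‿cong (×1-homo-* m (ℕ.suc n))) (-‿distribʳ-* _ _))
    *-homo -[1+ m ] (+ n)    = trans (-◃-homo (ℕ.suc m ℕ.* n))
      (trans (-‿cong (×1-homo-* (ℕ.suc m) n)) (-‿distribˡ-* _ _))
    *-homo -[1+ m ] -[1+ n ] = trans (+◃-homo (ℕ.suc m ℕ.* ℕ.suc n))
      (trans (×1-homo-* (ℕ.suc m) (ℕ.suc n))
        (trans (sym (-‿involutive _)) (trans (-‿cong (-‿distribˡ-* _ _)) (-‿distribʳ-* _ _))))

    morphism : ℤ.+-*-rawRing ACR.-Raw-AlmostCommutative⟶ ACR.fromCommutativeRing R
    morphism = record
      { ⟦_⟧ = ⟦_⟧ ; +-homo = +-homo ; *-homo = *-homo ; -‿homo = -‿homo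
      ; 0-homo = refl ; 1-homo = refl }

  open RingSolver ℤ.+-*-rawRing (ACR.fromCommutativeRing R) morphism
    (λ i j → Maybe.map (λ eq → reflexive (≡.cong ⟦_⟧ eq)) (dec⇒maybe (i ℤₚ.≟ j))) public
    using (solve; con; _:+_; _:*_; :-_; _:=_)

-- The standard library has no real numbers.  They are axiomatised, classically
-- (decidable order), as a Dedekind-complete ordered field; such a field is
-- unique up to isomorphism, and under excluded middle Dedekind cuts give one.
record RealNumbers c ℓ₁ ℓ₂ : Set (suc (c ⊔ ℓ₁ ⊔ ℓ₂)) where
  field
    commutativeRing : CommutativeRing c ℓ₁
  open CommutativeRing commutativeRing public
  infix 4 _≤ᴿ_
  field
    _≤ᴿ_            : Rel Carrier ℓ₂
    isDecTotalOrder : IsDecTotalOrder _≈_ _≤ᴿ_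
    1≉0             : ¬ (1# ≈ 0#)
    inverse         : ∀ x → ¬ (x ≈ 0#) → ∃ λ y → x * y ≈ 1#
    +-monoʳ-≤ᴿ      : ∀ {x y} z → x ≤ᴿ y → (z + x) ≤ᴿ (z + y)
    *-nonNegative   : ∀ {x y} → 0# ≤ᴿ x → 0# ≤ᴿ y → 0# ≤ᴿ (x * y)

  UpperBound : Pred Carrier (c ⊔ ℓ₁ ⊔ ℓ₂) → Carrier → Set (c ⊔ ℓ₁ ⊔ ℓ₂)
  UpperBound P b = ∀ x → P x → x ≤ᴿ b

  field
    supremum : (P : Pred Carrier (c ⊔ ℓ₁ ⊔ ℓ₂)) → ∃ P → ∃ (UpperBound P) →
               ∃ λ s → UpperBound P s × (∀ b → UpperBound P b → s ≤ᴿ b)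

  open IsDecTotalOrder isDecTotalOrder public
    using (antisym; total; _≟_; ≤-respˡ-≈; ≤-respʳ-≈)
    renaming (refl to ≤ᴿ-refl; trans to ≤ᴿ-trans)

record DiscreteField c ℓ : Set (suc (c ⊔ ℓ)) where
  field
    commutativeRing : CommutativeRing c ℓ
  open CommutativeRing commutativeRing public
  field
    _≟_     : Decidable _≈_
    1≉0     : ¬ (1# ≈ 0#)
    inverse : ∀ x → ¬ (x ≈ 0#) → ∃ λ y → x * y ≈ 1#

module ComplexNumbers {c ℓ₁ ℓ₂} (ℝ : RealNumbers c ℓ₁ ℓ₂) where
  private
    module R = RealNumbers ℝ
    open R using (_≈_; _+_; _*_; -_; 0#; 1#; _≤ᴿ_)
    open IntegerSolver R.commutativeRing

    -- pairs (re , im)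
    ℂ⁺ : AbelianGroup c ℓ₁
    ℂ⁺ = abelianGroup R.+-abelianGroup R.+-abelianGroup
    module C = AbelianGroup ℂ⁺

    infixl 7 _*ᶜ_
    _*ᶜ_ : C.Carrier → C.Carrier → C.Carrier
    (a , b) *ᶜ (a′ , b′) = (a * a′ + - (b * b′)) , (a * b′ + b * a′)

    assoc-re : ∀ a b a′ b′ a″ b″ →
      (a * a′ + - (b * b′)) * a″ + - ((a * b′ + b * a′) * b″) ≈
      a * (a′ * a″ + - (b′ * b″)) + - (b * (a′ * b″ + b′ * a″))
    assoc-re = solve 6 (λ a b a′ b′ a″ b″ →
      (a :* a′ :+ :- (b :* b′)) :* a″ :+ :- ((a :* b′ :+ b :* a′) :* b″) :=
      a :* (a′ :* a″ :+ :- (b′ :* b″)) :+ :- (b :* (a′ :* b″ :+ b′ :* a″))) R.refl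

    assoc-im : ∀ a b a′ b′ a″ b″ →
      (a * a′ + - (b * b′)) * b″ + (a * b′ + b * a′) * a″ ≈
      a * (a′ * b″ + b′ * a″) + b * (a′ * a″ + - (b′ * b″))
    assoc-im = solve 6 (λ a b a′ b′ a″ b″ →
      (a :* a′ :+ :- (b :* b′)) :* b″ :+ (a :* b′ :+ b :* a′) :* a″ :=
      a :* (a′ :* b″ :+ b′ :* a″) :+ b :* (a′ :* a″ :+ :- (b′ :* b″))) R.refl

    comm-re : ∀ a b a′ b′ → a * a′ + - (b * b′) ≈ a′ * a + - (b′ * b)
    comm-re = solve 4 (λ a b a′ b′ → a :* a′ :+ :- (b :* b′) := a′ :* a :+ :- (b′ :* b)) R.refl

    comm-im : ∀ a b a′ b′ → a * b′ + b * a′ ≈ a′ * b + b′ * a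
    comm-im = solve 4 (λ a b a′ b′ → a :* b′ :+ b :* a′ := a′ :* b :+ b′ :* a) R.refl

    identity-re : ∀ a b → 1# * a + - (0# * b) ≈ a
    identity-re = solve 2 (λ a b → con (+ 1) :* a :+ :- (con (+ 0) :* b) := a) R.refl

    identity-im : ∀ a b → 1# * b + 0# * a ≈ b
    identity-im = solve 2 (λ a b → con (+ 1) :* b :+ con (+ 0) :* a := b) R.refl

    distrib-re : ∀ a b a′ b′ a″ b″ →
      a * (a′ + a″) + - (b * (b′ + b″)) ≈
      (a * a′ + - (b * b′)) + (a * a″ + - (b * b″))
    distrib-re = solve 6 (λ a b a′ b′ a″ b″ →
      a :* (a′ :+ a″) :+ :- (b :* (b′ :+ b″)) :=
      (a :* a′ :+ :- (b :* b′)) :+ (a :* a″ :+ :- (b :* b″))) R.refl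

    distrib-im : ∀ a b a′ b′ a″ b″ →
      a * (b′ + b″) + b * (a′ + a″) ≈ (a * b′ + b * a′) + (a * b″ + b * a″)
    distrib-im = solve 6 (λ a b a′ b′ a″ b″ →
      a :* (b′ :+ b″) :+ b :* (a′ :+ a″) :=
      (a :* b′ :+ b :* a′) :+ (a :* b″ :+ b :* a″)) R.refl

    *ᶜ-cong : ∀ {w x y z} → w C.≈ x → y C.≈ z → (w *ᶜ y) C.≈ (x *ᶜ z)
    *ᶜ-cong (p , q) (r , s) =
      R.+-cong (R.*-cong p r) (R.-‿cong (R.*-cong q s)) ,
      R.+-cong (R.*-cong p s) (R.*-cong q r)

    *ᶜ-comm : ∀ x y → (x *ᶜ y) C.≈ (y *ᶜ x)
    *ᶜ-comm (a , b) (a′ , b′) = comm-re a b a′ b′ , comm-im a b a′ b′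

    1ᶜ : C.Carrier
    1ᶜ = 1# , 0#

    *ᶜ-identityˡ : ∀ x → (1ᶜ *ᶜ x) C.≈ x
    *ᶜ-identityˡ (a , b) = identity-re a b , identity-im a b

    *ᶜ-distribˡ : ∀ x y z → (x *ᶜ (y C.∙ z)) C.≈ ((x *ᶜ y) C.∙ (x *ᶜ z))
    *ᶜ-distribˡ (a , b) (a′ , b′) (a″ , b″) =
      distrib-re a b a′ b′ a″ b″ , distrib-im a b a′ b′ a″ b″

  ℂ-commutativeRing : CommutativeRing c ℓ₁
  ℂ-commutativeRing = record
    { Carrier = C.Carrier
    ; _≈_ = C._≈_
    ; _+_ = C._∙_
    ; _*_ = _*ᶜ_
    ; -_  = C._⁻¹
    ; 0#  = C.ε
    ; 1#  = 1ᶜ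
    ; isCommutativeRing = record
      { isRing = record
        { +-isAbelianGroup = C.isAbelianGroup
        ; *-cong = *ᶜ-cong
        ; *-assoc = λ (a , b) (a′ , b′) (a″ , b″) →
            assoc-re a b a′ b′ a″ b″ , assoc-im a b a′ b′ a″ b″
        ; *-identity = *ᶜ-identityˡ , λ x → C.trans (*ᶜ-comm x 1ᶜ) (*ᶜ-identityˡ x)
        ; distrib = *ᶜ-distribˡ , λ x y z →
            C.trans (*ᶜ-comm (y C.∙ z) x)
              (C.trans (*ᶜ-distribˡ x y z) (C.∙-cong (*ᶜ-comm x y) (*ᶜ-comm x z)))
        }
      ; *-comm = *ᶜ-comm
      }
    }

  private
    neg-square : ∀ a → (- a) * (- a) ≈ a * a
    neg-square = solve 1 (λ a → (:- a) :* (:- a) := a :* a) R.refl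

    square-nonNegative : ∀ a → 0# ≤ᴿ a * a
    square-nonNegative a with R.total 0# a
    ... | inj₁ 0≤a = R.*-nonNegative 0≤a 0≤a
    ... | inj₂ a≤0 = R.≤-respʳ-≈ (neg-square a) (R.*-nonNegative 0≤-a 0≤-a)
      where
      0≤-a : 0# ≤ᴿ - a
      0≤-a = R.≤-respˡ-≈ (R.-‿inverseˡ a)
               (R.≤-respʳ-≈ (R.+-identityʳ (- a)) (R.+-monoʳ-≤ᴿ (- a) a≤0))

    square-zero : ∀ a → a * a ≈ 0# → a ≈ 0#
    square-zero a aa≈0 with a R.≟ 0#
    ... | yes a≈0 = a≈0
    ... | no  a≉0 with R.inverse a a≉0
    ...   | b , ab≈1 = R.trans (R.sym (R.*-identityʳ a))
            (R.trans (R.*-congˡ (R.sym ab≈1))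
              (R.trans (R.sym (R.*-assoc a a b)) (R.trans (R.*-congʳ aa≈0) (R.zeroˡ b))))

    sumOfSquares-zeroˡ : ∀ a b → a * a + b * b ≈ 0# → a ≈ 0#
    sumOfSquares-zeroˡ a b eq = square-zero a (R.antisym
      (R.≤-respʳ-≈ eq (R.≤-respˡ-≈ (R.+-identityʳ (a * a))
        (R.+-monoʳ-≤ᴿ (a * a) (square-nonNegative b))))
      (square-nonNegative a))

    inverse-re : ∀ a b n → a * (a * n) + - (b * (- (b * n))) ≈ (a * a + b * b) * n
    inverse-re = solve 3 (λ a b n →
      a :* (a :* n) :+ :- (b :* (:- (b :* n))) :=
      (a :* a :+ b :* b) :* n) R.refl

    inverse-im : ∀ a b n → a * (- (b * n)) + b * (a * n) ≈ 0#
    inverse-im = solve 3 (λ a b n → a :* (:- (b :* n)) :+ b :* (a :* n) := con (+ 0)) R.refl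

  ℂ : DiscreteField c ℓ₁
  ℂ = record
    { commutativeRing = ℂ-commutativeRing
    ; _≟_     = λ (a , b) (a′ , b′) → (a R.≟ a′) ×-dec (b R.≟ b′)
    ; 1≉0     = λ (1≈0 , _) → R.1≉0 1≈0
    ; inverse = inv
    }
    where
    inv : ∀ x → ¬ (x C.≈ C.ε) → ∃ λ y → (x *ᶜ y) C.≈ 1ᶜ
    inv (a , b) x≉0 with R.inverse (a * a + b * b) (λ eq →
      x≉0 (sumOfSquares-zeroˡ a b eq , sumOfSquares-zeroˡ b a (R.trans (R.+-comm _ _) eq)))
    ... | n , eq = (a * n , - (b * n)) ,
                   (R.trans (inverse-re a b n) eq , inverse-im a b n)

  conj : C.Carrier → C.Carrier
  conj (a , b) = a , - b

  -- ∣z∣ = r, i.e. r is the non-negative square root of re² + im².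
  HasModulus : C.Carrier → R.Carrier → Set (ℓ₁ ⊔ ℓ₂)
  HasModulus (a , b) r = (0# ≤ᴿ r) × (r * r ≈ a * a + b * b)

maxOverSubsets : ∀ {n} → (Subset n → ℕ) → ℕ
maxOverSubsets {ℕ.zero}  f = f []
maxOverSubsets {ℕ.suc n} f =
  maxOverSubsets (f ∘ (inside ∷_)) ℕ.⊔ maxOverSubsets (f ∘ (outside ∷_))

module LinearAlgebra {c ℓ} (K : DiscreteField c ℓ) where
  private
    module K = DiscreteField K
    open K using (_≈_; _+_; _*_; -_; 0#; 1#; Carrier)

  open RawMonoidOps K.+-rawMonoid public using (sum)

  Matrix : ℕ → ℕ → Set c
  Matrix m n = Fin m → Fin n → Carrier

  InKernel : ∀ {m n} → Matrix m n → (Fin n → Carrier) → Set ℓ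
  InKernel A x = ∀ i → sum (λ j → A i j * x j) ≈ 0#

  SupportedOn : ∀ {n} → Subset n → (Fin n → Carrier) → Set ℓ
  SupportedOn S x = ∀ j → j ∉ S → x j ≈ 0#

  IndependentColumns : ∀ {m n} → Matrix m n → Subset n → Set (c ⊔ ℓ)
  IndependentColumns A S = ∀ x → SupportedOn S x → InKernel A x → ∀ j → x j ≈ 0#

  private
    open IntegerSolver K.commutativeRing

    Dependence : ∀ {m n} → Matrix m n → Subset n → Set (c ⊔ ℓ)
    Dependence A S = ∃ λ x → SupportedOn S x × InKernel A x × ∃ λ j → ¬ (x j ≈ 0#)

    cons : ∀ {n} → Carrier → (Fin n → Carrier) → Fin (ℕ.suc n) → Carrier
    cons a x Fin.zero    = a
    cons a x (Fin.suc j) = x j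

    cons-supported : ∀ {n} {S : Subset n} {a x} → SupportedOn S x → SupportedOn (inside ∷ S) (cons a x)
    cons-supported supp Fin.zero    0∉ = ⊥-elim (0∉ here)
    cons-supported supp (Fin.suc j) j∉ = supp j (j∉ ∘ there)

    tail-supported : ∀ {n s} {S : Subset n} {x} → SupportedOn (s ∷ S) x → SupportedOn S (x ∘ Fin.suc)
    tail-supported supp j j∉ = supp (Fin.suc j) λ { (there j∈) → j∉ j∈ }

    sum-eliminate : ∀ {n} (f g x : Fin n → Carrier) k →
      sum (λ j → (f j + k * g j) * x j) ≈ sum (λ j → f j * x j) + k * sum (λ j → g j * x j)
    sum-eliminate {ℕ.zero}  f g x k = lemma k
      where
      lemma : ∀ k → 0# ≈ 0# + k * 0#
      lemma = solve 1 (λ k → con (+ 0) := con (+ 0) :+ k :* con (+ 0)) K.refl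
    sum-eliminate {ℕ.suc n} f g x k =
      K.trans (K.+-congˡ (sum-eliminate (f ∘ Fin.suc) (g ∘ Fin.suc) (x ∘ Fin.suc) k))
        (lemma (f Fin.zero) (g Fin.zero) (x Fin.zero) k _ _)
      where
      lemma : ∀ a b x k s t → (a + k * b) * x + (s + k * t) ≈ (a * x + s) + k * (b * x + t)
      lemma = solve 6 (λ a b x k s t →
        (a :+ k :* b) :* x :+ (s :+ k :* t) :=
        (a :* x :+ s) :+ k :* (b :* x :+ t)) K.refl

    zero-sum : ∀ {n} (f x : Fin n → Carrier) → (∀ j → x j ≈ 0#) → sum (λ j → f j * x j) ≈ 0#
    zero-sum {ℕ.zero}  f x z = K.refl
    zero-sum {ℕ.suc n} f x z = K.trans
      (K.+-cong (K.trans (K.*-congˡ (z Fin.zero)) (K.zeroʳ _))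
                (zero-sum (f ∘ Fin.suc) (x ∘ Fin.suc) (z ∘ Fin.suc)))
      (K.+-identityˡ 0#)

    -- Gaussian elimination
    independentOrDependent : ∀ {m n} (A : Matrix m n) (S : Subset n) →
                             IndependentColumns A S ⊎ Dependence A S
    independentOrDependent A [] = inj₁ λ x _ _ ()
    independentOrDependent A (outside ∷ S) with independentOrDependent (λ i → A i ∘ Fin.suc) S
    ... | inj₁ indep = inj₁ λ x supp ker → λ
      { Fin.zero    → supp Fin.zero λ ()
      ; (Fin.suc j) → indep (x ∘ Fin.suc) (tail-supported supp) (λ i →
          K.trans (K.sym (K.trans (K.+-congʳ (K.trans (K.*-congˡ (supp Fin.zero λ ())) (K.zeroʳ _)))
                                  (K.+-identityˡ _)))
                  (ker i)) j }
    ... | inj₂ (x , supp , ker , j , xj≉0) = inj₂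
      ( cons 0# x
      , (λ { Fin.zero _ → K.refl ; (Fin.suc j) j∉ → supp j (j∉ ∘ there) })
      , (λ i → K.trans (K.+-congʳ (K.zeroʳ _)) (K.trans (K.+-identityˡ _) (ker i)))
      , Fin.suc j , xj≉0 )
    independentOrDependent {m} A (inside ∷ S) with all? (λ i → A i Fin.zero K.≟ 0#)
    ... | yes col≈0 = inj₂
      ( cons 1# (λ _ → 0#)
      , cons-supported (λ _ _ → K.refl)
      , (λ i → K.trans (K.+-cong (K.trans (K.*-congʳ (col≈0 i)) (K.zeroˡ _))
                                 (zero-sum (A i ∘ Fin.suc) _ (λ _ → K.refl)))
                       (K.+-identityˡ 0#))
      , Fin.zero , K.1≉0 )
    ... | no ¬col≈0 with ¬∀⟶∃¬ m _ (λ i → A i Fin.zero K.≟ 0#) ¬col≈0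
    ...   | p , a≉0 with K.inverse (A p Fin.zero) a≉0
    ...     | a⁻¹ , aa⁻¹≈1 with independentOrDependent B S
      where
      B : Matrix _ _
      B i j = A i (Fin.suc j) + (- (A i Fin.zero * a⁻¹)) * A p (Fin.suc j)
    ...       | inj₁ indep = inj₁ λ x supp ker →
      let x′ = x ∘ Fin.suc
          s  = λ i → sum (λ j → A i (Fin.suc j) * x′ j)
          tail≈0 = indep x′ (tail-supported supp) λ i →
            K.trans (sum-eliminate (A i ∘ Fin.suc) (A p ∘ Fin.suc) x′ _)
              (K.trans (reduce (A i Fin.zero) (A p Fin.zero) a⁻¹ (x Fin.zero) (s i) (s p))
                (K.trans (K.+-cong (K.+-cong (ker i) (K.-‿cong (K.*-congˡ (ker p))))
                                   (K.*-congˡ (K.+-congʳ aa⁻¹≈1)))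
                  (vanish (A i Fin.zero) a⁻¹ (x Fin.zero))))
      in λ
      { Fin.zero →
          K.trans (isolate (A p Fin.zero) a⁻¹ (x Fin.zero) (s p))
            (K.trans (K.+-cong (K.+-cong (K.*-congˡ (ker p))
                                         (K.-‿cong (K.*-congˡ (zero-sum (A p ∘ Fin.suc) x′ tail≈0))))
                               (K.*-congʳ (K.+-congˡ (K.-‿cong aa⁻¹≈1))))
              (vanish′ a⁻¹ (x Fin.zero)))
      ; (Fin.suc j) → tail≈0 j }
      where
      reduce : ∀ aᵢ a b x₀ sᵢ sₚ →
        sᵢ + (- (aᵢ * b)) * sₚ ≈
        (aᵢ * x₀ + sᵢ) + - ((aᵢ * b) * (a * x₀ + sₚ)) + (aᵢ * x₀) * (a * b + - 1#)
      reduce = solve 6 (λ aᵢ a b x₀ sᵢ sₚ →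
        sᵢ :+ (:- (aᵢ :* b)) :* sₚ :=
        (aᵢ :* x₀ :+ sᵢ) :+ :- ((aᵢ :* b) :* (a :* x₀ :+ sₚ)) :+ (aᵢ :* x₀) :* (a :* b :+ :- con (+ 1))) K.refl
      vanish : ∀ aᵢ b x₀ → 0# + - ((aᵢ * b) * 0#) + (aᵢ * x₀) * (1# + - 1#) ≈ 0#
      vanish = solve 3 (λ aᵢ b x₀ →
        con (+ 0) :+ :- ((aᵢ :* b) :* con (+ 0)) :+ (aᵢ :* x₀) :* (con (+ 1) :+ :- con (+ 1)) :=
        con (+ 0)) K.refl
      isolate : ∀ a b x₀ s → x₀ ≈ b * (a * x₀ + s) + - (b * s) + (1# + - (a * b)) * x₀
      isolate = solve 4 (λ a b x₀ s →
        x₀ :=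
        b :* (a :* x₀ :+ s) :+ :- (b :* s) :+ (con (+ 1) :+ :- (a :* b)) :* x₀) K.refl
      vanish′ : ∀ b x₀ → b * 0# + - (b * 0#) + (1# + - 1#) * x₀ ≈ 0#
      vanish′ = solve 2 (λ b x₀ →
        b :* con (+ 0) :+ :- (b :* con (+ 0)) :+ (con (+ 1) :+ :- con (+ 1)) :* x₀ :=
        con (+ 0)) K.refl
    ...       | inj₂ (x , supp , ker , j , xj≉0) = inj₂
      ( cons (- (a⁻¹ * s p)) x
      , cons-supported supp
      , (λ i → K.trans (rearrange (A i Fin.zero) a⁻¹ (s i) (s p))
                 (K.trans (K.sym (sum-eliminate (A i ∘ Fin.suc) (A p ∘ Fin.suc) x _)) (ker i)))
      , Fin.suc j , xj≉0 )
      where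
      s : Fin m → Carrier
      s i = sum (λ j → A i (Fin.suc j) * x j)
      rearrange : ∀ aᵢ b sᵢ sₚ → aᵢ * (- (b * sₚ)) + sᵢ ≈ sᵢ + (- (aᵢ * b)) * sₚ
      rearrange = solve 4 (λ aᵢ b sᵢ sₚ →
        aᵢ :* (:- (b :* sₚ)) :+ sᵢ :=
        sᵢ :+ (:- (aᵢ :* b)) :* sₚ) K.refl

  independentColumns? : ∀ {m n} (A : Matrix m n) (S : Subset n) → Dec (IndependentColumns A S)
  independentColumns? A S with independentOrDependent A S
  ... | inj₁ indep                        = yes indep
  ... | inj₂ (x , supp , ker , j , xj≉0) = no λ indep → xj≉0 (indep x supp ker j)

  -- The largest size of a linearly independent set of columns.
  rank : ∀ {m n} → Matrix m n → ℕ
  rank A = maxOverSubsets λ S → if does (independentColumns? A S) then ∣ S ∣ else 0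

record Graph (n : ℕ) : Set where
  field
    adjacent    : Fin n → Fin n → Bool
    symmetric   : ∀ i j → adjacent i j ≡ adjacent j i
    irreflexive : ∀ i → adjacent i i ≡ false

  Adjacent : Rel (Fin n) _
  Adjacent i j = T (adjacent i j)

  Connected : Rel (Fin n) _
  Connected = Star Adjacent

  neighbours : Fin n → Subset n
  neighbours i = tabulate (adjacent i)

  degree : Fin n → ℕ
  degree i = ∣ neighbours i ∣

  edges : List (Fin n × Fin n)
  edges = filter (λ (i , j) → (i Finₚ.<? j) ×-dec T? (adjacent i j))
                 (cartesianProduct (allFin n) (allFin n))

  private
    -- Floyd–Warshall: Via k i j holds when some walk from i to j has all its
    -- interior vertices among the first k.
    Via : ℕ → Rel (Fin n) _
    Via ℕ.zero    i j = (i ≡ j) ⊎ Adjacent i j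
    Via (ℕ.suc k) i j = Via k i j ⊎ ∃ λ l → toℕ l ≡ k × Via k i l × Via k l j

    via? : ∀ k → Decidable (Via k)
    via? ℕ.zero    i j = (i Finₚ.≟ j) ⊎-dec T? (adjacent i j)
    via? (ℕ.suc k) i j =
      via? k i j ⊎-dec any? λ l → (toℕ l ℕₚ.≟ k) ×-dec via? k i l ×-dec via? k l j

    via-sound : ∀ k {i j} → Via k i j → Connected i j
    via-sound ℕ.zero    (inj₁ ≡.refl)          = ε
    via-sound ℕ.zero    (inj₂ e)               = e ◅ ε
    via-sound (ℕ.suc k) (inj₁ v)               = via-sound k v
    via-sound (ℕ.suc k) (inj₂ (_ , _ , v , w)) = via-sound k v ◅◅ via-sound k w

    via-weaken : ∀ k {i j} → Via 0 i j → Via k i j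
    via-weaken ℕ.zero    v = v
    via-weaken (ℕ.suc k) v = inj₁ (via-weaken k v)

    via-trans : ∀ k {i l j} → toℕ l < k → Via k i l → Via k l j → Via k i j
    via-trans (ℕ.suc k) {i} {l} {j} l<1+k v w with toℕ l ℕₚ.≟ k
    ... | yes l≡k = inj₂ (l , l≡k , into v , from w)
      where
      into : ∀ {i} → Via (ℕ.suc k) i l → Via k i l
      into (inj₁ u)                  = u
      into (inj₂ (m , m≡k , u , _)) with Finₚ.toℕ-injective (≡.trans m≡k (≡.sym l≡k))
      ... | ≡.refl = u
      from : ∀ {j} → Via (ℕ.suc k) l j → Via k l j
      from (inj₁ u)                  = u
      from (inj₂ (m , m≡k , _ , u)) with Finₚ.toℕ-injective (≡.trans m≡k (≡.sym l≡k))
      ... | ≡.refl = u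
    ... | no l≢k = compose v w
      where
      l<k : toℕ l < k
      l<k = ℕₚ.≤∧≢⇒< (ℕₚ.≤-pred l<1+k) l≢k
      compose : Via (ℕ.suc k) i l → Via (ℕ.suc k) l j → Via (ℕ.suc k) i j
      compose (inj₁ v) (inj₁ w) = inj₁ (via-trans k l<k v w)
      compose (inj₁ v) (inj₂ (m , m≡k , w , w′)) = inj₂ (m , m≡k , via-trans k l<k v w , w′)
      compose (inj₂ (m , m≡k , v , v′)) (inj₁ w) = inj₂ (m , m≡k , v , via-trans k l<k v′ w)
      compose (inj₂ (m , m≡k , v , _)) (inj₂ (m′ , m′≡k , _ , w′))
        with Finₚ.toℕ-injective (≡.trans m≡k (≡.sym m′≡k))
      ... | ≡.refl = inj₂ (m , m≡k , v , w′)

    via-complete : ∀ {i j} → Connected i j → Via n i j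
    via-complete ε                 = via-weaken n (inj₁ ≡.refl)
    via-complete (_◅_ {j = l} e p) =
      via-trans n (Finₚ.toℕ<n l) (via-weaken n (inj₂ e)) (via-complete p)

  connected? : Decidable Connected
  connected? i j = map′ (via-sound n) via-complete (via? n i j)

  component : Fin n → Subset n
  component i = tabulate (λ j → does (connected? i j))

  components : List (Subset n)
  components = deduplicate (≡-dec _≟ᵇ_) (map component (allFin n))

  ω : ℕ
  ω = length components

  θ : ℤ
  θ = + length edges ℤ.- + n ℤ.+ + ω

-- The increasing enumeration of a subset.
member : ∀ {n} (S : Subset n) → Fin ∣ S ∣ → Fin n
member (inside  ∷ S) Fin.zero    = Fin.zero
member (inside  ∷ S) (Fin.suc i) = Fin.suc (member S i)
member (outside ∷ S) i           = Fin.suc (member S i)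

_[_] : ∀ {n} → Graph n → (S : Subset n) → Graph ∣ S ∣
G [ S ] = record
  { adjacent    = λ i j → adjacent (member S i) (member S j)
  ; symmetric   = λ i j → symmetric (member S i) (member S j)
  ; irreflexive = λ i → irreflexive (member S i)
  }
  where open Graph G

next : ∀ {p} → Fin p → Fin p
next {ℕ.suc p} a = ℕ.suc (toℕ a) mod ℕ.suc p

-- cycle lists the vertices of an induced cycle C_p in cyclic order.
record IsInducedCycle {n} (G : Graph n) (p : ℕ) (cycle : Fin p → Fin n) : Set where
  open Graph G
  field
    3≤p       : 3 ≤ p
    injective : Injective _≡_ _≡_ cycle
    adjacency : ∀ a b → Adjacent (cycle a) (cycle b) ⇔ (b ≡ next a ⊎ a ≡ next b)

record PendantCycle {n} (G : Graph n) (p : ℕ) : Set where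
  open Graph G
  field
    cycle          : Fin p → Fin n
    isInducedCycle : IsInducedCycle G p cycle
    root           : Fin p
    root-degree    : degree (cycle root) ≡ 3
    other-degree   : ∀ a → ¬ (a ≡ root) → degree (cycle a) ≡ 2

  v : Fin n
  v = cycle root

  vertices : Subset n
  vertices = tabulate (λ x → does (any? (λ a → cycle a Finₚ.≟ x)))

  V[F] : Subset n
  V[F] = ∁ vertices

  V[H] : Subset n
  V[H] = V[F] ∪ ⁅ v ⁆

module GainGraphs {c ℓ₁ ℓ₂} (ℝ : RealNumbers c ℓ₁ ℓ₂) where
  open ComplexNumbers ℝ
  private
    module R = RealNumbers ℝ
    module C = DiscreteField ℂ
  open LinearAlgebra ℂ
  open RawMonoidOps C.*-rawMonoid using () renaming (sum to product; _×_ to power)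

  record GainGraph (n : ℕ) : Set (c ⊔ ℓ₁ ⊔ ℓ₂) where
    field
      graph : Graph n
    open Graph graph public
    field
      -- values off the edges are unconstrained and unused
      gain      : Fin n → Fin n → C.Carrier
      gain-unit : ∀ i j → Adjacent i j → HasModulus (gain i j) R.1#
      gain-conj : ∀ i j → Adjacent i j → gain j i C.≈ conj (gain i j)

    A : Matrix n n
    A i j = if adjacent i j then gain i j else C.0#

  _⟦_⟧ : ∀ {n} → GainGraph n → (S : Subset n) → GainGraph ∣ S ∣
  Φ ⟦ S ⟧ = record
    { graph     = graph [ S ]
    ; gain      = λ i j → gain (member S i) (member S j)
    ; gain-unit = λ i j → gain-unit (member S i) (member S j)
    ; gain-conj = λ i j → gain-conj (member S i) (member S j)
    }
    where open GainGraph Φ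

  adjacencyMatrix : ∀ {n} → Graph n → Matrix n n
  adjacencyMatrix G i j = if Graph.adjacent G i j then C.1# else C.0#

  r : ∀ {n} → Graph n → ℕ
  r G = rank (adjacencyMatrix G)

  rᵠ : ∀ {n} → GainGraph n → ℕ
  rᵠ Φ = rank (GainGraph.A Φ)

  module _ {n p} (Φ : GainGraph n) (cycle : Fin p → Fin n) where
    open GainGraph Φ

    cycleGain : C.Carrier
    cycleGain = product (λ a → gain (cycle a) (cycle (next a)))

    TypeB : Set ℓ₁
    TypeB = 2 ∣ p × ¬ (cycleGain C.≈ power (p / 2) (C.- C.1#))

{-# OPTIONS --safe #-}

-- Over any field, let A be the matrix of a graph G with weights satisfying
-- a(x,y) a(y,x) = 1 on edges.  Rescaling along a spanning forest makes every
-- forest edge have weight 1, so A differs, up to diagonal scaling, from the 0-1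
-- matrix in at most θ(G) edges; hence r(Φ) ≤ r(G) + 2θ(G), and likewise for F and H.
--
-- Pivoting on two consecutive vertices of degree 2 lowers the rank by 2 and
-- replaces a path of three edges of weights a, b, c by one edge of weight -abc.
-- Hence a pendant cycle of order p collapses, for odd p, to a loop at v, and for
-- even p, to a single edge at v whose weight vanishes exactly when the cycle is
-- not of Type B: r(Φ) = p-2 + r(Hᵠ) if it is not, and r(Φ) = p + r(Fᵠ) if it is.
-- The same applies to G, whose cycle is of Type B iff p ≡ 2 (mod 4).
--
-- As θ(F) and θ(H) are at most θ(G) - 1, the assumption r(Φ) = r(G) + 2θ(G)
-- excludes every case but p ≡ 0 (mod 4) with Type B, where
--   r(Φ) = p + r(Fᵠ) ≤ p + r(F) + 2θ(F) ≤ p + r(H) + 2θ(F) ≤ r(G) + 2θ(G)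
-- collapses to equalities.

module Submission where

open import Defs
import Algebra.Definitions.RawMonoid as RawMonoidOps
import Algebra.Properties.CommutativeMonoid.Sum as CommutativeMonoidSum
import Algebra.Properties.Ring as RingProperties
import Algebra.Properties.Semiring.Sum as SemiringSum
open import Data.Bool.Base using (Bool; true; false; T; if_then_else_)
open import Data.Bool.Properties using (T-≡) renaming (_≟_ to _≟ᵇ_)
open import Data.Empty using (⊥-elim)
open import Data.Fin.Base as Fin using (Fin; toℕ; fromℕ<; splitAt; join; punchIn; punchOut)
open import Data.Fin.Permutation using (Permutation; permutation)
open import Data.Fin.Properties as Finₚ using (all?; any?; ¬∀⟶∃¬; injective⇒≤; join-splitAt; splitAt-join; punchInᵢ≢i; punchOut-punchIn; punchOut-cong; toℕ<n; toℕ-injective; toℕ-fromℕ<)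
open import Data.Fin.Subset using (Subset; inside; outside; ∣_∣; _∈_; _∉_)
open import Data.Fin.Subset.Properties using (_∈?_; x∈∁p⇒x∉p; x∉p⇒x∈∁p; x∈p∪q⁻; x∈p∪q⁺; x∈⁅x⁆; x∈⁅y⁆⇒x≡y)
open import Data.Integer.Base as ℤ using (+_) renaming (_+_ to _+ℤ_; _*_ to _*ℤ_)
import Data.Integer.Properties as ℤₚ
open import Data.List.Base using (List; []; _∷_; length; lookup; allFin; cartesianProduct; map; _++_)
open import Data.List.Membership.Propositional using () renaming (_∈_ to _∈ˡ_)
open import Data.List.Membership.Propositional.Properties using (∈-filter⁺; ∈-filter⁻; ∈-cartesianProduct⁺; ∈-allFin; ∈-lookup; ∈-map⁺; ∈-map⁻; ∈-deduplicate⁺; ∈-deduplicate⁻; ∈-++⁺ˡ; ∈-++⁺ʳ)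
open import Data.List.Properties using (length-++; length-map)
import Data.List.Relation.Unary.All as All
open import Data.List.Relation.Unary.AllPairs using (_∷_)
open import Data.List.Relation.Unary.Any as Any using (here; there)
open import Data.List.Relation.Unary.Any.Properties using (lookup-index)
import Data.List.Relation.Unary.Unique.DecPropositional.Properties as UniqueDec
open import Data.List.Relation.Unary.Unique.Propositional using (Unique)
open import Data.List.Relation.Unary.Unique.Propositional.Properties using (allFin⁺; cartesianProduct⁺; filter⁺)
open import Data.Maybe.Base using (Maybe; just; nothing)
open import Data.Nat.Base using (ℕ; zero; suc; _∸_; _≤_; _<_; z≤n; s≤s) renaming (_+_ to _+ℕ_; _*_ to _*ℕ_)
open import Data.Nat.Divisibility using (_∣_; divides)
open import Data.Nat.DivMod using (_mod_; _%_; _/_; m%n<n; m%n%n≡m%n; [m+n]%n≡m%n; m<n⇒m%n≡m; %-distribˡ-+; m*n/n≡m)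
import Data.Nat.Properties as ℕₚ
import Data.Nat.Solver
open import Data.Product.Base using (∃; _×_; _,_; proj₁; proj₂; swap)
open import Data.Sum.Base as Sum using (_⊎_; inj₁; inj₂; [_,_]′)
open import Data.Vec.Base as Vec using ([]; _∷_; here; there; tabulate)
open import Data.Vec.Functional using (Vector) renaming ([] to []ᵛ; _∷_ to infixr 5 _∷ᵛ_)
open import Data.Vec.Properties using (≡-dec; lookup∘tabulate; tabulate-cong; lookup⇒[]=; []=⇒lookup)
open import Function.Base using (_∘_; id)
open import Function.Bundles using (Equivalence)
open import Function.Definitions using (Injective)
open import Level using (_⊔_)
open import Relation.Binary.Construct.Closure.ReflexiveTransitive as Star using (ε; _◅_; _◅◅_)
open import Relation.Binary.Definitions using (tri<; tri≈; tri>)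
open import Relation.Binary.PropositionalEquality.Core as ≡ using (_≡_; _≢_)
open import Relation.Binary.PropositionalEquality.Properties using (module ≡-Reasoning)
open import Relation.Nullary using (¬_; Dec; yes; no; does)
open import Relation.Nullary.Decidable using (dec-true; ¬?; decidable-stable)

-- Gains and 0-1 entries are both weights with `a(x,y) a(y,x) = 1`, so each rank formula is proved
-- once over a field and applied to Φ and to `G`. Characteristic 2 is excluded because the cycle of
-- `G`, whose product is 1, is classified by comparing 1 with `(-1)^(p/2)`. The obstacle to
-- induction on `p` is that pivoting leads out of simple graphs, to parallel edges and loops. The
-- induction therefore runs over an open weighted walk whose two ends are added into `v`; parallel
-- edges and loops are then mere sums of entries. A drop of θ by one is worth 2 in the extremal
-- equation, and each excluded case loses less: nothing if Φ and `G` both reduce to `H`, nothing if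
-- `G` reduces to `F` and Φ is bounded through `F`, and 1 for odd `p`, where both leave `H` with a
-- loop at `v` but the loop weights may differ. In the remaining case Φ reduces to `F` and `G` to
-- `H`. Besides the chain through `F`, also `r(Hᵠ) ≤ r(H) + 2θ(H) ≤ r(H) + 2θ(G) - 2 = r(Fᵠ) ≤
-- r(Hᵠ)` collapses, which gives the claims about `Hᵠ`.

-- Rank as the least inner dimension of a factorisation

maxOverSubsets-upper : ∀ {n} (f : Subset n → ℕ) S → f S ≤ maxOverSubsets f
maxOverSubsets-upper f []            = ℕₚ.≤-refl
maxOverSubsets-upper f (inside  ∷ S) = ℕₚ.≤-trans (maxOverSubsets-upper (f ∘ (inside ∷_)) S) (ℕₚ.m≤m⊔n _ _)
maxOverSubsets-upper f (outside ∷ S) = ℕₚ.≤-trans (maxOverSubsets-upper (f ∘ (outside ∷_)) S) (ℕₚ.m≤n⊔m _ _)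

maxOverSubsets-least : ∀ {n} (f : Subset n → ℕ) k → (∀ S → f S ≤ k) → maxOverSubsets f ≤ k
maxOverSubsets-least {zero}  f k f≤k = f≤k []
maxOverSubsets-least {suc n} f k f≤k = ℕₚ.⊔-lub
  (maxOverSubsets-least (f ∘ (inside ∷_)) k (f≤k ∘ (inside ∷_)))
  (maxOverSubsets-least (f ∘ (outside ∷_)) k (f≤k ∘ (outside ∷_)))

module RankTheory {c ℓ} (K : DiscreteField c ℓ) where
  open DiscreteField K hiding (zero)
  open LinearAlgebra K
  open IntegerSolver commutativeRing
  open SemiringSum semiring using (sum-cong-≋; sum-replicate-zero; ∑-distrib-+; sum-remove; *-distribˡ-sum; *-distribʳ-sum)

  sum-zero : ∀ {n} {u : Fin n → Carrier} → (∀ l → u l ≈ 0#) → sum u ≈ 0#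
  sum-zero {n} u≈0 = trans (sum-cong-≋ u≈0) (sum-replicate-zero n)

  infix 4 _≋_
  _≋_ : {I J : Set} → (I → J → Carrier) → (I → J → Carrier) → Set ℓ
  A ≋ B = ∀ i j → A i j ≈ B i j

  -- Factorisation rank makes sense for arbitrary index sets, so that vertices
  -- can be relabelled freely.
  RankAtMost : {I J : Set} → (I → J → Carrier) → ℕ → Set (c ⊔ ℓ)
  RankAtMost {I} {J} A k = ∃ λ (B : I → Fin k → Carrier) → ∃ λ (C : Fin k → J → Carrier) →
    A ≋ λ i j → sum (λ l → B i l * C l j)

  HasRank : {I J : Set} → (I → J → Carrier) → ℕ → Set (c ⊔ ℓ)
  HasRank A k = RankAtMost A k × (∀ k′ → RankAtMost A k′ → k ≤ k′)

  module _ {I J : Set} where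

    rankAtMost-cong : {A B : I → J → Carrier} → A ≋ B → ∀ {k} → RankAtMost A k → RankAtMost B k
    rankAtMost-cong A≋B (X , Y , eq) = X , Y , λ i j → trans (sym (A≋B i j)) (eq i j)

    hasRank-cong : {A B : I → J → Carrier} → A ≋ B → ∀ {k} → HasRank A k → HasRank B k
    hasRank-cong A≋B (upper , lower) =
      rankAtMost-cong A≋B upper , λ k′ → lower k′ ∘ rankAtMost-cong (λ i j → sym (A≋B i j))

    hasRank-unique : {A : I → J → Carrier} → ∀ {k l} → HasRank A k → HasRank A l → k ≡ l
    hasRank-unique (upper , lower) (upper′ , lower′) = ℕₚ.≤-antisym (lower _ upper′) (lower′ _ upper)

    rankAtMost-submatrix : {I′ J′ : Set} (f : I′ → I) (h : J′ → J) {A : I → J → Carrier} → ∀ {k} →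
      RankAtMost A k → RankAtMost (λ i j → A (f i) (h j)) k
    rankAtMost-submatrix f h (X , Y , eq) = X ∘ f , (λ l → Y l ∘ h) , λ i j → eq (f i) (h j)

    rankAtMost-outer : (x : I → Carrier) (y : J → Carrier) → RankAtMost (λ i j → x i * y j) 1
    rankAtMost-outer x y = (λ i _ → x i) , (λ _ → y) , λ i j → sym (+-identityʳ _)

    rankAtMost-scale : (x : I → Carrier) (y : J → Carrier) {A : I → J → Carrier} → ∀ {k} →
      RankAtMost A k → RankAtMost (λ i j → x i * A i j * y j) k
    rankAtMost-scale x y (X , Y , eq) = (λ i l → x i * X i l) , (λ l j → Y l j * y j) , λ i j →
      trans (*-congʳ (*-congˡ (eq i j)))
        (trans (*-congʳ (*-distribˡ-sum (x i) (λ l → X i l * Y l j)))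
          (trans (*-distribʳ-sum (y j) (λ l → x i * (X i l * Y l j))) (sum-cong-≋ λ l → regroup (x i) (X i l) (Y l j) (y j))))
      where
      regroup : ∀ a b d e → a * (b * d) * e ≈ a * b * (d * e)
      regroup = solve 4 (λ a b d e → a :* (b :* d) :* e := a :* b :* (d :* e)) refl

    private
      sum-splitAt : ∀ k {l} (u : Fin k → Carrier) (w : Fin l → Carrier) →
        sum (λ m → [ u , w ]′ (splitAt k m)) ≈ sum u + sum w
      sum-splitAt zero    u w = sym (+-identityˡ _)
      sum-splitAt (suc k) u w = trans
        (+-congˡ (trans (sum-cong-≋ (λ m → reflexive (shift m))) (sum-splitAt k (u ∘ Fin.suc) w)))
        (sym (+-assoc _ _ _))
        where
        shift : ∀ m → [ u , w ]′ (splitAt (suc k) (Fin.suc m)) ≡ [ u ∘ Fin.suc , w ]′ (splitAt k m)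
        shift m with splitAt k m
        ... | inj₁ _ = ≡.refl
        ... | inj₂ _ = ≡.refl

    rankAtMost-+ : {A B : I → J → Carrier} → ∀ {k l} → RankAtMost A k → RankAtMost B l →
      RankAtMost (λ i j → A i j + B i j) (k +ℕ l)
    rankAtMost-+ {k = k} (X , Y , eq) (X′ , Y′ , eq′) =
        (λ i → [ X i , X′ i ]′ ∘ splitAt k)
      , (λ m j → [ (λ l → Y l j) , (λ l → Y′ l j) ]′ (splitAt k m))
      , λ i j → trans (+-cong (eq i j) (eq′ i j)) (trans (sym (sum-splitAt k _ _))
          (sum-cong-≋ λ m → reflexive (merge i j (splitAt k m))))
      where
      merge : ∀ i j s →
        [ (λ l → X i l * Y l j) , (λ l → X′ i l * Y′ l j) ]′ s ≡
        [ X i , X′ i ]′ s * [ (λ l → Y l j) , (λ l → Y′ l j) ]′ s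
      merge i j (inj₁ _) = ≡.refl
      merge i j (inj₂ _) = ≡.refl

    rankAtMost-suc : {A : I → J → Carrier} → ∀ {k} → RankAtMost A k → RankAtMost A (suc k)
    rankAtMost-suc (X , Y , eq) =
        (λ { i Fin.zero → 0# ; i (Fin.suc l) → X i l })
      , (λ { Fin.zero j → 0# ; (Fin.suc l) j → Y l j })
      , λ i j → trans (eq i j) (sym (trans (+-congʳ (zeroˡ _)) (+-identityˡ _)))

    rankAtMost-≤ : {A : I → J → Carrier} → ∀ {k l} → k ≤ l → RankAtMost A k → RankAtMost A l
    rankAtMost-≤ {A} {k} k≤l low with ℕₚ.m≤n⇒∃[o]m+o≡n k≤l
    ... | o , ≡.refl = ≡.subst (RankAtMost A) (ℕₚ.+-comm o k) (pad o)
      where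
      pad : ∀ o → RankAtMost A (o +ℕ k)
      pad zero    = low
      pad (suc o) = rankAtMost-suc (pad o)

    rankAtMost-zero : {A : I → J → Carrier} → RankAtMost A 0 → ∀ i j → A i j ≈ 0#
    rankAtMost-zero (_ , _ , eq) = eq

    rankAtMost-null : {A : I → J → Carrier} → (∀ i j → A i j ≈ 0#) → RankAtMost A 0
    rankAtMost-null A≈0 = (λ _ ()) , (λ ()) , A≈0

    -- The Schur complement of the entry `A i₀ j₀`, with the pivot row and column kept: they become
    -- zero once `a⁻¹` inverts the pivot, so no index type of remaining rows has to be built.
    schur : (A : I → J → Carrier) → I → J → Carrier → I → J → Carrier
    schur A i₀ j₀ a⁻¹ i j = A i j + - (A i j₀ * a⁻¹ * A i₀ j)

    -- `A` is its Schur complement plus the outer product of the pivot column, scaled by `a⁻¹`, and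
    -- the pivot row.
    rankAtMost-schur⁺ : ∀ {A : I → J → Carrier} i₀ j₀ a⁻¹ {k} →
      RankAtMost (schur A i₀ j₀ a⁻¹) k → RankAtMost A (suc k)
    rankAtMost-schur⁺ {A} i₀ j₀ a⁻¹ low =
      rankAtMost-cong (λ i j → restore (A i j) _)
        (rankAtMost-+ (rankAtMost-outer (λ i → A i j₀ * a⁻¹) (A i₀)) low)
      where
      restore : ∀ x y → y + (x + - y) ≈ x
      restore = solve 2 (λ x y → y :+ (x :+ :- y) := x) refl

    private
      combine : ∀ {k} (x y z : Fin k → Carrier) s →
        sum (λ l → x l * z l) + s * sum (λ l → y l * z l) ≈ sum (λ l → (x l + s * y l) * z l)
      combine x y z s = trans (+-congˡ (*-distribˡ-sum s (λ l → y l * z l)))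
        (trans (sym (∑-distrib-+ (λ l → x l * z l) _))
          (sum-cong-≋ λ l → factor (x l) (y l) (z l) s))
        where
        factor : ∀ x y z s → x * z + s * (y * z) ≈ (x + s * y) * z
        factor = solve 4 (λ x y z s → x :* z :+ s :* (y :* z) := (x :+ s :* y) :* z) refl

    -- In a factorisation A = XY every column z of the reduced right factor is
    -- orthogonal to the pivot row of X, so one coordinate of z is redundant.
    rankAtMost-schur⁻ : ∀ {A : I → J → Carrier} i₀ j₀ a⁻¹ → A i₀ j₀ * a⁻¹ ≈ 1# → ∀ {k} →
      RankAtMost A (suc k) → RankAtMost (schur A i₀ j₀ a⁻¹) k
    rankAtMost-schur⁻ {A} i₀ j₀ a⁻¹ aa⁻¹≈1 {k} (X , Y , eq) with all? (λ l → X i₀ l ≟ 0#)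
    ... | yes row≈0 = ⊥-elim (1≉0 (trans (sym aa⁻¹≈1) (trans (*-congʳ A≈0) (zeroˡ _))))
      where
      A≈0 : A i₀ j₀ ≈ 0#
      A≈0 = trans (eq i₀ j₀) (sum-zero λ l → trans (*-congʳ (row≈0 l)) (zeroˡ (Y l j₀)))
    ... | no ¬row≈0 with ¬∀⟶∃¬ (suc k) _ (λ l → X i₀ l ≟ 0#) ¬row≈0
    ...   | l , b≉0 with inverse (X i₀ l) b≉0
    ...     | b⁻¹ , bb⁻¹≈1 = X″ , (λ m → Z (punchIn l m)) , factorise
      where
      open import Relation.Binary.Reasoning.Setoid setoid
      Z : Fin (suc k) → J → Carrier
      Z m j = Y m j + (- (a⁻¹ * A i₀ j)) * Y m j₀
      -- Orthogonality to row `i₀` expresses `Z l` through the other coordinates of `Z`;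
      -- substituting this into `XZ` turns the left factor into `X″`.
      X″ : I → Fin k → Carrier
      X″ i m = X i (punchIn l m) + (- (X i l * b⁻¹)) * X i₀ (punchIn l m)
      XZ : ∀ i j → sum (λ m → X i m * Z m j) ≈ schur A i₀ j₀ a⁻¹ i j
      XZ i j = begin
        sum (λ m → X i m * Z m j)
          ≈⟨ sum-cong-≋ (λ m → *-comm (X i m) (Z m j)) ⟩
        sum (λ m → Z m j * X i m)
          ≈⟨ combine (λ m → Y m j) (λ m → Y m j₀) (X i) (- (a⁻¹ * A i₀ j)) ⟨
        sum (λ m → Y m j * X i m) + (- (a⁻¹ * A i₀ j)) * sum (λ m → Y m j₀ * X i m)
          ≈⟨ +-cong (entry j) (*-congˡ (entry j₀)) ⟩
        A i j + (- (a⁻¹ * A i₀ j)) * A i j₀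
          ≈⟨ solve 4 (λ x b y z → x :+ (:- (b :* y)) :* z := x :+ :- (z :* b :* y)) refl
               (A i j) a⁻¹ (A i₀ j) (A i j₀) ⟩
        schur A i₀ j₀ a⁻¹ i j ∎
        where
        entry : ∀ j → sum (λ m → Y m j * X i m) ≈ A i j
        entry j = trans (sum-cong-≋ (λ m → *-comm (Y m j) (X i m))) (sym (eq i j))
      orthogonal : ∀ j → sum (λ m → X i₀ m * Z m j) ≈ 0#
      orthogonal j = trans (XZ i₀ j) (trans (+-congˡ (-‿cong (*-congʳ aa⁻¹≈1)))
        (solve 1 (λ x → x :+ :- (con (+ 1) :* x) := con (+ 0)) refl (A i₀ j)))
      factorise : schur A i₀ j₀ a⁻¹ ≋ λ i j → sum (λ m → X″ i m * Z (punchIn l m) j)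
      factorise i j = begin
        schur A i₀ j₀ a⁻¹ i j
          ≈⟨ XZ i j ⟨
        sum (λ m → X i m * Z m j)
          ≈⟨ sum-remove {i = l} (λ m → X i m * Z m j) ⟩
        X i l * Z l j + rest i
          ≈⟨ drop (X i l) b⁻¹ (X i₀ l) (Z l j) (rest i) (rest i₀) ⟩
        rest i + (- (X i l * b⁻¹)) * rest i₀
          + X i l * b⁻¹ * (X i₀ l * Z l j + rest i₀)
          + X i l * Z l j * (1# + - (X i₀ l * b⁻¹))
          ≈⟨ +-cong (+-congˡ (*-congˡ (trans (sym (sum-remove {i = l} (λ m → X i₀ m * Z m j))) (orthogonal j))))
                    (*-congˡ (+-congˡ (-‿cong bb⁻¹≈1))) ⟩
        rest i + (- (X i l * b⁻¹)) * rest i₀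
          + X i l * b⁻¹ * 0# + X i l * Z l j * (1# + - 1#)
          ≈⟨ solve 3 (λ x y z → x :+ y :* con (+ 0) :+ z :* (con (+ 1) :+ :- con (+ 1)) := x) refl _ _ _ ⟩
        rest i + (- (X i l * b⁻¹)) * rest i₀
          ≈⟨ combine (λ m → X i (punchIn l m)) (λ m → X i₀ (punchIn l m)) (λ m → Z (punchIn l m) j) _ ⟩
        sum (λ m → X″ i m * Z (punchIn l m) j) ∎
        where
        rest : I → Carrier
        rest i = sum (λ m → X i (punchIn l m) * Z (punchIn l m) j)
        -- A polynomial identity, so that the solver applies: the last two terms carry the factors
        -- that orthogonality and `bb⁻¹≈1` make zero afterwards.
        drop : ∀ x b⁻¹ b z r r₀ →
          x * z + r ≈ r + (- (x * b⁻¹)) * r₀ + x * b⁻¹ * (b * z + r₀) + x * z * (1# + - (b * b⁻¹))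
        drop = solve 6 (λ x b⁻¹ b z r r₀ →
          x :* z :+ r :=
          r :+ (:- (x :* b⁻¹)) :* r₀ :+ x :* b⁻¹ :* (b :* z :+ r₀) :+ x :* z :* (con (+ 1) :+ :- (b :* b⁻¹))) refl

    -- The rows of the left factor are copied or replaced by zero, while the right factor stays.
    rankAtMost-rows : {I′ : Set} {A : I → J → Carrier} {A′ : I′ → J → Carrier} →
      (∀ i → (∀ j → A i j ≈ 0#) ⊎ ∃ λ i′ → ∀ j → A i j ≈ A′ i′ j) →
      ∀ {k} → RankAtMost A′ k → RankAtMost A k
    rankAtMost-rows {I′} {A} {A′} row {k} (X , Y , eq) = (λ i → X′ i (row i)) , Y , λ i → factorise i (row i)
      where
      Row : I → Set ℓ
      Row i = (∀ j → A i j ≈ 0#) ⊎ ∃ λ i′ → ∀ j → A i j ≈ A′ i′ j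
      X′ : ∀ i → Row i → Fin k → Carrier
      X′ i (inj₁ _)        l = 0#
      X′ i (inj₂ (i′ , _)) l = X i′ l
      factorise : ∀ i (r : Row i) j → A i j ≈ sum (λ l → X′ i r l * Y l j)
      factorise i (inj₁ A≈0)       j = trans (A≈0 j) (sym (sum-zero λ l → zeroˡ (Y l j)))
      factorise i (inj₂ (i′ , A≈)) j = trans (A≈ j) (eq i′ j)

  rankAtMost-transpose : {I J : Set} {A : I → J → Carrier} → ∀ {k} →
    RankAtMost A k → RankAtMost (λ j i → A i j) k
  rankAtMost-transpose (X , Y , eq) = (λ j l → Y l j) , (λ l i → X i l) , λ j i →
    trans (eq i j) (sum-cong-≋ λ l → *-comm (X i l) (Y l j))

  module _ {I J : Set} where

    rankAtMost-columns : {J′ : Set} {A : I → J → Carrier} {A′ : I → J′ → Carrier} →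
      (∀ j → (∀ i → A i j ≈ 0#) ⊎ ∃ λ j′ → ∀ i → A i j ≈ A′ i j′) →
      ∀ {k} → RankAtMost A′ k → RankAtMost A k
    rankAtMost-columns column = rankAtMost-transpose ∘ rankAtMost-rows column ∘ rankAtMost-transpose

  module _ {I J I′ J′ : Set} {f : I′ → I} {h : J′ → J} where

    -- Repeated rows and columns do not change the rank, so `f` and `h` may take a value twice. One
    -- lemma thus serves both to relabel vertices along a surjection and to drop zero rows and
    -- columns.
    hasRank-extend : {A : I → J → Carrier} →
      (∀ i → (∀ j → A i j ≈ 0#) ⊎ ∃ λ i′ → i ≡ f i′) →
      (∀ j → (∀ i → A i j ≈ 0#) ⊎ ∃ λ j′ → j ≡ h j′) → ∀ {k} →
      HasRank (λ i j → A (f i) (h j)) k → HasRank A k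
    hasRank-extend {A} rows columns (upper , lower) =
      rankAtMost-rows row (rankAtMost-columns column upper) , λ k′ → lower k′ ∘ rankAtMost-submatrix f h
      where
      row : ∀ i → (∀ j → A i j ≈ 0#) ⊎ ∃ λ i′ → ∀ j → A i j ≈ A (f i′) j
      row i with rows i
      ... | inj₁ zeros         = inj₁ zeros
      ... | inj₂ (i′ , ≡.refl) = inj₂ (i′ , λ j → refl)
      column : ∀ j → (∀ i → A (f i) j ≈ 0#) ⊎ ∃ λ j′ → ∀ i → A (f i) j ≈ A (f i) (h j′)
      column j with columns j
      ... | inj₁ zeros         = inj₁ (zeros ∘ f)
      ... | inj₂ (j′ , ≡.refl) = inj₂ (j′ , λ i → refl)

    private
      zeroRow : ∀ a x → a * x ≈ 1# → ∀ y → y + - (a * x * y) ≈ 0#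
      zeroRow a x ax≈1 y = trans (+-congˡ (-‿cong (*-congʳ ax≈1)))
        (solve 1 (λ y → y :+ :- (con (+ 1) :* y) := con (+ 0)) refl y)
      zeroColumn : ∀ a x → a * x ≈ 1# → ∀ y → y + - (y * x * a) ≈ 0#
      zeroColumn a x ax≈1 y = trans (solve 3 (λ a x y → y :+ :- (y :* x :* a) := y :+ :- (a :* x :* y)) refl a x y)
        (zeroRow a x ax≈1 y)

    -- The pivot row and column of the Schur complement vanish, so its restriction to `f` and `h`
    -- has the same rank; adding the pivot back raises the rank by exactly one.
    hasRank-pivot : ∀ {A : I → J → Carrier} i₀ j₀ a⁻¹ → A i₀ j₀ * a⁻¹ ≈ 1# →
      (∀ i → i ≡ i₀ ⊎ ∃ λ i′ → i ≡ f i′) → (∀ j → j ≡ j₀ ⊎ ∃ λ j′ → j ≡ h j′) → ∀ {k} →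
      HasRank (λ i j → schur A i₀ j₀ a⁻¹ (f i) (h j)) k → HasRank A (suc k)
    hasRank-pivot {A} i₀ j₀ a⁻¹ aa⁻¹≈1 rows columns (upper , lower) =
      rankAtMost-schur⁺ i₀ j₀ a⁻¹ (rankAtMost-rows row (rankAtMost-columns column upper)) , lower′
      where
      row : ∀ i → (∀ j → schur A i₀ j₀ a⁻¹ i j ≈ 0#) ⊎ ∃ λ i′ → ∀ j → schur A i₀ j₀ a⁻¹ i j ≈ schur A i₀ j₀ a⁻¹ (f i′) j
      row i with rows i
      ... | inj₁ ≡.refl       = inj₁ λ j → zeroRow _ _ aa⁻¹≈1 _
      ... | inj₂ (i′ , ≡.refl) = inj₂ (i′ , λ j → refl)
      column : ∀ j → (∀ i → schur A i₀ j₀ a⁻¹ (f i) j ≈ 0#) ⊎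
                     ∃ λ j′ → ∀ i → schur A i₀ j₀ a⁻¹ (f i) j ≈ schur A i₀ j₀ a⁻¹ (f i) (h j′)
      column j with columns j
      ... | inj₁ ≡.refl       = inj₁ λ i → zeroColumn _ _ aa⁻¹≈1 _
      ... | inj₂ (j′ , ≡.refl) = inj₂ (j′ , λ i → refl)
      lower′ : ∀ k′ → RankAtMost A k′ → suc _ ≤ k′
      lower′ zero     low = ⊥-elim (1≉0 (trans (sym aa⁻¹≈1)
        (trans (*-congʳ (rankAtMost-zero low i₀ j₀)) (zeroˡ _))))
      lower′ (suc k′) low = s≤s (lower k′ (rankAtMost-submatrix f h (rankAtMost-schur⁻ i₀ j₀ a⁻¹ aa⁻¹≈1 low)))

  module _ {I J I′ : Set} {f : I′ → I} where

    rankAtMost-insertRow : {A : I → J → Carrier} (e : I) → (∀ i → i ≡ e ⊎ ∃ λ i′ → i ≡ f i′) → ∀ {k} →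
      RankAtMost (λ i j → A (f i) j) k → RankAtMost A (suc k)
    rankAtMost-insertRow {A} e cover low =
      rankAtMost-cong (λ i j → solve 2 (λ x y → x :+ (y :+ :- x) := y) refl _ _)
        (rankAtMost-+ (rankAtMost-outer χ (A e)) (rankAtMost-rows row low))
      where
      -- `χ` follows the branch taken by `cover` rather than equality with `e`, so it agrees with
      -- `row` even if `e` is also a value of `f`.
      χ : I → Carrier
      χ i with cover i
      ... | inj₁ _ = 1#
      ... | inj₂ _ = 0#
      row : ∀ i → (∀ j → A i j + - (χ i * A e j) ≈ 0#) ⊎ ∃ λ i′ → ∀ j → A i j + - (χ i * A e j) ≈ A (f i′) j
      row i with cover i
      ... | inj₁ ≡.refl        = inj₁ λ j → solve 1 (λ x → x :+ :- (con (+ 1) :* x) := con (+ 0)) refl _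
      ... | inj₂ (i′ , ≡.refl) = inj₂ (i′ , λ j → solve 2 (λ x y → x :+ :- (con (+ 0) :* y) := x) refl _ _)

  module _ {I I′ : Set} {f : I′ → I} where

    rankAtMost-insertVertex : {A : I → I → Carrier} (e : I) → (∀ i → i ≡ e ⊎ ∃ λ i′ → i ≡ f i′) → ∀ {k} →
      RankAtMost (λ i j → A (f i) (f j)) k → RankAtMost A (suc (suc k))
    rankAtMost-insertVertex e cover low = rankAtMost-insertRow e cover
      (rankAtMost-transpose (rankAtMost-insertRow e cover (rankAtMost-transpose low)))

    -- Two pivots, at `(e₁ , e₂)` and at `(e₂ , e₁)`. As both diagonal entries vanish, the first
    -- changes neither the second pivot nor its row and column, so the two corrections simply add
    -- up.
    hasRank-pivotPair : ∀ {A : I → I → Carrier} e₁ e₂ b₁₂ b₂₁ →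
      A e₁ e₂ * b₁₂ ≈ 1# → A e₂ e₁ * b₂₁ ≈ 1# → A e₁ e₁ ≈ 0# → A e₂ e₂ ≈ 0# →
      (∀ i → i ≡ e₁ ⊎ i ≡ e₂ ⊎ ∃ λ i′ → i ≡ f i′) → ∀ {k} →
      HasRank (λ i j → A (f i) (f j) + - (A (f i) e₂ * b₁₂ * A e₁ (f j)) + - (A (f i) e₁ * b₂₁ * A e₂ (f j))) k →
      HasRank A (suc (suc k))
    hasRank-pivotPair {A} e₁ e₂ b₁₂ b₂₁ inv₁₂ inv₂₁ A₁₁≈0 A₂₂≈0 cover rk =
      hasRank-pivot {f = f₂} {h = f₁} e₁ e₂ b₁₂ inv₁₂ rows columns
        (hasRank-pivot {f = just} {h = just} nothing nothing b₂₁
          (trans (*-congʳ S₂₁) inv₂₁) classify classify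
          (hasRank-cong (λ i j → sym (+-congˡ (-‿cong (*-cong (*-congʳ (S₋₁ i)) (S₂₋ j))))) rk))
      where
      -- After the first pivot the rows lack `e₁` and the columns lack `e₂`; in both enumerations
      -- `nothing` is the place of the second pivot.
      f₁ f₂ : Maybe I′ → I
      f₁ nothing  = e₁
      f₁ (just i) = f i
      f₂ nothing  = e₂
      f₂ (just i) = f i
      classify : (i : Maybe I′) → i ≡ nothing ⊎ ∃ λ i′ → i ≡ just i′
      classify nothing  = inj₁ ≡.refl
      classify (just i) = inj₂ (i , ≡.refl)
      rows : ∀ i → i ≡ e₁ ⊎ ∃ λ i′ → i ≡ f₂ i′
      rows i with cover i
      ... | inj₁ eq              = inj₁ eq
      ... | inj₂ (inj₁ eq)       = inj₂ (nothing , eq)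
      ... | inj₂ (inj₂ (i′ , eq)) = inj₂ (just i′ , eq)
      columns : ∀ i → i ≡ e₂ ⊎ ∃ λ i′ → i ≡ f₁ i′
      columns i with cover i
      ... | inj₁ eq              = inj₂ (nothing , eq)
      ... | inj₂ (inj₁ eq)       = inj₁ eq
      ... | inj₂ (inj₂ (i′ , eq)) = inj₂ (just i′ , eq)
      vanishˡ : ∀ x y b {z} → z ≈ 0# → x + - (z * b * y) ≈ x
      vanishˡ x y b z≈0 = trans (+-congˡ (-‿cong (*-congʳ (*-congʳ z≈0))))
        (solve 3 (λ x y b → x :+ :- (con (+ 0) :* b :* y) := x) refl x y b)
      vanishʳ : ∀ x y b {z} → z ≈ 0# → x + - (y * b * z) ≈ x
      vanishʳ x y b z≈0 = trans (+-congˡ (-‿cong (*-congˡ z≈0)))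
        (solve 3 (λ x y b → x :+ :- (y :* b :* con (+ 0)) := x) refl x y b)
      S₂₁ : schur A e₁ e₂ b₁₂ e₂ e₁ ≈ A e₂ e₁
      S₂₁ = vanishˡ _ _ _ A₂₂≈0
      S₋₁ : ∀ i → schur A e₁ e₂ b₁₂ (f i) e₁ ≈ A (f i) e₁
      S₋₁ i = vanishʳ _ _ _ A₁₁≈0
      S₂₋ : ∀ j → schur A e₁ e₂ b₁₂ e₂ (f j) ≈ A e₂ (f j)
      S₂₋ j = vanishˡ _ _ _ A₂₂≈0

  private
    cons : ∀ {n} → Carrier → (Fin n → Carrier) → Fin (suc n) → Carrier
    cons a x Fin.zero    = a
    cons a x (Fin.suc j) = x j

    tail-supported : ∀ {n s} {S : Subset n} {x} → SupportedOn (s ∷ S) x → SupportedOn S (x ∘ Fin.suc)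
    tail-supported supp j j∉ = supp (Fin.suc j) λ { (there j∈) → j∉ j∈ }

    module Elimination {m n} (A : Matrix m (suc n)) (p : Fin m) (a⁻¹ : Carrier)
                       (aa⁻¹≈1 : A p Fin.zero * a⁻¹ ≈ 1#) where
      B : Matrix m n
      B i j = schur A p Fin.zero a⁻¹ i (Fin.suc j)

      B-sum : ∀ (x : Fin n → Carrier) i → sum (λ j → B i j * x j) ≈
        sum (λ j → A i (Fin.suc j) * x j) + - (A i Fin.zero * a⁻¹ * sum (λ j → A p (Fin.suc j) * x j))
      B-sum x i = trans (sum-cong-≋ λ j → distribute (A i (Fin.suc j)) (A i Fin.zero * a⁻¹) (A p (Fin.suc j)) (x j))
        (trans (∑-distrib-+ (λ j → A i (Fin.suc j) * x j) _)
          (+-congˡ (trans (sym (*-distribˡ-sum (- (A i Fin.zero * a⁻¹)) (λ j → A p (Fin.suc j) * x j)))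
            (solve 2 (λ u w → (:- u) :* w := :- (u :* w)) refl _ _))))
        where
        distribute : ∀ u w y z → (u + - (w * y)) * z ≈ u * z + (- w) * (y * z)
        distribute = solve 4 (λ u w y z → (u :+ :- (w :* y)) :* z := u :* z :+ (:- w) :* (y :* z)) refl

      independent⁻ : ∀ {S} → IndependentColumns A (inside ∷ S) → IndependentColumns B S
      independent⁻ indep x supp ker j = indep (cons (- (a⁻¹ * s)) x)
        (λ { Fin.zero 0∉ → ⊥-elim (0∉ here) ; (Fin.suc j) j∉ → supp j (j∉ ∘ there) })
        (λ i → trans (rearrange (A i Fin.zero) a⁻¹ s _) (trans (sym (B-sum x i)) (ker i)))
        (Fin.suc j)
        where
        s = sum (λ j → A p (Fin.suc j) * x j)
        rearrange : ∀ u b w z → u * (- (b * w)) + z ≈ z + - (u * b * w)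
        rearrange = solve 4 (λ u b w z → u :* (:- (b :* w)) :+ z := z :+ :- (u :* b :* w)) refl

      independent⁺ : ∀ {S} → IndependentColumns B S → IndependentColumns A (inside ∷ S)
      independent⁺ indep x supp ker = λ { Fin.zero → head≈0 ; (Fin.suc j) → tail≈0 j }
        where
        x′ = x ∘ Fin.suc
        s : Fin m → Carrier
        s i = sum (λ j → A i (Fin.suc j) * x′ j)
        reduce : ∀ u a b y z w → z + - (u * b * w) ≈ (u * y + z) + - (u * b * (a * y + w)) + u * y * (a * b + - 1#)
        reduce = solve 6 (λ u a b y z w →
          z :+ :- (u :* b :* w) :=
          (u :* y :+ z) :+ :- (u :* b :* (a :* y :+ w)) :+ u :* y :* (a :* b :+ :- con (+ 1))) refl
        tail≈0 : ∀ j → x′ j ≈ 0#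
        tail≈0 = indep x′ (tail-supported supp) λ i → trans (B-sum x′ i)
          (trans (reduce (A i Fin.zero) (A p Fin.zero) a⁻¹ (x Fin.zero) (s i) (s p))
            (trans (+-cong (+-cong (ker i) (-‿cong (*-congˡ (ker p)))) (*-congˡ (+-congʳ aa⁻¹≈1)))
              (solve 2 (λ u w → con (+ 0) :+ :- (u :* con (+ 0)) :+ w :* (con (+ 1) :+ :- con (+ 1)) := con (+ 0)) refl _ _)))
        head≈0 : x Fin.zero ≈ 0#
        head≈0 = trans (solve 4 (λ a b y w → y := b :* (a :* y :+ w) :+ :- (b :* w) :+ y :* (con (+ 1) :+ :- (a :* b)))
                         refl (A p Fin.zero) a⁻¹ (x Fin.zero) (s p))
          (trans (+-cong (+-cong (*-congˡ (ker p)) (-‿cong (*-congˡ (sum-zero λ j → trans (*-congˡ (tail≈0 j)) (zeroʳ _)))))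
                         (*-congˡ (+-congˡ (-‿cong aa⁻¹≈1))))
            (solve 2 (λ b y → b :* con (+ 0) :+ :- (b :* con (+ 0)) :+ y :* (con (+ 1) :+ :- con (+ 1)) := con (+ 0))
              refl a⁻¹ (x Fin.zero)))

    -- Gaussian elimination from left to right: the columns that provide a pivot form `S`, and each
    -- pivot adds one outer product to the factorisation.
    basis : ∀ {m n} (A : Matrix m n) → ∃ λ S → IndependentColumns A S × RankAtMost A ∣ S ∣
    basis {n = zero}      A = [] , (λ _ _ _ ()) , rankAtMost-null λ _ ()
    basis {m} {n = suc n} A with all? (λ i → A i Fin.zero ≟ 0#)
    ... | yes col≈0 with basis (λ i → A i ∘ Fin.suc)
    ...   | S , indep , low = outside ∷ S
          , (λ x supp ker → λ
              { Fin.zero → supp Fin.zero λ ()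
              ; (Fin.suc j) → indep (x ∘ Fin.suc) (tail-supported supp)
                  (λ i → trans (sym (trans (+-congʳ (trans (*-congʳ (col≈0 i)) (zeroˡ _))) (+-identityˡ _))) (ker i)) j })
          , rankAtMost-columns (λ { Fin.zero → inj₁ col≈0 ; (Fin.suc j) → inj₂ (j , λ _ → refl) }) low
    basis {m} {n = suc n} A | no ¬col≈0 with ¬∀⟶∃¬ m _ (λ i → A i Fin.zero ≟ 0#) ¬col≈0
    ... | p , a≉0 with inverse (A p Fin.zero) a≉0
    ...   | a⁻¹ , aa⁻¹≈1 with basis (Elimination.B A p a⁻¹ aa⁻¹≈1)
    ...     | S , indep , low = inside ∷ S , Elimination.independent⁺ A p a⁻¹ aa⁻¹≈1 indep
            , rankAtMost-schur⁺ p Fin.zero a⁻¹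
                (rankAtMost-columns (λ { Fin.zero → inj₁ λ i → trans (+-congˡ (-‿cong (trans (*-assoc _ _ _)
                                           (*-congˡ (trans (*-comm _ _) aa⁻¹≈1))))) (trans (+-congˡ (-‿cong (*-identityʳ _))) (-‿inverseʳ _))
                                       ; (Fin.suc j) → inj₂ (j , λ _ → refl) }) low)

    -- Independence makes a chosen column nonzero, so it has an entry to pivot on, and the Schur
    -- complement takes one off both the number of chosen columns and `k`.
    independent⇒≤ : ∀ {m n} (A : Matrix m n) S → IndependentColumns A S → ∀ {k} → RankAtMost A k → ∣ S ∣ ≤ k
    independent⇒≤ A [] indep low = z≤n
    independent⇒≤ A (outside ∷ S) indep low = independent⇒≤ (λ i → A i ∘ Fin.suc) S
      (λ x supp ker j → indep (cons 0# x)
        (λ { Fin.zero _ → refl ; (Fin.suc j) j∉ → supp j (j∉ ∘ there) })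
        (λ i → trans (+-congʳ (zeroʳ _)) (trans (+-identityˡ _) (ker i))) (Fin.suc j))
      (rankAtMost-submatrix id Fin.suc low)
    independent⇒≤ {m} A (inside ∷ S) indep {k} low with all? (λ i → A i Fin.zero ≟ 0#)
    ... | yes col≈0 = ⊥-elim (1≉0 (indep (cons 1# (λ _ → 0#))
            (λ { Fin.zero 0∉ → ⊥-elim (0∉ here) ; (Fin.suc _) _ → refl })
            (λ i → trans (+-cong (trans (*-congʳ (col≈0 i)) (zeroˡ _)) (sum-zero λ j → zeroʳ (A i (Fin.suc j))))
                         (+-identityˡ 0#))
            Fin.zero))
    ... | no ¬col≈0 with ¬∀⟶∃¬ m _ (λ i → A i Fin.zero ≟ 0#) ¬col≈0
    ...   | p , a≉0 with k
    ...     | zero   = ⊥-elim (a≉0 (rankAtMost-zero low p Fin.zero))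
    ...     | suc k′ with inverse (A p Fin.zero) a≉0
    ...       | a⁻¹ , aa⁻¹≈1 = s≤s (independent⇒≤ (Elimination.B A p a⁻¹ aa⁻¹≈1) S
                  (Elimination.independent⁻ A p a⁻¹ aa⁻¹≈1 indep)
                  (rankAtMost-submatrix id Fin.suc (rankAtMost-schur⁻ p Fin.zero a⁻¹ aa⁻¹≈1 low)))

  -- Bridge between column independence and factorisations; together with `hasRank-unique` it turns
  -- every `HasRank` computation into an equation for `rank`.
  hasRank-rank : ∀ {m n} (A : Matrix m n) → HasRank A (rank A)
  hasRank-rank A = upper (basis A) , λ k low → maxOverSubsets-least size k (bounded low)
    where
    size = λ S → if does (independentColumns? A S) then ∣ S ∣ else 0
    upper : (∃ λ S → IndependentColumns A S × RankAtMost A ∣ S ∣) → RankAtMost A (rank A)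
    upper (S , indep , low) = rankAtMost-≤ (≡.subst (_≤ rank A)
      (≡.cong (λ b → if b then ∣ S ∣ else 0) (dec-true (independentColumns? A S) indep))
      (maxOverSubsets-upper size S)) low
    bounded : ∀ {k} → RankAtMost A k → ∀ S → size S ≤ k
    bounded low S with independentColumns? A S
    ... | yes indep = independent⇒≤ A S indep low
    ... | no  _     = z≤n

-- Closed walks, eliminated two vertices at a time

module ClosedWalks {c ℓ} (K : DiscreteField c ℓ) where
  open DiscreteField K hiding (zero)
  open RankTheory K
  open IntegerSolver commutativeRing
  open RingProperties ring using (-‿involutive; -1*x≈-x)
  open RawMonoidOps *-rawMonoid using () renaming (_×_ to power)
  open import Relation.Binary.Reasoning.Setoid setoid

  -- Adjacency matrix of the path 0, 1, 2, … with weight f k on the arc k → k+1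
  -- and f′ k on the reverse arc.
  walk : (f f′ : ℕ → Carrier) → ℕ → ℕ → Carrier
  walk f f′ zero          zero          = 0#
  walk f f′ zero          (suc zero)    = f 0
  walk f f′ zero          (suc (suc l)) = 0#
  walk f f′ (suc k)       (suc l)       = walk (f ∘ suc) (f′ ∘ suc) k l
  walk f f′ (suc zero)    zero          = f′ 0
  walk f f′ (suc (suc k)) zero          = 0#

  walk-forward : ∀ f f′ k → walk f f′ k (suc k) ≡ f k
  walk-forward f f′ zero    = ≡.refl
  walk-forward f f′ (suc k) = walk-forward (f ∘ suc) (f′ ∘ suc) k

  walk-backward : ∀ f f′ k → walk f f′ (suc k) k ≡ f′ k
  walk-backward f f′ zero    = ≡.refl
  walk-backward f f′ (suc k) = walk-backward (f ∘ suc) (f′ ∘ suc) k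

  walk-far : ∀ f f′ k l → l ≢ suc k → k ≢ suc l → walk f f′ k l ≡ 0#
  walk-far f f′ zero          zero          _  _  = ≡.refl
  walk-far f f′ zero          (suc zero)    l≢ _  = ⊥-elim (l≢ ≡.refl)
  walk-far f f′ zero          (suc (suc l)) _  _  = ≡.refl
  walk-far f f′ (suc zero)    zero          _  k≢ = ⊥-elim (k≢ ≡.refl)
  walk-far f f′ (suc (suc k)) zero          _  _  = ≡.refl
  walk-far f f′ (suc k)       (suc l)       l≢ k≢ =
    walk-far (f ∘ suc) (f′ ∘ suc) k l (l≢ ∘ ≡.cong suc) (k≢ ∘ ≡.cong suc)

  walk-transpose : ∀ f f′ k l → walk f f′ k l ≡ walk f′ f l k
  walk-transpose f f′ zero          zero          = ≡.refl
  walk-transpose f f′ zero          (suc zero)    = ≡.refl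
  walk-transpose f f′ zero          (suc (suc l)) = ≡.refl
  walk-transpose f f′ (suc zero)    zero          = ≡.refl
  walk-transpose f f′ (suc (suc k)) zero          = ≡.refl
  walk-transpose f f′ (suc k)       (suc l)       = walk-transpose (f ∘ suc) (f′ ∘ suc) k l

  -- The weights left after eliminating the vertices 1 and 2 of the path.
  reduce : (ℕ → Carrier) → ℕ → Carrier
  reduce f zero    = - (f 0 * f 1 * f 2)
  reduce f (suc k) = f (suc (suc (suc k)))

  private
    skip : ℕ → ℕ
    skip zero    = zero
    skip (suc k) = suc (suc (suc k))

  -- The right-hand side is the matrix of `hasRank-pivotPair` for the path vertices 1 and 2, with
  -- `f′ 1` and `f 1` as inverses of the entries `f 1` and `f′ 1`. `skip` lists the survivors 0, 3,
  -- 4, and so on; only the entries joining 0 to 3 are altered.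
  walk-reduce : ∀ f f′ k l → walk (reduce f) (reduce f′) k l ≈
    walk f f′ (skip k) (skip l)
      + - (walk f f′ (skip k) 2 * f′ 1 * walk f f′ 1 (skip l))
      + - (walk f f′ (skip k) 1 * f 1 * walk f f′ 2 (skip l))
  walk-reduce f f′ zero zero =
    solve 4 (λ a b x y → con (+ 0) := con (+ 0) :+ :- (con (+ 0) :* a :* x) :+ :- (y :* b :* con (+ 0)))
      refl (f′ 1) (f 1) (f′ 0) (f 0)
  walk-reduce f f′ zero (suc zero) =
    solve 4 (λ a x y z → :- (x :* y :* z) := con (+ 0) :+ :- (con (+ 0) :* a :* con (+ 0)) :+ :- (x :* y :* z))
      refl (f′ 1) (f 0) (f 1) (f 2)
  walk-reduce f f′ zero (suc (suc l)) =
    solve 3 (λ a x y → con (+ 0) := con (+ 0) :+ :- (con (+ 0) :* a :* con (+ 0)) :+ :- (x :* y :* con (+ 0)))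
      refl (f′ 1) (f 0) (f 1)
  walk-reduce f f′ (suc zero) zero =
    solve 4 (λ a x y z → :- (x :* y :* z) := con (+ 0) :+ :- (z :* y :* x) :+ :- (con (+ 0) :* a :* con (+ 0)))
      refl (f 1) (f′ 0) (f′ 1) (f′ 2)
  walk-reduce f f′ (suc (suc k)) zero =
    solve 3 (λ a x y → con (+ 0) := con (+ 0) :+ :- (con (+ 0) :* a :* x) :+ :- (con (+ 0) :* y :* con (+ 0)))
      refl (f′ 1) (f′ 0) (f 1)
  walk-reduce f f′ (suc k) (suc l) =
    solve 5 (λ w x y a b → w := w :+ :- (x :* a :* con (+ 0)) :+ :- (con (+ 0) :* b :* y))
      refl (walk f f′ (3 +ℕ k) (3 +ℕ l)) (walk f f′ (3 +ℕ k) 2) (walk f f′ 2 (3 +ℕ l)) (f′ 1) (f 1)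

  MutuallyInverse : (f f′ : ℕ → Carrier) → Set ℓ
  MutuallyInverse f f′ = ∀ k → f k * f′ k ≈ 1#

  reduce-inverse : ∀ {f f′} → MutuallyInverse f f′ → MutuallyInverse (reduce f) (reduce f′)
  reduce-inverse {f} {f′} inv zero = begin
    (- (f 0 * f 1 * f 2)) * (- (f′ 0 * f′ 1 * f′ 2))
      ≈⟨ solve 6 (λ a b d a′ b′ d′ → (:- (a :* b :* d)) :* (:- (a′ :* b′ :* d′)) := a :* a′ :* (b :* b′) :* (d :* d′))
           refl (f 0) (f 1) (f 2) (f′ 0) (f′ 1) (f′ 2) ⟩
    f 0 * f′ 0 * (f 1 * f′ 1) * (f 2 * f′ 2)
      ≈⟨ *-cong (*-cong (inv 0) (inv 1)) (inv 2) ⟩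
    1# * 1# * 1#
      ≈⟨ solve 0 (con (+ 1) :* con (+ 1) :* con (+ 1) := con (+ 1)) refl ⟩
    1# ∎
  reduce-inverse inv (suc k) = inv (suc (suc (suc k)))

  prod : ℕ → (ℕ → Carrier) → Carrier
  prod zero    f = 1#
  prod (suc n) f = f 0 * prod n (f ∘ suc)

  -- Two arcs fewer cost one change of sign. This is where the power `(-1)^(p/2)` in the definition
  -- of Type B comes from.
  prod-reduce : ∀ n f → prod (suc n) (reduce f) ≈ - prod (suc (suc (suc n))) f
  prod-reduce n f = solve 4 (λ a b d e → (:- (a :* b :* d)) :* e := :- (a :* (b :* (d :* e)))) refl _ _ _ _

  -- The walk 0, 1, …, m+1 with its two ends glued to a vertex of a graph on J
  -- with adjacency matrix N; the vector δ marks that vertex.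
  module Glued {J : Set} (N : J → J → Carrier) (δ : J → Carrier) where

    -- The ends `0` and `suc m` count as one vertex, so entries at either of them are added. For
    -- `m = 0` the four corner terms form a loop, and for `m = 1` the sums are the total weights of
    -- two parallel edges; no case distinction on `m` is made.
    glued : ∀ m (f f′ : ℕ → Carrier) → Fin m ⊎ J → Fin m ⊎ J → Carrier
    glued m f f′ (inj₁ k) (inj₁ l) = walk f f′ (suc (toℕ k)) (suc (toℕ l))
    glued m f f′ (inj₁ k) (inj₂ j) = (walk f f′ (suc (toℕ k)) 0 + walk f f′ (suc (toℕ k)) (suc m)) * δ j
    glued m f f′ (inj₂ i) (inj₁ l) = δ i * (walk f f′ 0 (suc (toℕ l)) + walk f f′ (suc m) (suc (toℕ l)))
    glued m f f′ (inj₂ i) (inj₂ j) = N i j + δ i *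
      ((walk f f′ 0 0 + walk f f′ 0 (suc m)) + (walk f f′ (suc m) 0 + walk f f′ (suc m) (suc m))) * δ j

    private
      embed : ∀ {m} → Fin m ⊎ J → Fin (suc (suc m)) ⊎ J
      embed (inj₁ k) = inj₁ (Fin.suc (Fin.suc k))
      embed (inj₂ j) = inj₂ j

      classify : ∀ {m} (x : Fin (suc (suc m)) ⊎ J) →
        x ≡ inj₁ Fin.zero ⊎ x ≡ inj₁ (Fin.suc Fin.zero) ⊎ ∃ λ y → x ≡ embed y
      classify (inj₁ Fin.zero)              = inj₁ ≡.refl
      classify (inj₁ (Fin.suc Fin.zero))    = inj₂ (inj₁ ≡.refl)
      classify (inj₁ (Fin.suc (Fin.suc k))) = inj₂ (inj₂ (inj₁ k , ≡.refl))
      classify (inj₂ j)                     = inj₂ (inj₂ (inj₂ j , ≡.refl))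

    -- The eliminated vertices 1 and 2 are interior and gluing is bilinear in the entries at the
    -- ends, so elimination commutes with gluing: `walk-reduce` is applied to each summand and the
    -- corrections are collected.
    hasRank-reduce : ∀ m {f f′} → MutuallyInverse f f′ → ∀ {k} →
      HasRank (glued m (reduce f) (reduce f′)) k → HasRank (glued (suc (suc m)) f f′) (suc (suc k))
    hasRank-reduce m {f} {f′} inv rk =
      hasRank-pivotPair {f = embed} (inj₁ Fin.zero) (inj₁ (Fin.suc Fin.zero)) (f′ 1) (f 1)
        (inv 1) (trans (*-comm _ _) (inv 1)) refl refl classify (hasRank-cong complement rk)
      where
      complement : ∀ i j → glued m (reduce f) (reduce f′) i j ≈ _
      complement (inj₁ k) (inj₁ l) = walk-reduce f f′ (suc (toℕ k)) (suc (toℕ l))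
      complement (inj₁ k) (inj₂ j) =
        trans (*-congʳ (+-cong (walk-reduce f f′ (suc (toℕ k)) 0) (walk-reduce f f′ (suc (toℕ k)) (suc m))))
          (solve 11 (λ w₁ w₂ x x′ b b′ y₁ y₁′ y₂ y₂′ d →
            ((w₁ :+ :- (x :* b :* y₁) :+ :- (x′ :* b′ :* y₁′)) :+ (w₂ :+ :- (x :* b :* y₂) :+ :- (x′ :* b′ :* y₂′))) :* d :=
            (w₁ :+ w₂) :* d :+ :- (x :* b :* ((y₁ :+ y₂) :* d)) :+ :- (x′ :* b′ :* ((y₁′ :+ y₂′) :* d)))
            refl _ _ _ _ _ _ _ _ _ _ _)
      complement (inj₂ i) (inj₁ l) =
        trans (*-congˡ (+-cong (walk-reduce f f′ 0 (suc (toℕ l))) (walk-reduce f f′ (suc m) (suc (toℕ l)))))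
          (solve 11 (λ w₁ w₂ x₁ x₁′ x₂ x₂′ b b′ y y′ d →
            d :* ((w₁ :+ :- (x₁ :* b :* y) :+ :- (x₁′ :* b′ :* y′)) :+ (w₂ :+ :- (x₂ :* b :* y) :+ :- (x₂′ :* b′ :* y′))) :=
            d :* (w₁ :+ w₂) :+ :- (d :* (x₁ :+ x₂) :* b :* y) :+ :- (d :* (x₁′ :+ x₂′) :* b′ :* y′))
            refl _ _ _ _ _ _ _ _ _ _ _)
      complement (inj₂ i) (inj₂ j) =
        trans (+-congˡ (*-congʳ (*-congˡ (+-cong
            (+-cong (walk-reduce f f′ 0 0) (walk-reduce f f′ 0 (suc m)))
            (+-cong (walk-reduce f f′ (suc m) 0) (walk-reduce f f′ (suc m) (suc m)))))))
          (solve 17 (λ n w₁ w₂ w₃ w₄ x₁ x₁′ x₂ x₂′ b b′ y₁ y₁′ y₂ y₂′ d e →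
            n :+ d :* (((w₁ :+ :- (x₁ :* b :* y₁) :+ :- (x₁′ :* b′ :* y₁′)) :+ (w₂ :+ :- (x₁ :* b :* y₂) :+ :- (x₁′ :* b′ :* y₂′)))
              :+ ((w₃ :+ :- (x₂ :* b :* y₁) :+ :- (x₂′ :* b′ :* y₁′)) :+ (w₄ :+ :- (x₂ :* b :* y₂) :+ :- (x₂′ :* b′ :* y₂′)))) :* e :=
            n :+ d :* ((w₁ :+ w₂) :+ (w₃ :+ w₄)) :* e
              :+ :- (d :* (x₁ :+ x₂) :* b :* ((y₁ :+ y₂) :* e))
              :+ :- (d :* (x₁′ :+ x₂′) :* b′ :* ((y₁′ :+ y₂′) :* e)))
            refl _ _ _ _ _ _ _ _ _ _ _ _ _ _ _ _ _)

    private
      -- With a single interior vertex left, `f 0 + f′ 1` and `f′ 0 + f 1` are the weights of its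
      -- merged edge in the two directions. Multiplied by `f 1`, respectively by `f 0`, they become
      -- `prod 2 f + 1`.
      endsˡ : ∀ {f f′} → MutuallyInverse f f′ → f 0 + f′ 1 ≈ 0# → prod 2 f ≈ power 1 (- 1#)
      endsˡ {f} {f′} inv s≈0 = begin
        f 0 * (f 1 * 1#)
          ≈⟨ solve 3 (λ a b b′ → a :* (b :* con (+ 1)) := (a :+ b′) :* b :+ (:- con (+ 1)) :* (b :* b′)) refl (f 0) (f 1) (f′ 1) ⟩
        (f 0 + f′ 1) * f 1 + (- 1#) * (f 1 * f′ 1)
          ≈⟨ +-cong (*-congʳ s≈0) (*-congˡ (inv 1)) ⟩
        0# * f 1 + (- 1#) * 1#
          ≈⟨ solve 1 (λ b → con (+ 0) :* b :+ (:- con (+ 1)) :* con (+ 1) := (:- con (+ 1)) :* con (+ 1)) refl (f 1) ⟩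
        (- 1#) * 1# ∎

      endsʳ : ∀ {f f′} → MutuallyInverse f f′ → f′ 0 + f 1 ≈ 0# → prod 2 f ≈ power 1 (- 1#)
      endsʳ {f} {f′} inv s≈0 = begin
        f 0 * (f 1 * 1#)
          ≈⟨ solve 3 (λ a a′ b → a :* (b :* con (+ 1)) := a :* (a′ :+ b) :+ (:- con (+ 1)) :* (a :* a′)) refl (f 0) (f′ 0) (f 1) ⟩
        f 0 * (f′ 0 + f 1) + (- 1#) * (f 0 * f′ 0)
          ≈⟨ +-cong (*-congˡ s≈0) (*-congˡ (inv 0)) ⟩
        f 0 * 0# + (- 1#) * 1#
          ≈⟨ solve 1 (λ b → b :* con (+ 0) :+ (:- con (+ 1)) :* con (+ 1) := (:- con (+ 1)) :* con (+ 1)) refl (f 0) ⟩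
        (- 1#) * 1# ∎

      ends⁻¹ : ∀ {f f′} → MutuallyInverse f f′ → prod 2 f ≈ power 1 (- 1#) → f 0 + f′ 1 ≈ 0# × f′ 0 + f 1 ≈ 0#
      ends⁻¹ {f} {f′} inv eq =
          (begin
            f 0 + f′ 1
              ≈⟨ +-congʳ (trans (sym (*-identityʳ _)) (*-congˡ (sym (inv 1)))) ⟩
            f 0 * (f 1 * f′ 1) + f′ 1
              ≈⟨ solve 3 (λ a b b′ → a :* (b :* b′) :+ b′ := (a :* (b :* con (+ 1))) :* b′ :+ b′) refl (f 0) (f 1) (f′ 1) ⟩
            prod 2 f * f′ 1 + f′ 1
              ≈⟨ minus (f′ 1) ⟩
            0# ∎)
        , (begin
            f′ 0 + f 1
              ≈⟨ +-congˡ (trans (sym (*-identityʳ _)) (*-congˡ (sym (inv 0)))) ⟩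
            f′ 0 + f 1 * (f 0 * f′ 0)
              ≈⟨ solve 3 (λ a a′ b → a′ :+ b :* (a :* a′) := (a :* (b :* con (+ 1))) :* a′ :+ a′) refl (f 0) (f′ 0) (f 1) ⟩
            prod 2 f * f′ 0 + f′ 0
              ≈⟨ minus (f′ 0) ⟩
            0# ∎)
        where
        minus : ∀ x → prod 2 f * x + x ≈ 0#
        minus x = trans (+-congʳ (*-congʳ eq))
          (solve 1 (λ x → (:- con (+ 1)) :* con (+ 1) :* x :+ x := con (+ 0)) refl x)

      flip-sign : ∀ q f → prod (2 +ℕ q *ℕ 2) (reduce f) ≈ power (suc q) (- 1#) →
        prod (4 +ℕ q *ℕ 2) f ≈ power (suc (suc q)) (- 1#)
      flip-sign q f eq = trans (sym (-‿involutive _))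
        (trans (-‿cong (trans (sym (prod-reduce (suc (q *ℕ 2)) f)) eq)) (sym (-1*x≈-x _)))

      flip-sign⁻¹ : ∀ q f → prod (4 +ℕ q *ℕ 2) f ≈ power (suc (suc q)) (- 1#) →
        prod (2 +ℕ q *ℕ 2) (reduce f) ≈ power (suc q) (- 1#)
      flip-sign⁻¹ q f eq = trans (prod-reduce (suc (q *ℕ 2)) f)
        (trans (-‿cong (trans eq (-1*x≈-x _))) (-‿involutive _))

    -- After `q` reductions one interior vertex remains, and the sign changes have turned the
    -- hypothesis into `prod 2 f = -1`. Both weights of its merged edge vanish, so the vertex is
    -- isolated and only `N` is left.
    hasRank-typeA : ∀ q {f f′} → MutuallyInverse f f′ → prod (2 +ℕ q *ℕ 2) f ≈ power (suc q) (- 1#) → ∀ {k} →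
      HasRank N k → HasRank (glued (suc (q *ℕ 2)) f f′) (q *ℕ 2 +ℕ k)
    hasRank-typeA zero {f} {f′} inv eq rk = hasRank-extend {f = inj₂} {h = inj₂} rows columns
      (hasRank-cong (λ i j → solve 3 (λ n d e →
        n := n :+ d :* ((con (+ 0) :+ con (+ 0)) :+ (con (+ 0) :+ con (+ 0))) :* e) refl (N i j) (δ i) (δ j)) rk)
      where
      closed = ends⁻¹ {f} {f′} inv eq
      rows : ∀ i → (∀ j → glued 1 f f′ i j ≈ 0#) ⊎ ∃ λ i′ → i ≡ inj₂ i′
      rows (inj₁ Fin.zero) = inj₁ λ { (inj₁ Fin.zero) → refl ; (inj₂ j) → trans (*-congʳ (proj₂ closed)) (zeroˡ _) }
      rows (inj₂ i)        = inj₂ (i , ≡.refl)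
      columns : ∀ j → (∀ i → glued 1 f f′ i j ≈ 0#) ⊎ ∃ λ j′ → j ≡ inj₂ j′
      columns (inj₁ Fin.zero) = inj₁ λ { (inj₁ Fin.zero) → refl ; (inj₂ i) → trans (*-congˡ (proj₁ closed)) (zeroʳ _) }
      columns (inj₂ j)        = inj₂ (j , ≡.refl)
    hasRank-typeA (suc q) {f} inv eq rk = hasRank-reduce (suc (q *ℕ 2)) inv
      (hasRank-typeA q (reduce-inverse inv) (flip-sign⁻¹ q f eq) rk)

    -- The last interior vertex is now joined to `v`, and to nothing else, by nonzero weights.
    -- Pivoting on the pair removes both, and since `δ` vanishes off `v` no correction reaches the
    -- rest of `N`.
    hasRank-typeB : ∀ {J′ : Set} {e : J′ → J} v → (∀ j → j ≡ v ⊎ ∃ λ j′ → j ≡ e j′) →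
      N v v ≈ 0# → δ v ≈ 1# → (∀ j → δ (e j) ≈ 0#) →
      ∀ q {f f′} → MutuallyInverse f f′ → ¬ (prod (2 +ℕ q *ℕ 2) f ≈ power (suc q) (- 1#)) → ∀ {k} →
      HasRank (λ i j → N (e i) (e j)) k → HasRank (glued (suc (q *ℕ 2)) f f′) (suc q *ℕ 2 +ℕ k)
    hasRank-typeB {J′} {e} v cover Nvv≈0 δv≈1 δe≈0 zero {f} {f′} inv neq rk =
      hasRank-pivotPair {f = inj₂ ∘ e} (inj₁ Fin.zero) (inj₂ v) (proj₁ s′⁻¹) (proj₁ s⁻¹)
        (trans (*-congʳ (trans (*-congˡ δv≈1) (*-identityʳ _))) (proj₂ s′⁻¹))
        (trans (*-congʳ (trans (*-congʳ δv≈1) (*-identityˡ _))) (proj₂ s⁻¹))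
        refl
        (trans (no-loop v v) Nvv≈0)
        classify₁
        (hasRank-cong (λ i j → sym (begin
          glued 1 f f′ (inj₂ (e i)) (inj₂ (e j))
            + - (glued 1 f f′ (inj₂ (e i)) (inj₂ v) * proj₁ s′⁻¹ * ((f′ 0 + f 1) * δ (e j)))
            + - (δ (e i) * (f 0 + f′ 1) * proj₁ s⁻¹ * glued 1 f f′ (inj₂ v) (inj₂ (e j)))
            ≈⟨ +-cong (+-cong (no-loop (e i) (e j)) (-‿cong (*-congˡ (*-congˡ (δe≈0 j)))))
                      (-‿cong (*-congʳ (*-congʳ (*-congʳ (δe≈0 i))))) ⟩
          N (e i) (e j) + - (glued 1 f f′ (inj₂ (e i)) (inj₂ v) * proj₁ s′⁻¹ * ((f′ 0 + f 1) * 0#))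
            + - (0# * (f 0 + f′ 1) * proj₁ s⁻¹ * glued 1 f f′ (inj₂ v) (inj₂ (e j)))
            ≈⟨ solve 6 (λ n x s t y z → n :+ :- (x :* (s :* con (+ 0))) :+ :- (con (+ 0) :* t :* y :* z) := n) refl _ _ _ _ _ _ ⟩
          N (e i) (e j) ∎)) rk)
      where
      s⁻¹ = inverse (f 0 + f′ 1) (neq ∘ endsˡ inv)
      s′⁻¹ = inverse (f′ 0 + f 1) (neq ∘ endsʳ inv)
      no-loop : ∀ i j → glued 1 f f′ (inj₂ i) (inj₂ j) ≈ N i j
      no-loop i j = solve 3 (λ n d e →
        n :+ d :* ((con (+ 0) :+ con (+ 0)) :+ (con (+ 0) :+ con (+ 0))) :* e := n) refl (N i j) (δ i) (δ j)
      classify₁ : (x : Fin 1 ⊎ J) → x ≡ inj₁ Fin.zero ⊎ x ≡ inj₂ v ⊎ ∃ λ j → x ≡ inj₂ (e j)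
      classify₁ (inj₁ Fin.zero) = inj₁ ≡.refl
      classify₁ (inj₂ j) with cover j
      ... | inj₁ ≡.refl        = inj₂ (inj₁ ≡.refl)
      ... | inj₂ (j′ , ≡.refl) = inj₂ (inj₂ (j′ , ≡.refl))
    hasRank-typeB v cover Nvv≈0 δv≈1 δe≈0 (suc q) {f} inv neq rk = hasRank-reduce (suc (q *ℕ 2)) inv
      (hasRank-typeB v cover Nvv≈0 δv≈1 δe≈0 q (reduce-inverse inv) (neq ∘ flip-sign q f) rk)

    -- Here no interior vertex survives: the last arc has both ends at the marked vertex, and `t` is
    -- the sum of its two weights. Only existence is recorded, because `rank-diagonal-≤` compares
    -- arbitrary loop weights.
    hasRank-odd : ∀ q {f f′} → MutuallyInverse f f′ → ∃ λ t → ∀ {k} →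
      HasRank (λ i j → N i j + δ i * t * δ j) k → HasRank (glued (q *ℕ 2) f f′) (q *ℕ 2 +ℕ k)
    hasRank-odd zero {f} {f′} inv = _ , hasRank-extend {f = inj₂} {h = inj₂}
      (inj₂ ∘ right) (inj₂ ∘ right)
      where
      right : (x : Fin 0 ⊎ J) → ∃ λ j → x ≡ inj₂ j
      right (inj₂ j) = j , ≡.refl
    hasRank-odd (suc q) inv with hasRank-odd q (reduce-inverse inv)
    ... | t , odd = t , hasRank-reduce (q *ℕ 2) inv ∘ odd

-- Counting vertices, edges and components of induced subgraphs

module _ {A : Set} where

  injection-length : ∀ {k} {f : Fin k → A} {xs} → Injective _≡_ _≡_ f → (∀ i → f i ∈ˡ xs) → k ≤ length xs
  injection-length {f = f} {xs} inj f∈ = injective⇒≤ {f = Any.index ∘ f∈} λ {i} {j} eq → inj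
    (≡.trans (lookup-index (f∈ i)) (≡.trans (≡.cong (lookup xs) eq) (≡.sym (lookup-index (f∈ j)))))

  lookup-injective : ∀ {xs : List A} → Unique xs → Injective _≡_ _≡_ (lookup xs)
  lookup-injective (_ ∷ _)   {Fin.zero}  {Fin.zero}  eq = ≡.refl
  lookup-injective (x∉ ∷ _)  {Fin.zero}  {Fin.suc j} eq = ⊥-elim (All.lookup x∉ (∈-lookup j) eq)
  lookup-injective (x∉ ∷ _)  {Fin.suc i} {Fin.zero}  eq = ⊥-elim (All.lookup x∉ (∈-lookup i) (≡.sym eq))
  lookup-injective (_ ∷ uniq) {Fin.suc i} {Fin.suc j} eq = ≡.cong Fin.suc (lookup-injective uniq eq)

member-∈ : ∀ {n} (S : Subset n) i → member S i ∈ S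
member-∈ (inside  ∷ S) Fin.zero    = here
member-∈ (inside  ∷ S) (Fin.suc i) = there (member-∈ S i)
member-∈ (outside ∷ S) i           = there (member-∈ S i)

position : ∀ {n} (S : Subset n) {x} → x ∈ S → ∃ λ i → member S i ≡ x
position (_       ∷ S) here       = Fin.zero , ≡.refl
position (inside  ∷ S) (there x∈) with position S x∈
... | i , eq = Fin.suc i , ≡.cong Fin.suc eq
position (outside ∷ S) (there x∈) with position S x∈
... | i , eq = i , ≡.cong Fin.suc eq

member-injective : ∀ {n} (S : Subset n) → Injective _≡_ _≡_ (member S)
member-injective (inside  ∷ S) {Fin.zero}  {Fin.zero}  eq = ≡.refl
member-injective (inside  ∷ S) {Fin.suc i} {Fin.suc j} eq = ≡.cong Fin.suc (member-injective S (Finₚ.suc-injective eq))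
member-injective (outside ∷ S) eq = member-injective S (Finₚ.suc-injective eq)

order-≤ : ∀ {n k} (S : Subset n) (c : Fin k → Fin n) → (∀ x → x ∈ S ⊎ ∃ λ a → c a ≡ x) → n ≤ ∣ S ∣ +ℕ k
order-≤ {n} {k} S c cover = injective⇒≤ {f = join ∣ S ∣ k ∘ choose} λ {x} {y} eq →
  ≡.trans (≡.sym (retract x)) (≡.trans (≡.cong vertex (join-injective (choose x) (choose y) eq)) (retract y))
  where
  vertex : Fin ∣ S ∣ ⊎ Fin k → Fin n
  vertex = [ member S , c ]′
  choose : Fin n → Fin ∣ S ∣ ⊎ Fin k
  choose x with cover x
  ... | inj₁ x∈       = inj₁ (proj₁ (position S x∈))
  ... | inj₂ (a , _) = inj₂ a
  retract : ∀ x → vertex (choose x) ≡ x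
  retract x with cover x
  ... | inj₁ x∈        = proj₂ (position S x∈)
  ... | inj₂ (_ , eq) = eq
  join-injective : ∀ u w → (join (∣ S ∣) k u) ≡ (join (∣ S ∣) k w) → u ≡ w
  join-injective u w eq = ≡.trans (≡.sym (splitAt-join ∣ S ∣ k u))
    (≡.trans (≡.cong (splitAt ∣ S ∣) eq) (splitAt-join ∣ S ∣ k w))

SameEdge : ∀ {n} → Fin n × Fin n → Fin n × Fin n → Set
SameEdge e e′ = e ≡ e′ ⊎ e ≡ swap e′

sameEdge-trans : ∀ {n} {d e e′ : Fin n × Fin n} → SameEdge e d → SameEdge e′ d → SameEdge e e′
sameEdge-trans (inj₁ ≡.refl) (inj₁ ≡.refl) = inj₁ ≡.refl
sameEdge-trans (inj₁ ≡.refl) (inj₂ ≡.refl) = inj₂ ≡.refl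
sameEdge-trans (inj₂ ≡.refl) (inj₁ ≡.refl) = inj₂ ≡.refl
sameEdge-trans (inj₂ ≡.refl) (inj₂ ≡.refl) = inj₁ ≡.refl

module GraphLemmas {n} (G : Graph n) where
  open Graph G

  adjacent-sym : ∀ {x y} → Adjacent x y → Adjacent y x
  adjacent-sym {x} {y} = ≡.subst T (symmetric x y)

  adjacent-irrefl : ∀ {x} → ¬ Adjacent x x
  adjacent-irrefl {x} = ≡.subst T (irreflexive x)

  connected-sym : ∀ {x y} → Connected x y → Connected y x
  connected-sym = Star.reverse adjacent-sym

  edges-unique : Unique edges
  edges-unique = filter⁺ _ (cartesianProduct⁺ (allFin⁺ n) (allFin⁺ n))

  ∈-edges⁻ : ∀ {x y} → (x , y) ∈ˡ edges → x Fin.< y × Adjacent x y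
  ∈-edges⁻ e∈ = proj₂ (∈-filter⁻ _ {xs = cartesianProduct (allFin n) (allFin n)} e∈)

  ∈-edges⁺ : ∀ {x y} → x Fin.< y → Adjacent x y → (x , y) ∈ˡ edges
  ∈-edges⁺ {x} {y} x<y adj = ∈-filter⁺ _ (∈-cartesianProduct⁺ (∈-allFin x) (∈-allFin y)) (x<y , adj)

  orient : ∀ x y → Adjacent x y → ∃ λ e → e ∈ˡ edges × SameEdge (x , y) e
  orient x y adj with Finₚ.<-cmp x y
  ... | tri< x<y _ _    = (x , y) , ∈-edges⁺ x<y adj , inj₁ ≡.refl
  ... | tri≈ _ ≡.refl _ = ⊥-elim (adjacent-irrefl adj)
  ... | tri> _ _ y<x    = (y , x) , ∈-edges⁺ y<x (adjacent-sym adj) , inj₂ ≡.refl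

  -- `edges` stores each edge with the smaller endpoint first, while the family `e` is oriented
  -- freely; hence its members must differ up to reversal.
  edges-≥ : ∀ {k} (e : Fin k → Fin n × Fin n) → (∀ a → Adjacent (proj₁ (e a)) (proj₂ (e a))) →
    (∀ a b → SameEdge (e a) (e b) → a ≡ b) → k ≤ length edges
  edges-≥ {k} e adj inj = injection-length {f = λ a → proj₁ (oriented a)}
    (λ {a} {b} eq → inj a b (sameEdge-trans (same a)
      (≡.subst (SameEdge (e b)) (≡.sym eq) (same b))))
    (λ a → proj₁ (proj₂ (oriented a)))
    where
    oriented : ∀ a → ∃ λ d → d ∈ˡ edges × SameEdge (e a) d
    oriented a = orient _ _ (adj a)
    same : ∀ a → SameEdge (e a) (proj₁ (oriented a))
    same a = proj₂ (proj₂ (oriented a))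

  component-≡⇒connected : ∀ {x y} → component x ≡ component y → Connected x y
  component-≡⇒connected {x} {y} eq = toWitness′ (connected? x y) (≡.trans
    (≡.sym (lookup∘tabulate (λ z → does (connected? x z)) y))
    (≡.trans (≡.cong (λ S → Vec.lookup S y) eq)
      (≡.trans (lookup∘tabulate (λ z → does (connected? y z)) y) (dec-true (connected? y y) ε))))
    where
    toWitness′ : ∀ {P : Set} (P? : Dec P) → does P? ≡ true → P
    toWitness′ (yes p) _ = p

  connected⇒component-≡ : ∀ {x y} → Connected x y → component x ≡ component y
  connected⇒component-≡ {x} {y} x~y = tabulate-cong λ z → agree (connected? x z) (connected? y z)
    (connected-sym x~y ◅◅_) (x~y ◅◅_)
    where
    agree : ∀ {P Q : Set} (P? : Dec P) (Q? : Dec Q) → (P → Q) → (Q → P) → does P? ≡ does Q?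
    agree (yes p) Q? to from = ≡.sym (dec-true Q? (to p))
    agree (no ¬p) (yes q) to from = ⊥-elim (¬p (from q))
    agree (no ¬p) (no ¬q) to from = ≡.refl

  -- Numbers of components are compared through vertices in pairwise different components: such a
  -- family has at most `ω` members, and `transversal` attains `ω`.
  Separated : ∀ {k} → (Fin k → Fin n) → Set
  Separated f = ∀ a b → Connected (f a) (f b) → a ≡ b

  separated⇒≤ω : ∀ {k} (f : Fin k → Fin n) → Separated f → k ≤ ω
  separated⇒≤ω f sep = injection-length {f = component ∘ f}
    (λ {a} {b} eq → sep a b (component-≡⇒connected eq))
    (λ a → ∈-deduplicate⁺ (≡-dec _≟ᵇ_) (∈-map⁺ component (∈-allFin (f a))))

  transversal : ∃ λ (f : Fin ω → Fin n) → Separated f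
  transversal = (λ a → proj₁ (origin a)) , λ a b conn →
    lookup-injective (UniqueDec.deduplicate-! (≡-dec _≟ᵇ_) (map component (allFin n)))
      (≡.trans (proj₂ (origin a)) (≡.trans (connected⇒component-≡ conn) (≡.sym (proj₂ (origin b)))))
    where
    origin : ∀ a → ∃ λ x → lookup components a ≡ component x
    origin a with ∈-map⁻ component (∈-deduplicate⁻ (≡-dec _≟ᵇ_) (map component (allFin n)) (∈-lookup a))
    ... | x , _ , eq = x , eq

module SubgraphLemmas {n} (G : Graph n) (S : Subset n) where
  open Graph G
  open GraphLemmas G

  edges-subgraph : ∀ {k} (e : Fin k → Fin n × Fin n) →
    (∀ a → Adjacent (proj₁ (e a)) (proj₂ (e a))) →
    (∀ a b → SameEdge (e a) (e b) → a ≡ b) →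
    (∀ a → ¬ (proj₁ (e a) ∈ S × proj₂ (e a) ∈ S)) →
    length (Graph.edges (G [ S ])) +ℕ k ≤ length edges
  edges-subgraph {k} e adj inj outer = edges-≥ (edge ∘ splitAt kₛ) (adjacentₑ ∘ splitAt kₛ) λ a b same →
    ≡.trans (≡.sym (join-splitAt kₛ k a)) (≡.trans (≡.cong (join kₛ k) (injectiveₑ (splitAt kₛ a) (splitAt kₛ b) same))
      (join-splitAt kₛ k b))
    where
    Eₛ = Graph.edges (G [ S ])
    kₛ = length Eₛ
    inner : Fin kₛ → Fin n × Fin n
    inner i = member S (proj₁ (lookup Eₛ i)) , member S (proj₂ (lookup Eₛ i))
    edge : Fin kₛ ⊎ Fin k → Fin n × Fin n
    edge = [ inner , e ]′
    adjacentₑ : ∀ a → Adjacent (proj₁ (edge a)) (proj₂ (edge a))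
    adjacentₑ (inj₁ i) = proj₂ (GraphLemmas.∈-edges⁻ (G [ S ]) (∈-lookup i))
    adjacentₑ (inj₂ a) = adj a
    inner-∈ : ∀ i → proj₁ (inner i) ∈ S × proj₂ (inner i) ∈ S
    inner-∈ i = member-∈ S _ , member-∈ S _
    apart : ∀ i a → ¬ SameEdge (inner i) (e a)
    apart i a (inj₁ eq) = outer a (≡.subst (λ d → proj₁ d ∈ S × proj₂ d ∈ S) eq (inner-∈ i))
    apart i a (inj₂ eq) = outer a (swap (≡.subst (λ d → proj₁ d ∈ S × proj₂ d ∈ S) eq (inner-∈ i)))
    injectiveₑ : ∀ a b → SameEdge (edge a) (edge b) → a ≡ b
    injectiveₑ (inj₁ i) (inj₁ j) (inj₁ eq) = ≡.cong inj₁ (lookup-injective (GraphLemmas.edges-unique (G [ S ]))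
      (≡.cong₂ _,_ (member-injective S (≡.cong proj₁ eq)) (member-injective S (≡.cong proj₂ eq))))
    injectiveₑ (inj₁ i) (inj₁ j) (inj₂ eq) = ⊥-elim (ℕₚ.<-asym
      (proj₁ (GraphLemmas.∈-edges⁻ (G [ S ]) (∈-lookup i)))
      (≡.subst₂ Fin._<_ (≡.sym (member-injective S (≡.cong proj₂ eq))) (≡.sym (member-injective S (≡.cong proj₁ eq)))
        (proj₁ (GraphLemmas.∈-edges⁻ (G [ S ]) (∈-lookup j)))))
    injectiveₑ (inj₁ i) (inj₂ b) same = ⊥-elim (apart i b same)
    injectiveₑ (inj₂ a) (inj₁ j) same = ⊥-elim (apart j a (sameEdge-trans (inj₁ ≡.refl) same))
    injectiveₑ (inj₂ a) (inj₂ b) same = ≡.cong inj₂ (inj a b same)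

  -- `ρ` carries a walk of `G` between vertices of `S` to a walk inside `S` with the same ends, so
  -- different components of the subgraph stay apart in `G`.
  ω-retract : (ρ : Fin n → Fin ∣ S ∣) → (∀ i → ρ (member S i) ≡ i) →
    (∀ x y → Adjacent x y → Graph.Connected (G [ S ]) (ρ x) (ρ y)) → Graph.ω (G [ S ]) ≤ ω
  ω-retract ρ retract step with GraphLemmas.transversal (G [ S ])
  ... | f , sep = separated⇒≤ω (member S ∘ f) λ a b conn →
    sep a b (≡.subst₂ (Graph.Connected (G [ S ])) (retract (f a)) (retract (f b)) (push conn))
    where
    push : ∀ {x y} → Connected x y → Graph.Connected (G [ S ]) (ρ x) (ρ y)
    push ε        = ε
    push (adj ◅ w) = step _ _ adj ◅◅ push w

  -- The retraction sends everything outside `S` to `s`. An edge that crosses the boundary meets `S`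
  -- in `s`, so its image is a single vertex.
  ω-collapse : ∀ {s} → s ∈ S → (∀ x y → Adjacent x y → x ∉ S → y ∈ S → y ≡ s) → Graph.ω (G [ S ]) ≤ ω
  ω-collapse {s} s∈ boundary = ω-retract ρ (λ i → member-injective S (ρ-member (member-∈ S i))) step
    where
    ρ : Fin n → Fin ∣ S ∣
    ρ x with x ∈? S
    ... | yes x∈ = proj₁ (position S x∈)
    ... | no  _  = proj₁ (position S s∈)
    ρ-member : ∀ {x} → x ∈ S → member S (ρ x) ≡ x
    ρ-member {x} x∈ with x ∈? S
    ... | yes x∈′ = proj₂ (position S x∈′)
    ... | no  x∉  = ⊥-elim (x∉ x∈)
    ρ-outside : ∀ {x} → x ∉ S → member S (ρ x) ≡ s
    ρ-outside {x} x∉ with x ∈? S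
    ... | yes x∈ = ⊥-elim (x∉ x∈)
    ... | no  _  = proj₂ (position S s∈)
    merged : ∀ x y → member S (ρ x) ≡ member S (ρ y) → Graph.Connected (G [ S ]) (ρ x) (ρ y)
    merged x y eq = ≡.subst (Graph.Connected (G [ S ]) (ρ x)) (member-injective S eq) ε
    step : ∀ x y → Adjacent x y → Graph.Connected (G [ S ]) (ρ x) (ρ y)
    step x y adj = go (x ∈? S) (y ∈? S)
      where
      go : Dec (x ∈ S) → Dec (y ∈ S) → Graph.Connected (G [ S ]) (ρ x) (ρ y)
      go (yes x∈) (yes y∈) = ≡.subst₂ Adjacent (≡.sym (ρ-member x∈)) (≡.sym (ρ-member y∈)) adj ◅ ε
      go (yes x∈) (no  y∉) = merged x y (≡.trans (ρ-member x∈)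
        (≡.trans (boundary y x (adjacent-sym adj) y∉ x∈) (≡.sym (ρ-outside y∉))))
      go (no  x∉) (yes y∈) = merged x y (≡.trans (ρ-outside x∉) (≡.sym (≡.trans (ρ-member y∈) (boundary x y adj x∉ y∈))))
      go (no  x∉) (no  y∉) = merged x y (≡.trans (ρ-outside x∉) (≡.sym (ρ-outside y∉)))

-- The subtraction never truncates, by order≤edges+ω.
cyclomatic : ∀ {n} → Graph n → ℕ
cyclomatic {n} G = (length (Graph.edges G) +ℕ Graph.ω G) ∸ n

θ≡cyclomatic : ∀ {n} (G : Graph n) → n ≤ length (Graph.edges G) +ℕ Graph.ω G → Graph.θ G ≡ + cyclomatic G
θ≡cyclomatic {n} G n≤ = ≡.trans
  (≡.trans (≡.cong (ℤ._+ + ω) (ℤₚ.m-n≡m⊖n E n)) (ℤₚ.distribˡ-⊖-+-pos ω E n))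
  (ℤₚ.⊖-≥ n≤)
  where
  E = length (Graph.edges G)
  ω = Graph.ω G

-- Meant for `F`, which loses `p` vertices but `p + 1` edges (the cycle and the edge leaving it),
-- and for `H`, which loses `p - 1` vertices but `p` edges.
cyclomatic-subgraph : ∀ {n} (G : Graph n) (S : Subset n) k →
  ∣ S ∣ ≤ length (Graph.edges (G [ S ])) +ℕ Graph.ω (G [ S ]) →
  length (Graph.edges (G [ S ])) +ℕ suc k ≤ length (Graph.edges G) →
  n ≤ ∣ S ∣ +ℕ k → Graph.ω (G [ S ]) ≤ Graph.ω G → suc (cyclomatic (G [ S ])) ≤ cyclomatic G
cyclomatic-subgraph {n} G S k nₛ≤ E≤ n≤ ω≤ = ℕₚ.m+n≤o⇒m≤o∸n (suc t) (begin
  suc t +ℕ n                     ≤⟨ ℕₚ.+-monoʳ-≤ (suc t) n≤ ⟩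
  suc t +ℕ (nₛ +ℕ k)             ≡⟨ solve 3 (λ a b d → (con 1 :+ d) :+ (a :+ b) := (a :+ d) :+ (con 1 :+ b)) ≡.refl nₛ k t ⟩
  (nₛ +ℕ t) +ℕ suc k             ≡⟨ ≡.cong (_+ℕ suc k) (ℕₚ.m+[n∸m]≡n nₛ≤) ⟩
  (Eₛ +ℕ ωₛ) +ℕ suc k            ≡⟨ solve 3 (λ a b d → (a :+ b) :+ d := (a :+ d) :+ b) ≡.refl Eₛ ωₛ (suc k) ⟩
  (Eₛ +ℕ suc k) +ℕ ωₛ            ≤⟨ ℕₚ.+-mono-≤ E≤ ω≤ ⟩
  length (Graph.edges G) +ℕ Graph.ω G ∎)
  where
  open ℕₚ.≤-Reasoning
  open Data.Nat.Solver.+-*-Solver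
  t = cyclomatic (G [ S ])
  nₛ = ∣ S ∣
  Eₛ = length (Graph.edges (G [ S ]))
  ωₛ = Graph.ω (G [ S ])

-- Switching along a spanning forest

module Switching {c ℓ} (K : DiscreteField c ℓ) where
  open DiscreteField K hiding (zero)
  open RankTheory K
  open LinearAlgebra K using (Matrix)
  open IntegerSolver commutativeRing
  open import Relation.Binary.Reasoning.Setoid setoid

  -- Each listed position is peeled off as one outer product with a single possibly nonzero entry.
  rankAtMost-support : ∀ {m n} (M : Matrix m n) (ps : List (Fin m × Fin n)) →
    (∀ i j → M i j ≈ 0# ⊎ (i , j) ∈ˡ ps) → RankAtMost M (length ps)
  rankAtMost-support M [] supp = rankAtMost-null λ i j → [ id , (λ ()) ]′ (supp i j)
  rankAtMost-support {m} {n} M ((i₀ , j₀) ∷ ps) supp =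
    rankAtMost-cong (λ i j → solve 2 (λ x y → x :+ (y :+ :- x) := y) refl _ _)
      (rankAtMost-+ (rankAtMost-outer χ χ′) (rankAtMost-support _ ps supp′))
    where
    χ : Fin m → Carrier
    χ i = if does (i Finₚ.≟ i₀) then 1# else 0#
    χ′ : Fin n → Carrier
    χ′ j = if does (j Finₚ.≟ j₀) then M i₀ j₀ else 0#
    supp′ : ∀ i j → M i j + - (χ i * χ′ j) ≈ 0# ⊎ (i , j) ∈ˡ ps
    supp′ i j with i Finₚ.≟ i₀ | j Finₚ.≟ j₀
    ... | yes ≡.refl | yes ≡.refl = inj₁ (solve 1 (λ x → x :+ :- (con (+ 1) :* x) := con (+ 0)) refl _)
    ... | yes ≡.refl | no j≢ with supp i j
    ...   | inj₁ M≈0          = inj₁ (trans (+-congʳ M≈0) (solve 0 (con (+ 0) :+ :- (con (+ 1) :* con (+ 0)) := con (+ 0)) refl))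
    ...   | inj₂ (here ≡.refl) = ⊥-elim (j≢ ≡.refl)
    ...   | inj₂ (there p∈)   = inj₂ p∈
    supp′ i j | no i≢ | j≟ with supp i j
    ...   | inj₁ M≈0          = inj₁ (trans (+-congʳ M≈0) (solve 1 (λ x → con (+ 0) :+ :- (con (+ 0) :* x) := con (+ 0)) refl _))
    ...   | inj₂ (here ≡.refl) = ⊥-elim (i≢ ≡.refl)
    ...   | inj₂ (there p∈)   = inj₂ p∈

  -- Union–find along a list of edges: d is a potential for the edges that
  -- joined two classes, and only the remaining edges can be unbalanced.
  record Potential {n} (g : Matrix n n) (es : List (Fin n × Fin n)) (classes : ℕ) : Set (c ⊔ ℓ) where
    field
      class          : Fin n → Fin classes
      representative : Fin classes → Fin n
      class-rep      : ∀ a → class (representative a) ≡ a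
      class-edge     : ∀ {x y} → (x , y) ∈ˡ es → class x ≡ class y
      d d⁻¹          : Fin n → Carrier
      d-inverse      : ∀ x → d x * d⁻¹ x ≈ 1#
      unbalanced     : List (Fin n × Fin n)
      balance        : ∀ {x y} → (x , y) ∈ˡ es → g x y ≈ d x * d⁻¹ y ⊎ (x , y) ∈ˡ unbalanced
      count          : length unbalanced +ℕ n ≤ length es +ℕ classes

  module _ {n} (g : Matrix n n) where

    potential-[] : Potential g [] n
    potential-[] = record
      { class = id ; representative = id ; class-rep = λ _ → ≡.refl ; class-edge = λ ()
      ; d = λ _ → 1# ; d⁻¹ = λ _ → 1# ; d-inverse = λ _ → *-identityˡ 1#
      ; unbalanced = [] ; balance = λ () ; count = ℕₚ.≤-refl }

    -- An edge inside a class closes a cycle and is put among the unbalanced ones; an edge between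
    -- two classes merges them. Either way `count` is preserved.
    potential-∷ : ∀ {es k} x y → g x y * g y x ≈ 1# → Potential g es k → ∃ (Potential g ((x , y) ∷ es))
    potential-∷ {es} {zero}  x y gg≈1 P with Potential.class P x
    ... | ()
    potential-∷ {es} {suc k} x y gg≈1 P with Potential.class P y Finₚ.≟ Potential.class P x
    ... | yes same = suc k , record
      { class = class ; representative = representative ; class-rep = class-rep
      ; class-edge = λ { (here ≡.refl) → ≡.sym same ; (there e∈) → class-edge e∈ }
      ; d = d ; d⁻¹ = d⁻¹ ; d-inverse = d-inverse
      ; unbalanced = (x , y) ∷ unbalanced
      ; balance = λ { (here ≡.refl) → inj₂ (here ≡.refl)
                    ; (there e∈) → [ inj₁ , (λ u∈ → inj₂ (there u∈)) ]′ (balance e∈) }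
      ; count = s≤s count }
      where open Potential P
    ... | no differ = k , record
      { class = relabel ∘ class
      ; representative = representative ∘ punchIn (class y)
      ; class-rep = λ a → ≡.trans (≡.cong relabel (class-rep (punchIn (class y) a))) (relabel-punchIn a)
      ; class-edge = λ { (here ≡.refl) → ≡.trans relabel-x (≡.sym relabel-y)
                       ; (there e∈) → ≡.cong relabel (class-edge e∈) }
      ; d = λ z → factor (class z) * d z
      ; d⁻¹ = λ z → factor⁻¹ (class z) * d⁻¹ z
      ; d-inverse = λ z → trans (regroup _ _ _ _) (trans (*-cong (factor-inverse (class z)) (d-inverse z)) (*-identityˡ 1#))
      ; unbalanced = unbalanced
      ; balance = λ { (here ≡.refl) → inj₁ balance-new
                    ; (there e∈) → [ inj₁ ∘ balance-old e∈ , inj₂ ]′ (balance e∈) }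
      ; count = ≡.subst (length unbalanced +ℕ n ≤_) (ℕₚ.+-suc (length es) k) count }
      where
      open Potential P
      relabel : Fin (suc k) → Fin k
      relabel a with class y Finₚ.≟ a
      ... | yes _  = punchOut differ
      ... | no y≢a = punchOut y≢a
      relabel-punchIn : ∀ a → relabel (punchIn (class y) a) ≡ a
      relabel-punchIn a with class y Finₚ.≟ punchIn (class y) a
      ... | yes eq = ⊥-elim (punchInᵢ≢i (class y) a (≡.sym eq))
      ... | no  ne = ≡.trans (punchOut-cong (class y) ≡.refl) (punchOut-punchIn (class y))
      relabel-x : relabel (class x) ≡ punchOut differ
      relabel-x with class y Finₚ.≟ class x
      ... | yes _ = ≡.refl
      ... | no  _ = punchOut-cong (class y) ≡.refl
      relabel-y : relabel (class y) ≡ punchOut differ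
      relabel-y with class y Finₚ.≟ class y
      ... | yes _ = ≡.refl
      ... | no ne = ⊥-elim (ne ≡.refl)
      -- Rescaling the class of `y` by `s` is what makes the new edge balanced:
      -- `d x * (s⁻¹ * d⁻¹ y)` reduces to `g x y`.
      s s⁻¹ : Carrier
      s   = g y x * d x * d⁻¹ y
      s⁻¹ = g x y * d⁻¹ x * d y
      factor factor⁻¹ : Fin (suc k) → Carrier
      factor a   = if does (class y Finₚ.≟ a) then s else 1#
      factor⁻¹ a = if does (class y Finₚ.≟ a) then s⁻¹ else 1#
      regroup : ∀ u w u′ w′ → u * w * (u′ * w′) ≈ u * u′ * (w * w′)
      regroup = solve 4 (λ u w u′ w′ → u :* w :* (u′ :* w′) := u :* u′ :* (w :* w′)) refl
      s-inverse : s * s⁻¹ ≈ 1#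
      s-inverse = begin
        s * s⁻¹
          ≈⟨ solve 6 (λ a b p p′ q q′ → a :* p :* q′ :* (b :* p′ :* q) := b :* a :* (p :* p′) :* (q :* q′))
               refl (g y x) (g x y) (d x) (d⁻¹ x) (d y) (d⁻¹ y) ⟩
        g x y * g y x * (d x * d⁻¹ x) * (d y * d⁻¹ y)
          ≈⟨ *-cong (*-cong gg≈1 (d-inverse x)) (d-inverse y) ⟩
        1# * 1# * 1#
          ≈⟨ trans (*-identityʳ _) (*-identityʳ _) ⟩
        1# ∎
      factor-inverse : ∀ a → factor a * factor⁻¹ a ≈ 1#
      factor-inverse a with class y Finₚ.≟ a
      ... | yes _ = s-inverse
      ... | no  _ = *-identityˡ 1#
      balance-old : ∀ {a b} → (a , b) ∈ˡ es → g a b ≈ d a * d⁻¹ b →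
        g a b ≈ factor (class a) * d a * (factor⁻¹ (class b) * d⁻¹ b)
      balance-old {a} {b} e∈ eq rewrite class-edge e∈ =
        sym (trans (regroup _ _ _ _) (trans (*-congʳ (factor-inverse (class b))) (trans (*-identityˡ _) (sym eq))))
      balance-new : g x y ≈ factor (class x) * d x * (factor⁻¹ (class y) * d⁻¹ y)
      balance-new with class y Finₚ.≟ class x | class y Finₚ.≟ class y
      ... | yes eq | _     = ⊥-elim (differ eq)
      ... | no _   | no ne = ⊥-elim (ne ≡.refl)
      ... | no _   | yes _ = sym (begin
        1# * d x * (g x y * d⁻¹ x * d y * d⁻¹ y)
          ≈⟨ solve 5 (λ b p p′ q q′ → con (+ 1) :* p :* (b :* p′ :* q :* q′) := b :* (p :* p′) :* (q :* q′))
               refl (g x y) (d x) (d⁻¹ x) (d y) (d⁻¹ y) ⟩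
        g x y * (d x * d⁻¹ x) * (d y * d⁻¹ y)
          ≈⟨ *-cong (*-congˡ (d-inverse x)) (d-inverse y) ⟩
        g x y * 1# * 1#
          ≈⟨ trans (*-identityʳ _) (*-identityʳ _) ⟩
        g x y ∎)

    potential : ∀ es → (∀ {x y} → (x , y) ∈ˡ es → g x y * g y x ≈ 1#) → ∃ (Potential g es)
    potential []             unit = n , potential-[]
    potential ((x , y) ∷ es) unit = potential-∷ x y (unit (here ≡.refl)) (proj₂ (potential es (unit ∘ there)))

  weighted : ∀ {n} → Graph n → Matrix n n → Matrix n n
  weighted G g i j = if Graph.adjacent G i j then g i j else 0#

  UnitWeights : ∀ {n} → Graph n → Matrix n n → Set ℓ
  UnitWeights G g = ∀ i j → Graph.Adjacent G i j → g i j * g j i ≈ 1#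

  module _ {n} (G : Graph n) (g : Matrix n n) (unit : UnitWeights G g) where
    open Graph G
    open GraphLemmas G

    -- No edge joins two final classes, so there are at most `ω` of them, which bounds the number
    -- `b` of unbalanced edges. Each such edge occupies two transposed positions of the difference
    -- matrix, whence `b + b`.
    switching : ∃ λ b → b +ℕ n ≤ length edges +ℕ ω × ∃ λ (d : Fin n → Carrier) → ∃ λ (d⁻¹ : Fin n → Carrier) →
      (∀ x → d x * d⁻¹ x ≈ 1#) ×
      RankAtMost (λ i j → weighted G g i j + - (d i * weighted G (λ _ _ → 1#) i j * d⁻¹ j)) (b +ℕ b)
    switching = length unbalanced
      , ℕₚ.≤-trans count (ℕₚ.+-monoʳ-≤ (length edges) (separated⇒≤ω representative separated))
      , d , d⁻¹ , d-inverse
      , ≡.subst (RankAtMost _) (≡.trans (length-++ unbalanced) (≡.cong (length unbalanced +ℕ_) (length-map swap unbalanced)))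
          (rankAtMost-support _ (unbalanced ++ map swap unbalanced) support)
      where
      open Potential (proj₂ (potential g edges (λ e∈ → unit _ _ (proj₂ (∈-edges⁻ e∈)))))
      class-adjacent : ∀ {x y} → Adjacent x y → class x ≡ class y
      class-adjacent {x} {y} adj with orient x y adj
      ... | _ , e∈ , inj₁ ≡.refl = class-edge e∈
      ... | _ , e∈ , inj₂ ≡.refl = ≡.sym (class-edge e∈)
      class-connected : ∀ {x y} → Connected x y → class x ≡ class y
      class-connected ε         = ≡.refl
      class-connected (adj ◅ w) = ≡.trans (class-adjacent adj) (class-connected w)
      separated : Separated representative
      separated a b conn = ≡.trans (≡.sym (class-rep a)) (≡.trans (class-connected conn) (class-rep b))
      reverse : ∀ {x y} → g x y * g y x ≈ 1# → g y x ≈ d y * d⁻¹ x → g x y ≈ d x * d⁻¹ y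
      reverse {x} {y} gg≈1 eq = begin
        g x y
          ≈⟨ trans (sym (trans (*-identityʳ _) (*-identityʳ _))) (*-cong (*-congˡ (sym (d-inverse x))) (sym (d-inverse y))) ⟩
        g x y * (d x * d⁻¹ x) * (d y * d⁻¹ y)
          ≈⟨ solve 5 (λ a p p′ q q′ → a :* (p :* p′) :* (q :* q′) := a :* (q :* p′) :* (p :* q′)) refl (g x y) (d x) (d⁻¹ x) (d y) (d⁻¹ y) ⟩
        g x y * (d y * d⁻¹ x) * (d x * d⁻¹ y)
          ≈⟨ *-congʳ (trans (*-congˡ (sym eq)) gg≈1) ⟩
        1# * (d x * d⁻¹ y)
          ≈⟨ *-identityˡ _ ⟩
        d x * d⁻¹ y ∎
      balanced : ∀ x y → Adjacent x y → g x y ≈ d x * d⁻¹ y ⊎ (x , y) ∈ˡ unbalanced ++ map swap unbalanced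
      balanced x y adj with orient x y adj
      ... | _ , e∈ , inj₁ ≡.refl = [ inj₁ , inj₂ ∘ ∈-++⁺ˡ ]′ (balance e∈)
      ... | _ , e∈ , inj₂ ≡.refl = [ inj₁ ∘ reverse (unit x y adj) , inj₂ ∘ ∈-++⁺ʳ unbalanced ∘ ∈-map⁺ swap ]′ (balance e∈)
      support : ∀ i j → weighted G g i j + - (d i * weighted G (λ _ _ → 1#) i j * d⁻¹ j) ≈ 0# ⊎
                        (i , j) ∈ˡ unbalanced ++ map swap unbalanced
      support i j with adjacent i j | balanced i j
      ... | false | _ = inj₁ (solve 2 (λ x y → con (+ 0) :+ :- (x :* con (+ 0) :* y) := con (+ 0)) refl _ _)
      ... | true  | b = [ (λ eq → inj₁ (trans (+-congʳ eq)
                            (solve 2 (λ x y → x :* y :+ :- (x :* con (+ 1) :* y) := con (+ 0)) refl _ _))) , inj₂ ]′ (b _)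

-- The pendant cycle inside the graph

∈-tabulate⁺ : ∀ {n} (b : Fin n → Bool) {x} → T (b x) → x ∈ tabulate b
∈-tabulate⁺ b {x} bx = lookup⇒[]= x _ (≡.trans (lookup∘tabulate b x) (Equivalence.to T-≡ bx))

∈-tabulate⁻ : ∀ {n} (b : Fin n → Bool) {x} → x ∈ tabulate b → T (b x)
∈-tabulate⁻ b {x} x∈ = Equivalence.from T-≡ (≡.trans (≡.sym (lookup∘tabulate b x)) ([]=⇒lookup x∈))

injection-∣∣ : ∀ {n k} (S : Subset n) {f : Fin k → Fin n} → Injective _≡_ _≡_ f → (∀ a → f a ∈ S) → k ≤ ∣ S ∣
injection-∣∣ S {f} inj f∈ = injective⇒≤ {f = λ a → proj₁ (position S (f∈ a))} λ {a} {b} eq →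
  inj (≡.trans (≡.sym (proj₂ (position S (f∈ a)))) (≡.trans (≡.cong (member S) eq) (proj₂ (position S (f∈ b)))))

[]ᵛ-injective : ∀ {n} → Injective _≡_ _≡_ ([]ᵛ {A = Fin n})
[]ᵛ-injective {x = ()}

∷ᵛ-injective : ∀ {n k} {x : Fin n} {f : Vector (Fin n) k} → (∀ a → f a ≢ x) →
  Injective _≡_ _≡_ f → Injective _≡_ _≡_ (x ∷ᵛ f)
∷ᵛ-injective fresh inj {Fin.zero}  {Fin.zero}  eq = ≡.refl
∷ᵛ-injective fresh inj {Fin.zero}  {Fin.suc b} eq = ⊥-elim (fresh b (≡.sym eq))
∷ᵛ-injective fresh inj {Fin.suc a} {Fin.zero}  eq = ⊥-elim (fresh a eq)
∷ᵛ-injective fresh inj {Fin.suc a} {Fin.suc b} eq = ≡.cong Fin.suc (inj eq)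

module _ {n k} (S : Subset n) (f : Vector (Fin n) k) where

  exhaustive : ∣ S ∣ ≡ k → Injective _≡_ _≡_ f → (∀ a → f a ∈ S) → ∀ {x} → x ∈ S → ∃ λ a → f a ≡ x
  exhaustive size inj f∈ {x} x∈ with any? (λ a → f a Finₚ.≟ x)
  ... | yes found = found
  ... | no  fresh = ⊥-elim (ℕₚ.<-irrefl (≡.sym size)
    (injection-∣∣ S {x ∷ᵛ f} (∷ᵛ-injective (λ a eq → fresh (a , eq)) inj) λ { Fin.zero → x∈ ; (Fin.suc a) → f∈ a }))

  extra-member : ∣ S ∣ ≡ suc k → ∃ λ x → x ∈ S × ∀ a → f a ≢ x
  extra-member size with any? (λ i → ¬? (any? (λ a → f a Finₚ.≟ member S i)))
  ... | yes (i , fresh) = member S i , member-∈ S i , λ a eq → fresh (a , eq)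
  ... | no  none        = ⊥-elim (ℕₚ.<-irrefl size (s≤s (injective⇒≤ {f = proj₁ ∘ hit} λ {i} {j} eq →
    member-injective S (≡.trans (≡.sym (proj₂ (hit i))) (≡.trans (≡.cong f eq) (proj₂ (hit j)))))))
    where
    hit : ∀ i → ∃ λ a → f a ≡ member S i
    hit i = decidable-stable (any? (λ a → f a Finₚ.≟ member S i)) λ fresh → none (i , fresh)

module Rotation {m} (root : Fin (suc m)) where
  private
    p = suc m

    mod-+ : ∀ x y → (x % p +ℕ y) % p ≡ (x +ℕ y) % p
    mod-+ x y = ≡.trans (%-distribˡ-+ (x % p) y p)
      (≡.trans (≡.cong (λ z → (z +ℕ y % p) % p) (m%n%n≡m%n x p)) (≡.sym (%-distribˡ-+ x y p)))

    toℕ-mod : ∀ x → toℕ (x mod p) ≡ x % p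
    toℕ-mod x = toℕ-fromℕ< (m%n<n x p)

    mod-cong : ∀ x y → x % p ≡ y % p → x mod p ≡ y mod p
    mod-cong x y eq = toℕ-injective (≡.trans (toℕ-mod x) (≡.trans eq (≡.sym (toℕ-mod y))))

    toℕ-% : (a : Fin p) → toℕ a % p ≡ toℕ a
    toℕ-% a = m<n⇒m%n≡m (toℕ<n a)

    complement : toℕ root +ℕ (p ∸ toℕ root) ≡ p
    complement = ℕₚ.m+[n∸m]≡n (ℕₚ.<⇒≤ (toℕ<n root))

  -- Defined on all naturals so that the walk round the cycle has two ends, `0` and `p`, both naming
  -- the root.
  at : ℕ → Fin p
  at k = (k +ℕ toℕ root) mod p

  at-0 : at 0 ≡ root
  at-0 = toℕ-injective (≡.trans (toℕ-mod (toℕ root)) (toℕ-% root))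

  at-p : at p ≡ at 0
  at-p = mod-cong (p +ℕ toℕ root) (toℕ root)
    (≡.trans (≡.cong (_% p) (ℕₚ.+-comm p (toℕ root))) ([m+n]%n≡m%n (toℕ root) p))

  next-at : ∀ k → next (at k) ≡ at (suc k)
  next-at k = mod-cong (suc (toℕ (at k))) (suc x) (begin
    suc (toℕ (at k)) % p   ≡⟨ ≡.cong (λ y → suc y % p) (toℕ-mod x) ⟩
    suc (x % p) % p        ≡⟨ ≡.cong (_% p) (ℕₚ.+-comm 1 (x % p)) ⟩
    (x % p +ℕ 1) % p       ≡⟨ mod-+ x 1 ⟩
    (x +ℕ 1) % p           ≡⟨ ≡.cong (_% p) (ℕₚ.+-comm x 1) ⟩
    suc x % p              ∎)
    where
    open ≡-Reasoning
    x = k +ℕ toℕ root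

  index : Fin p → Fin p
  index a = (toℕ a +ℕ (p ∸ toℕ root)) mod p

  index-at : ∀ k → k < p → toℕ (index (at k)) ≡ k
  index-at k k<p = begin
    toℕ (index (at k))                         ≡⟨ toℕ-mod (toℕ (at k) +ℕ (p ∸ toℕ root)) ⟩
    (toℕ (at k) +ℕ (p ∸ toℕ root)) % p         ≡⟨ ≡.cong (λ x → (x +ℕ (p ∸ toℕ root)) % p) (toℕ-mod (k +ℕ toℕ root)) ⟩
    ((k +ℕ toℕ root) % p +ℕ (p ∸ toℕ root)) % p ≡⟨ mod-+ (k +ℕ toℕ root) (p ∸ toℕ root) ⟩
    (k +ℕ toℕ root +ℕ (p ∸ toℕ root)) % p      ≡⟨ ≡.cong (_% p) (ℕₚ.+-assoc k (toℕ root) (p ∸ toℕ root)) ⟩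
    (k +ℕ (toℕ root +ℕ (p ∸ toℕ root))) % p    ≡⟨ ≡.cong (λ x → (k +ℕ x) % p) complement ⟩
    (k +ℕ p) % p                               ≡⟨ [m+n]%n≡m%n k p ⟩
    k % p                                      ≡⟨ m<n⇒m%n≡m k<p ⟩
    k                                          ∎
    where open ≡-Reasoning

  at-index : ∀ a → at (toℕ (index a)) ≡ a
  at-index a = toℕ-injective (begin
    toℕ (at (toℕ (index a)))                   ≡⟨ toℕ-mod (toℕ (index a) +ℕ toℕ root) ⟩
    (toℕ (index a) +ℕ toℕ root) % p            ≡⟨ ≡.cong (λ x → (x +ℕ toℕ root) % p) (toℕ-mod (toℕ a +ℕ (p ∸ toℕ root))) ⟩
    ((toℕ a +ℕ (p ∸ toℕ root)) % p +ℕ toℕ root) % p ≡⟨ mod-+ (toℕ a +ℕ (p ∸ toℕ root)) (toℕ root) ⟩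
    (toℕ a +ℕ (p ∸ toℕ root) +ℕ toℕ root) % p  ≡⟨ ≡.cong (_% p) (ℕₚ.+-assoc (toℕ a) (p ∸ toℕ root) (toℕ root)) ⟩
    (toℕ a +ℕ (p ∸ toℕ root +ℕ toℕ root)) % p  ≡⟨ ≡.cong (λ x → (toℕ a +ℕ x) % p) (≡.trans (ℕₚ.+-comm (p ∸ toℕ root) (toℕ root)) complement) ⟩
    (toℕ a +ℕ p) % p                           ≡⟨ [m+n]%n≡m%n (toℕ a) p ⟩
    toℕ a % p                                  ≡⟨ toℕ-% a ⟩
    toℕ a                                      ∎)
    where open ≡-Reasoning

  at-injective : ∀ {k l} → k < p → l < p → at k ≡ at l → k ≡ l
  at-injective {k} {l} k<p l<p eq = ≡.trans (≡.sym (index-at k k<p)) (≡.trans (≡.cong (toℕ ∘ index) eq) (index-at l l<p))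

  -- The walk starts at the root, the gain of the cycle at position 0; this permutation identifies
  -- the two products.
  rotation : Permutation p p
  rotation = permutation (at ∘ toℕ) index at-index (λ k → toℕ-injective (index-at (toℕ k) (toℕ<n k)))

module Pendant {n} (G : Graph n) {m} (C : PendantCycle G (suc m)) where
  open Graph G
  open GraphLemmas G
  open PendantCycle C
  open IsInducedCycle isInducedCycle
  open Rotation root
  private
    p = suc m

  2≤m : 2 ≤ m
  2≤m = ℕₚ.≤-pred 3≤p

  -- The vertices of the cycle in cyclic order from v; w k depends on k modulo p.
  w : ℕ → Fin n
  w k = cycle (at k)

  w-0 : w 0 ≡ v
  w-0 = ≡.cong cycle at-0

  w-p : w p ≡ w 0
  w-p = ≡.cong cycle at-p

  w-injective : ∀ {k l} → k < p → l < p → w k ≡ w l → k ≡ l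
  w-injective k<p l<p eq = at-injective k<p l<p (injective eq)

  w-adjacent : ∀ k → Adjacent (w k) (w (suc k))
  w-adjacent k = Equivalence.from (adjacency _ _) (inj₁ (≡.sym (next-at k)))

  w-adjacent⁻ : ∀ {k l} → Adjacent (w k) (w l) → w l ≡ w (suc k) ⊎ w k ≡ w (suc l)
  w-adjacent⁻ {k} {l} adj = Sum.map
    (λ eq → ≡.cong cycle (≡.trans eq (next-at k))) (λ eq → ≡.cong cycle (≡.trans eq (next-at l)))
    (Equivalence.to (adjacency _ _) adj)

  OnCycle : Fin n → Set
  OnCycle x = ∃ λ a → cycle a ≡ x

  onCycle? : ∀ x → Dec (OnCycle x)
  onCycle? x = any? (λ a → cycle a Finₚ.≟ x)

  onCycle⇒w : ∀ {x} → OnCycle x → ∃ λ k → k < p × w k ≡ x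
  onCycle⇒w (a , eq) = toℕ (index a) , toℕ<n (index a) , ≡.trans (≡.cong cycle (at-index a)) eq

  ∈V[F]⁺ : ∀ {x} → ¬ OnCycle x → x ∈ V[F]
  ∈V[F]⁺ {x} off = x∉p⇒x∈∁p λ x∈ → reject (onCycle? x) (∈-tabulate⁻ _ x∈)
    where
    reject : (d : Dec (OnCycle x)) → ¬ T (does d)
    reject (yes on) _ = off on

  ∈V[F]⁻ : ∀ {x} → x ∈ V[F] → ¬ OnCycle x
  ∈V[F]⁻ {x} x∈ on = x∈∁p⇒x∉p x∈ (∈-tabulate⁺ _ (accept (onCycle? x)))
    where
    accept : (d : Dec (OnCycle x)) → T (does d)
    accept (yes _)  = _
    accept (no off) = off on

  ∈V[H]⁺ : ∀ {x} → ¬ OnCycle x ⊎ x ≡ v → x ∈ V[H]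
  ∈V[H]⁺ (inj₁ off)    = x∈p∪q⁺ (inj₁ (∈V[F]⁺ off))
  ∈V[H]⁺ (inj₂ ≡.refl) = x∈p∪q⁺ (inj₂ (x∈⁅x⁆ v))

  ∈V[H]⁻ : ∀ {x} → x ∈ V[H] → ¬ OnCycle x ⊎ x ≡ v
  ∈V[H]⁻ x∈ = Sum.map ∈V[F]⁻ (x∈⁅y⁆⇒x≡y v) (x∈p∪q⁻ V[F] _ x∈)

  0<m : 0 < m
  0<m = ℕₚ.<⇒≤ 2≤m

  private
    neighbour : ∀ {x y} → Adjacent x y → y ∈ neighbours x
    neighbour adj = ∈-tabulate⁺ _ adj

    pair-injective : ∀ {x y : Fin n} → x ≢ y → Injective _≡_ _≡_ (x ∷ᵛ y ∷ᵛ []ᵛ)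
    pair-injective x≢y = ∷ᵛ-injective (λ { Fin.zero eq → x≢y (≡.sym eq) })
      (∷ᵛ-injective (λ ()) []ᵛ-injective)

    on-pair : ∀ {x y} → OnCycle x → OnCycle y → ∀ {z} → (∃ λ a → (x ∷ᵛ y ∷ᵛ []ᵛ) a ≡ z) → OnCycle z
    on-pair on-x on-y (Fin.zero , ≡.refl)         = on-x
    on-pair on-x on-y (Fin.suc Fin.zero , ≡.refl) = on-y

  -- Predecessor and successor on the cycle are distinct, so they exhaust a neighbourhood of size 2.
  neighbour-onCycle : ∀ k → suc k < p → ∀ {x} → Adjacent (w (suc k)) x → OnCycle x
  neighbour-onCycle k k<p adj = on-pair (_ , ≡.refl) (_ , ≡.refl)
    (exhaustive (neighbours (w (suc k))) (w k ∷ᵛ w (suc (suc k)) ∷ᵛ []ᵛ)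
      (other-degree (at (suc k)) (λ eq → ℕₚ.1+n≢0 (at-injective k<p (s≤s z≤n) (≡.trans eq (≡.sym at-0)))))
      (pair-injective distinct)
      (λ { Fin.zero → neighbour (adjacent-sym (w-adjacent k)) ; (Fin.suc Fin.zero) → neighbour (w-adjacent (suc k)) })
      (neighbour adj))
    where
    -- If `k + 2 = p`, then `w` has wrapped round to `w 0`; equality would give `k = 0` and `p = 2`,
    -- against `3≤p`.
    distinct : w k ≢ w (suc (suc k))
    distinct eq with ℕₚ.m≤n⇒m<n∨m≡n k<p
    ... | inj₁ lt = ℕₚ.m≢1+n+m k {n = 1} (w-injective (ℕₚ.<-trans (ℕₚ.n<1+n k) k<p) lt eq)
    ... | inj₂ eq′ = ℕₚ.<-irrefl (≡.trans (≡.cong suc (≡.sym (≡.cong suc k≡0))) eq′) 3≤p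
      where
      k≡0 : k ≡ 0
      k≡0 = w-injective (ℕₚ.<-trans (ℕₚ.n<1+n k) k<p) (s≤s z≤n) (≡.trans eq (≡.trans (≡.cong w eq′) w-p))

  private
    v-successor : Adjacent v (w 1)
    v-successor = ≡.subst (λ x → Adjacent x (w 1)) w-0 (w-adjacent 0)

    v-predecessor : Adjacent v (w m)
    v-predecessor = adjacent-sym (≡.subst (Adjacent (w m)) (≡.trans w-p w-0) (w-adjacent m))

    w1≢wm : w 1 ≢ w m
    w1≢wm eq = ℕₚ.<-irrefl (w-injective (s≤s 0<m) (ℕₚ.n<1+n m) eq) 2≤m

    outer : ∃ λ u → u ∈ neighbours v × ∀ a → (w 1 ∷ᵛ w m ∷ᵛ []ᵛ) a ≢ u
    outer = extra-member (neighbours v) (w 1 ∷ᵛ w m ∷ᵛ []ᵛ) root-degree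

  u : Fin n
  u = proj₁ outer

  v-u : Adjacent v u
  v-u = ∈-tabulate⁻ _ (proj₁ (proj₂ outer))

  -- The cycle is induced, so on it `v` is adjacent to `w 1` and `w m` only, and `u` was chosen
  -- different from both.
  u-offCycle : ¬ OnCycle u
  u-offCycle on with onCycle⇒w on
  ... | k , k<p , wk≡u with w-adjacent⁻ {0} {k} (≡.subst₂ Adjacent (≡.sym w-0) (≡.sym wk≡u) v-u)
  ...   | inj₁ eq = proj₂ (proj₂ outer) Fin.zero (≡.trans (≡.sym eq) wk≡u)
  ...   | inj₂ eq = proj₂ (proj₂ outer) (Fin.suc Fin.zero) (≡.trans (≡.cong w (≡.sym k≡m)) wk≡u)
    where
    k≡m : k ≡ m
    k≡m with ℕₚ.m≤n⇒m<n∨m≡n k<p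
    ... | inj₁ lt  = ⊥-elim (ℕₚ.1+n≢0 (w-injective lt (s≤s z≤n) (≡.sym eq)))
    ... | inj₂ eq′ = ℕₚ.suc-injective eq′

  -- Other cycle vertices have all their neighbours on the cycle; at `v` the three neighbours are
  -- `u`, `w 1` and `w m`.
  leave-cycle : ∀ {x y} → OnCycle x → ¬ OnCycle y → Adjacent x y → x ≡ v × y ≡ u
  leave-cycle on off adj with onCycle⇒w on
  ... | suc k , k<p , ≡.refl = ⊥-elim (off (neighbour-onCycle k k<p adj))
  ... | zero  , _   , ≡.refl with exhaustive (neighbours v) (u ∷ᵛ w 1 ∷ᵛ w m ∷ᵛ []ᵛ) root-degree
    (∷ᵛ-injective (proj₂ (proj₂ outer)) (pair-injective w1≢wm))
    (λ { Fin.zero → proj₁ (proj₂ outer) ; (Fin.suc Fin.zero) → neighbour v-successor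
       ; (Fin.suc (Fin.suc Fin.zero)) → neighbour v-predecessor })
    (neighbour (≡.subst (λ x → Adjacent x _) w-0 adj))
  ...   | Fin.zero , eq = w-0 , ≡.sym eq
  ...   | Fin.suc a , eq = ⊥-elim (off (on-pair (_ , ≡.refl) (_ , ≡.refl) (a , eq)))

  w-step : ∀ {k l} → k < p → l < p → w k ≡ w (suc l) → k ≡ suc l ⊎ (k ≡ 0 × l ≡ m)
  w-step {k} {l} k<p l<p eq with ℕₚ.m≤n⇒m<n∨m≡n l<p
  ... | inj₁ lt     = inj₁ (w-injective k<p lt eq)
  ... | inj₂ ≡.refl = inj₂ (w-injective k<p (s≤s z≤n) (≡.trans eq w-p) , ≡.refl)

  private
    v-onCycle : OnCycle v
    v-onCycle = root , ≡.refl

    w-edge : Fin p → Fin n × Fin n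
    w-edge k = w (toℕ k) , w (suc (toℕ k))

    -- Only a cycle of length 2 would use an edge in both directions. The wrap-around cases of
    -- `w-step` reduce to `m ≤ 1`, which `2≤m` forbids.
    no-reversal : ∀ {k l} → k < p → l < p → w k ≡ w (suc l) → w (suc k) ≢ w l
    no-reversal k<p l<p eq eq′ with w-step k<p l<p eq | w-step l<p k<p (≡.sym eq′)
    ... | inj₁ k≡1+l          | inj₁ l≡1+k          = ℕₚ.m≢1+n+m _ {n = 1} (≡.trans k≡1+l (≡.cong suc l≡1+k))
    ... | inj₁ ≡.refl         | inj₂ (≡.refl , ≡.refl) = ℕₚ.<-irrefl ≡.refl 2≤m
    ... | inj₂ (≡.refl , ≡.refl) | inj₁ ≡.refl         = ℕₚ.<-irrefl ≡.refl 2≤m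
    ... | inj₂ (_ , l≡m)      | inj₂ (l≡0 , _)      = ℕₚ.<⇒≢ 0<m (≡.trans (≡.sym l≡0) l≡m)

    w-edge-injective : ∀ k l → SameEdge (w-edge k) (w-edge l) → k ≡ l
    w-edge-injective k l (inj₁ eq) = toℕ-injective (w-injective (toℕ<n k) (toℕ<n l) (≡.cong proj₁ eq))
    w-edge-injective k l (inj₂ eq) = ⊥-elim (no-reversal (toℕ<n k) (toℕ<n l) (≡.cong proj₁ eq) (≡.cong proj₂ eq))

    off-V[F] : ∀ {x} → x ∉ V[F] → OnCycle x
    off-V[F] {x} x∉ = decidable-stable (onCycle? x) (x∉ ∘ ∈V[F]⁺)

    edges-F : length (Graph.edges (G [ V[F] ])) +ℕ suc p ≤ length edges
    edges-F = SubgraphLemmas.edges-subgraph G V[F] ((v , u) ∷ᵛ w-edge)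
      (λ { Fin.zero → v-u ; (Fin.suc k) → w-adjacent (toℕ k) })
      (λ { Fin.zero    Fin.zero    _         → ≡.refl
         ; Fin.zero    (Fin.suc l) (inj₁ eq) → ⊥-elim (u-offCycle (_ , ≡.sym (≡.cong proj₂ eq)))
         ; Fin.zero    (Fin.suc l) (inj₂ eq) → ⊥-elim (u-offCycle (_ , ≡.sym (≡.cong proj₂ eq)))
         ; (Fin.suc k) Fin.zero    (inj₁ eq) → ⊥-elim (u-offCycle (_ , ≡.cong proj₂ eq))
         ; (Fin.suc k) Fin.zero    (inj₂ eq) → ⊥-elim (u-offCycle (_ , ≡.cong proj₁ eq))
         ; (Fin.suc k) (Fin.suc l) same      → ≡.cong Fin.suc (w-edge-injective k l same) })
      (λ { Fin.zero (v∈ , _) → ∈V[F]⁻ v∈ v-onCycle ; (Fin.suc k) (w∈ , _) → ∈V[F]⁻ w∈ (_ , ≡.refl) })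

    edges-H : length (Graph.edges (G [ V[H] ])) +ℕ p ≤ length edges
    edges-H = SubgraphLemmas.edges-subgraph G V[H] w-edge (w-adjacent ∘ toℕ) w-edge-injective
      λ k (x∈ , y∈) → adjacent-irrefl (≡.subst₂ Adjacent (is-v x∈) (is-v y∈) (w-adjacent (toℕ k)))
      where
      is-v : ∀ {a} → cycle a ∈ V[H] → cycle a ≡ v
      is-v x∈ = [ (λ off → ⊥-elim (off (_ , ≡.refl))) , id ]′ (∈V[H]⁻ x∈)

    order-F : n ≤ ∣ V[F] ∣ +ℕ p
    order-F = order-≤ V[F] cycle cover
      where
      cover : ∀ x → x ∈ V[F] ⊎ OnCycle x
      cover x with onCycle? x
      ... | yes on = inj₂ on
      ... | no off = inj₁ (∈V[F]⁺ off)

  cover-H : ∀ x → x ∈ V[H] ⊎ ∃ λ (k : Fin m) → w (suc (toℕ k)) ≡ x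
  cover-H x with onCycle? x
  ... | no off = inj₁ (∈V[H]⁺ (inj₁ off))
  ... | yes on with onCycle⇒w on
  ...   | zero  , _       , eq = inj₁ (∈V[H]⁺ (inj₂ (≡.trans (≡.sym eq) w-0)))
  ...   | suc k , s≤s k<m , eq = inj₂ (fromℕ< k<m , ≡.trans (≡.cong (w ∘ suc) (toℕ-fromℕ< k<m)) eq)

  private
    ω-F : Graph.ω (G [ V[F] ]) ≤ ω
    ω-F = SubgraphLemmas.ω-collapse G V[F] {u} (∈V[F]⁺ u-offCycle) λ x y adj x∉ y∈ →
      proj₂ (leave-cycle (off-V[F] x∉) (∈V[F]⁻ y∈) adj)

    ω-H : Graph.ω (G [ V[H] ]) ≤ ω
    ω-H = SubgraphLemmas.ω-collapse G V[H] {v} (∈V[H]⁺ (inj₂ ≡.refl)) λ x y adj x∉ y∈ →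
      [ (λ off → ⊥-elim (x∉ (∈V[H]⁺ (inj₂ (proj₁ (leave-cycle
          (decidable-stable (onCycle? x) (x∉ ∘ ∈V[H]⁺ ∘ inj₁)) off adj)))))) , id ]′ (∈V[H]⁻ y∈)

  cyclomatic-F : ∣ V[F] ∣ ≤ length (Graph.edges (G [ V[F] ])) +ℕ Graph.ω (G [ V[F] ]) →
    suc (cyclomatic (G [ V[F] ])) ≤ cyclomatic G
  cyclomatic-F order = cyclomatic-subgraph G V[F] p order edges-F order-F ω-F

  cyclomatic-H : ∣ V[H] ∣ ≤ length (Graph.edges (G [ V[H] ])) +ℕ Graph.ω (G [ V[H] ]) →
    suc (cyclomatic (G [ V[H] ])) ≤ cyclomatic G
  cyclomatic-H order = cyclomatic-subgraph G V[H] m order edges-H (order-≤ V[H] (w ∘ suc ∘ toℕ) cover-H) ω-H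

-- Rank of a weighted graph with a pendant cycle

module PendantRank {c ℓ} (K : DiscreteField c ℓ) {n} (G : Graph n) {m} (C : PendantCycle G (suc m)) where
  open DiscreteField K hiding (zero)
  open RankTheory K
  open LinearAlgebra K using (Matrix; rank)
  open Switching K
  open ClosedWalks K
  open Graph G
  open GraphLemmas G
  open PendantCycle C
  open Rotation root
  open Pendant G C
  open RawMonoidOps *-rawMonoid using () renaming (sum to product; _×_ to power)
  open CommutativeMonoidSum *-commutativeMonoid using (sum-cong-≋; sum-permute)
  private
    p = suc m

    weighted-edge : ∀ (g : Matrix n n) {x y} → Adjacent x y → weighted G g x y ≈ g x y
    weighted-edge g {x} {y} adj with adjacent x y
    ... | true = refl

    weighted-nonEdge : ∀ (g : Matrix n n) {x y} → ¬ Adjacent x y → weighted G g x y ≈ 0#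
    weighted-nonEdge g {x} {y} ¬adj with adjacent x y
    ... | true  = ⊥-elim (¬adj _)
    ... | false = refl

    forward backward : Matrix n n → ℕ → Carrier
    forward  g k = g (w k) (w (suc k))
    backward g k = g (w (suc k)) (w k)

  δ : Fin (∣ V[H] ∣) → Carrier
  δ j = if does (member V[H] j Finₚ.≟ v) then 1# else 0#

  private
    δ-v : ∀ {j} → member V[H] j ≡ v → δ j ≈ 1#
    δ-v {j} eq with member V[H] j Finₚ.≟ v
    ... | yes _ = refl
    ... | no ne = ⊥-elim (ne eq)

    δ-other : ∀ {j} → member V[H] j ≢ v → δ j ≈ 0#
    δ-other {j} ne with member V[H] j Finₚ.≟ v
    ... | yes eq = ⊥-elim (ne eq)
    ... | no _   = refl

    vᴴ : ∃ λ i → member V[H] i ≡ v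
    vᴴ = position V[H] (∈V[H]⁺ (inj₂ ≡.refl))

  δ-support : ∃ λ i → ∀ j → j ≢ i → δ j ≈ 0#
  δ-support = proj₁ vᴴ , λ j j≢ → δ-other {j} λ eq → j≢ (member-injective V[H] (≡.trans eq (≡.sym (proj₂ vᴴ))))

  private
    entry-path : ∀ g k l → k < m → l < m →
      walk (forward g) (backward g) (suc k) (suc l) ≈ weighted G g (w (suc k)) (w (suc l))
    entry-path g k l k<m l<m with suc l ℕₚ.≟ suc (suc k) | suc k ℕₚ.≟ suc (suc l)
    ... | yes ≡.refl | _ = trans (reflexive (walk-forward (forward g) (backward g) (suc k)))
                             (sym (weighted-edge g (w-adjacent (suc k))))
    ... | no _ | yes ≡.refl = trans (reflexive (walk-backward (forward g) (backward g) (suc l)))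
                                (sym (weighted-edge g (adjacent-sym (w-adjacent (suc l)))))
    ... | no l≢ | no k≢ = trans (reflexive (walk-far (forward g) (backward g) _ _ l≢ k≢))
      (sym (weighted-nonEdge g λ adj → [ absurd l<m k<m l≢ , absurd k<m l<m k≢ ]′ (w-adjacent⁻ {suc k} {suc l} adj)))
      where
      absurd : ∀ {a b} → a < m → b < m → suc a ≢ suc (suc b) → w (suc a) ≢ w (suc (suc b))
      absurd a<m b<m ne eq with w-step (s≤s a<m) (s≤s b<m) eq
      ... | inj₁ eq′      = ne eq′
      ... | inj₂ (() , _)

    -- Both ends of the walk stand for `v`. As `1 ≠ m`, no cycle vertex is next to both ends, so at
    -- most one summand is nonzero and it is the true entry.
    entry-v : ∀ g k → k < m →
      walk (forward g) (backward g) (suc k) 0 + walk (forward g) (backward g) (suc k) p ≈ weighted G g (w (suc k)) v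
    entry-v g k k<m with suc k ℕₚ.≟ 1 | suc k ℕₚ.≟ m
    ... | yes ≡.refl | yes 1≡m = ⊥-elim (ℕₚ.<-irrefl 1≡m 2≤m)
    ... | yes ≡.refl | no 1≢m = trans (+-congˡ (reflexive (walk-far (forward g) (backward g) 1 p
                                    (1≢m ∘ ≡.sym ∘ ℕₚ.suc-injective) (λ ()))))
        (trans (+-identityʳ _) (sym (trans (reflexive (≡.cong (weighted G g (w 1)) (≡.sym w-0)))
          (weighted-edge g (adjacent-sym (w-adjacent 0))))))
    ... | no k≢0 | yes ≡.refl = trans (+-cong (reflexive (walk-far (forward g) (backward g) (suc k) 0 (λ ()) k≢0))
                                  (reflexive (walk-forward (forward g) (backward g) (suc k))))
        (trans (+-identityˡ _) (trans (sym (weighted-edge g (w-adjacent (suc k))))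
          (reflexive (≡.cong (weighted G g (w (suc k))) (≡.trans w-p w-0)))))
    ... | no k≢0 | no k≢m = trans (+-cong
          (reflexive (walk-far (forward g) (backward g) (suc k) 0 (λ ()) k≢0))
          (reflexive (walk-far (forward g) (backward g) (suc k) p (k≢m ∘ ≡.sym ∘ ℕₚ.suc-injective)
            (λ eq → ℕₚ.<-irrefl ≡.refl (ℕₚ.<-trans (≡.subst (_< m) (ℕₚ.suc-injective eq) k<m) (ℕₚ.n<1+n m))))))
        (trans (+-identityˡ _) (sym (weighted-nonEdge g λ adj →
          [ (λ eq → [ (λ ()) , (λ (_ , eq′) → k≢m eq′) ]′ (w-step (s≤s z≤n) (s≤s k<m) eq))
          , (λ eq → k≢0 (w-injective (s≤s k<m) (s≤s (ℕₚ.<⇒≤ 2≤m)) eq))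
          ]′ (w-adjacent⁻ {suc k} {0} (≡.subst (Adjacent (w (suc k))) (≡.sym w-0) adj)))))

    weighted-transpose : ∀ (g : Matrix n n) x y → weighted G g x y ≈ weighted G (λ i j → g j i) y x
    weighted-transpose g x y rewrite symmetric x y = refl

    vertex : Fin m ⊎ Fin (∣ V[H] ∣) → Fin n
    vertex (inj₁ k) = w (suc (toℕ k))
    vertex (inj₂ j) = member V[H] j

    vertex-surjective : ∀ x → ∃ λ y → x ≡ vertex y
    vertex-surjective x with cover-H x
    ... | inj₁ x∈       = inj₂ (proj₁ (position V[H] x∈)) , ≡.sym (proj₂ (position V[H] x∈))
    ... | inj₂ (k , eq) = inj₁ k , ≡.sym eq

    nonEdge : ∀ k → k < m → ∀ {j} → member V[H] j ≢ v → ¬ Adjacent (w (suc k)) (member V[H] j)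
    nonEdge k k<m {j} ne adj = [ (λ off → off (neighbour-onCycle k (s≤s k<m) adj)) , ne ]′ (∈V[H]⁻ (member-∈ V[H] j))

    entry-H : ∀ g k → k < m → ∀ j →
      (walk (forward g) (backward g) (suc k) 0 + walk (forward g) (backward g) (suc k) p) * δ j
        ≈ weighted G g (w (suc k)) (member V[H] j)
    entry-H g k k<m j = go (member V[H] j Finₚ.≟ v)
      where
      go : Dec (member V[H] j ≡ v) → _
      go (yes eq) = trans (*-cong (entry-v g k k<m) (δ-v {j} eq))
        (trans (*-identityʳ _) (reflexive (≡.cong (weighted G g (w (suc k))) (≡.sym eq))))
      go (no ne) = trans (*-congˡ (δ-other {j} ne)) (trans (zeroʳ _) (sym (weighted-nonEdge g (nonEdge k k<m {j} ne))))

  module _ (g : Matrix n n) (unit : UnitWeights G g) where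
    f f′ : ℕ → Carrier
    f  = forward g
    f′ = backward g

    H-matrix : Matrix ∣ V[H] ∣ ∣ V[H] ∣
    H-matrix i j = weighted G g (member V[H] i) (member V[H] j)

    open Glued H-matrix δ

    f-inverse : MutuallyInverse f f′
    f-inverse k = unit _ _ (w-adjacent k)

    private
      entries : ∀ x y → glued m f f′ x y ≈ weighted G g (vertex x) (vertex y)
      entries (inj₁ k) (inj₁ l) = entry-path g (toℕ k) (toℕ l) (toℕ<n k) (toℕ<n l)
      entries (inj₁ k) (inj₂ j) = entry-H g (toℕ k) (toℕ<n k) j
      -- The previous case for the transposed weights, whose forward arcs are the backward arcs of
      -- `g`.
      entries (inj₂ i) (inj₁ l) = trans (*-comm _ _) (trans (*-congʳ (reflexive (≡.cong₂ _+_
          (walk-transpose f f′ 0 (suc (toℕ l))) (walk-transpose f f′ p (suc (toℕ l))))))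
        (trans (entry-H (λ x y → g y x) (toℕ l) (toℕ<n l) i)
          (weighted-transpose (λ x y → g y x) (w (suc (toℕ l))) (member V[H] i))))
      -- The two ends are not consecutive on the walk, so gluing creates no loop and the block of
      -- `H` is unchanged.
      entries (inj₂ i) (inj₂ j) = trans (+-congˡ (trans (*-congʳ (trans (*-congˡ (trans (+-cong
          (+-congˡ (reflexive (walk-far f f′ 0 p (λ eq → ℕₚ.<-irrefl (≡.sym (ℕₚ.suc-injective eq)) 0<m) (λ ()))))
          (+-cong (reflexive (walk-far f f′ p 0 (λ ()) (λ eq → ℕₚ.<-irrefl (≡.sym (ℕₚ.suc-injective eq)) 0<m)))
                  (reflexive (walk-far f f′ p p (ℕₚ.m≢1+n+m p {n = 0}) (ℕₚ.m≢1+n+m p {n = 0})))))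
          (trans (+-cong (+-identityʳ _) (+-identityʳ _)) (+-identityʳ _)))) (zeroʳ _))) (zeroˡ _)))
        (+-identityʳ _)

    hasRank-glued : ∀ {k} → HasRank (glued m f f′) k → HasRank (weighted G g) k
    hasRank-glued rk = hasRank-extend {f = vertex} {h = vertex} (inj₂ ∘ vertex-surjective) (inj₂ ∘ vertex-surjective)
      (hasRank-cong entries rk)

    cycleProduct : Carrier
    cycleProduct = product (λ a → g (cycle a) (cycle (next a)))

    private
      prod≈product : ∀ k (h : ℕ → Carrier) → prod k h ≈ product {k} (h ∘ toℕ)
      prod≈product zero    h = refl
      prod≈product (suc k) h = *-congˡ (prod≈product k (h ∘ suc))

    prod-f : prod p f ≈ cycleProduct
    prod-f = trans (prod≈product p f) (trans
      (sum-cong-≋ {p} (λ k → reflexive (≡.cong (g (w (toℕ k))) (≡.cong cycle (≡.sym (next-at (toℕ k)))))))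
      (sym (sum-permute (λ a → g (cycle a) (cycle (next a))) rotation)))

    F-matrix : Matrix ∣ V[F] ∣ ∣ V[F] ∣
    F-matrix i j = weighted G g (member V[F] i) (member V[F] j)

    private
      F⊆H : ∀ i → ∃ λ j → member V[H] j ≡ member V[F] i
      F⊆H i = position V[H] (∈V[H]⁺ (inj₁ (∈V[F]⁻ (member-∈ V[F] i))))

      e : Fin (∣ V[F] ∣) → Fin (∣ V[H] ∣)
      e = proj₁ ∘ F⊆H

      e-matrix : ∀ i j → F-matrix i j ≈ H-matrix (e i) (e j)
      e-matrix i j = reflexive (≡.cong₂ (weighted G g) (≡.sym (proj₂ (F⊆H i))) (≡.sym (proj₂ (F⊆H j))))

      H-classify : ∀ j → j ≡ proj₁ vᴴ ⊎ ∃ λ i → j ≡ e i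
      H-classify j with ∈V[H]⁻ (member-∈ V[H] j)
      ... | inj₂ eq  = inj₁ (member-injective V[H] (≡.trans eq (≡.sym (proj₂ vᴴ))))
      ... | inj₁ off with position V[F] (∈V[F]⁺ off)
      ...   | i , eq = inj₂ (i , member-injective V[H] (≡.trans (≡.sym eq) (≡.sym (proj₂ (F⊆H i)))))

      e≢v : ∀ i → member V[H] (e i) ≢ v
      e≢v i eq = ∈V[F]⁻ (member-∈ V[F] i) (root , ≡.trans (≡.sym eq) (proj₂ (F⊆H i)))

    rank-F≤H : rank F-matrix ≤ rank H-matrix
    rank-F≤H = proj₂ (hasRank-rank F-matrix) _
      (rankAtMost-cong (λ i j → sym (e-matrix i j)) (rankAtMost-submatrix e e (proj₁ (hasRank-rank H-matrix))))

    rank-H≤2+F : rank H-matrix ≤ 2 +ℕ rank F-matrix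
    rank-H≤2+F = proj₂ (hasRank-rank H-matrix) _
      (rankAtMost-insertVertex {f = e} (proj₁ vᴴ) H-classify (rankAtMost-cong e-matrix (proj₁ (hasRank-rank F-matrix))))

    -- Here `p = suc q * 2`, so the power is the sign `(-1)^(p/2)` and `q * 2` stands for `p - 2`.
    rank-typeA : ∀ q → m ≡ suc (q *ℕ 2) → cycleProduct ≈ power (suc q) (- 1#) →
      rank (weighted G g) ≡ q *ℕ 2 +ℕ rank H-matrix
    rank-typeA q ≡.refl eq = hasRank-unique (hasRank-rank _)
      (hasRank-glued (hasRank-typeA q f-inverse (trans prod-f eq) (hasRank-rank H-matrix)))

    rank-typeB : ∀ q → m ≡ suc (q *ℕ 2) → ¬ (cycleProduct ≈ power (suc q) (- 1#)) →
      rank (weighted G g) ≡ suc q *ℕ 2 +ℕ rank F-matrix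
    rank-typeB q ≡.refl neq = hasRank-unique (hasRank-rank _)
      (hasRank-glued (hasRank-typeB {e = e} (proj₁ vᴴ) H-classify
        (weighted-nonEdge g adjacent-irrefl) (δ-v {proj₁ vᴴ} (proj₂ vᴴ)) (λ i → δ-other {e i} (e≢v i))
        q f-inverse (λ eq → neq (trans (sym prod-f) eq))
        (hasRank-cong e-matrix (hasRank-rank F-matrix))))

    rank-odd : ∀ q → m ≡ q *ℕ 2 → ∃ λ t →
      rank (weighted G g) ≡ q *ℕ 2 +ℕ rank (λ i j → H-matrix i j + δ i * t * δ j)
    rank-odd q ≡.refl with hasRank-odd q f-inverse
    ... | t , odd = t , hasRank-unique (hasRank-rank _) (hasRank-glued (odd (hasRank-rank _)))

-- Arithmetic of the extremal case and rank bounds by θ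

open import Data.Nat.Base using (_+_; _*_)

parity : ∀ n → ∃ λ q → n ≡ q * 2 ⊎ n ≡ suc (q * 2)
parity zero    = 0 , inj₁ ≡.refl
parity (suc n) with parity n
... | q , inj₁ eq = q , inj₂ (≡.cong suc eq)
... | q , inj₂ eq = suc q , inj₁ (≡.cong suc eq)

double-mono : ∀ {x y} → x ≤ y → x + x ≤ y + y
double-mono x≤y = ℕₚ.+-mono-≤ x≤y x≤y

-- The letters stand for `a = r(Fᵠ)`, `b = r(F)`, `c = r(Hᵠ)`, `d = r(H)` and `x`, `y`, `z` for θ of
-- `F`, `H`, `G`. The equation says `a = d + 2(z - 1)`, and both `b + 2x` and `d + 2y` are at most
-- that, so every inequality is tight.
squeeze : ∀ {a b c d x y z} → suc (suc a) ≡ d + (z + z) → a ≤ b + (x + x) → b ≤ d → a ≤ c → c ≤ d + (y + y) →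
  suc x ≤ z → suc y ≤ z → a ≡ b + (x + x) × c ≡ d + (y + y) × a ≡ c × b ≡ d
squeeze {a} {b} {c} {d} {x} {y} {suc z} eq a≤ b≤d a≤c c≤ (s≤s x≤z) (s≤s y≤z) =
    ℕₚ.≤-antisym a≤ (ℕₚ.≤-trans (ℕₚ.+-mono-≤ b≤d (double-mono x≤z)) (ℕₚ.≤-reflexive (≡.sym a≡)))
  , ℕₚ.≤-antisym c≤ (ℕₚ.≤-trans y≤a a≤c)
  , ℕₚ.≤-antisym a≤c (ℕₚ.≤-trans c≤ y≤a)
  , ℕₚ.≤-antisym b≤d (ℕₚ.+-cancelʳ-≤ (z + z) d b (ℕₚ.≤-trans (ℕₚ.≤-reflexive (≡.sym a≡))
      (ℕₚ.≤-trans a≤ (ℕₚ.+-monoʳ-≤ b (double-mono x≤z)))))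
  where
  open Data.Nat.Solver.+-*-Solver
  a≡ : a ≡ d + (z + z)
  a≡ = ℕₚ.suc-injective (ℕₚ.suc-injective (≡.trans eq
    (solve 2 (λ d z → d :+ ((con 1 :+ z) :+ (con 1 :+ z)) := con 2 :+ (d :+ (z :+ z))) ≡.refl d z)))
  y≤a : d + (y + y) ≤ a
  y≤a = ℕₚ.≤-trans (ℕₚ.+-monoʳ-≤ d (double-mono y≤z)) (ℕₚ.≤-reflexive (≡.sym a≡))

-- For `a`, `b` the ranks of Φ and `G`, `y = θ(G)` and `x` the θ of `F` or `H`. As `2y` exceeds `2x`
-- by at least 2, a slack of one is affordable; the odd case needs it.
gap : ∀ {a b x y} → a ≡ b + (y + y) → a ≤ suc (b + (x + x)) → ¬ suc x ≤ y
gap {b = b} {x} eq a≤ x<y = ℕₚ.<-irrefl ≡.refl (ℕₚ.≤-trans (ℕₚ.≤-reflexive shift)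
  (ℕₚ.≤-trans (ℕₚ.+-monoʳ-≤ b (double-mono x<y)) (ℕₚ.≤-trans (ℕₚ.≤-reflexive (≡.sym eq)) a≤)))
  where
  open Data.Nat.Solver.+-*-Solver
  shift : suc (suc (b + (x + x))) ≡ b + (suc x + suc x)
  shift = solve 2 (λ b x → con 2 :+ (b :+ (x :+ x)) := b :+ ((con 1 :+ x) :+ (con 1 :+ x))) ≡.refl b x

module RankBounds {c ℓ} (K : DiscreteField c ℓ) {n} (G : Graph n) where
  open DiscreteField K using (Carrier; _≈_; 1#; 0#; refl; sym; trans; *-congˡ; *-congʳ; *-identityˡ; commutativeRing; +-congˡ; +-congʳ; +-identityʳ; -‿inverseʳ)
    renaming (_+_ to _+ᴷ_; _*_ to _*ᴷ_; -_ to -ᴷ_)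
  open RankTheory K
  open LinearAlgebra K using (Matrix; rank)
  open Switching K
  open IntegerSolver commutativeRing

  ones : Matrix n n
  ones _ _ = 1#

  ones-unit : UnitWeights G ones
  ones-unit _ _ _ = *-identityˡ 1#

  -- The edge count of `switching`, with the number of unbalanced edges dropped; all weights equal
  -- to 1 are a convenient choice.
  order≤edges+ω : n ≤ length (Graph.edges G) + Graph.ω G
  order≤edges+ω with switching G ones ones-unit
  ... | b , b+n≤ , _ = ℕₚ.≤-trans (ℕₚ.m≤n+m n b) b+n≤

  module _ (g : Matrix n n) (unit : UnitWeights G g) where

    rank-≤ : rank (weighted G g) ≤ rank (weighted G ones) + (cyclomatic G + cyclomatic G)
    rank-≤ with switching G g unit
    ... | b , b+n≤ , d , d⁻¹ , inv , low = proj₂ (hasRank-rank (weighted G g)) _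
      (rankAtMost-≤ (ℕₚ.+-monoʳ-≤ (rank (weighted G ones)) (double-mono (ℕₚ.m+n≤o⇒m≤o∸n b b+n≤)))
        (rankAtMost-cong (λ i j → solve 2 (λ x y → x :+ (y :+ :- x) := y) refl _ _)
          (rankAtMost-+ (rankAtMost-scale d d⁻¹ (proj₁ (hasRank-rank (weighted G ones)))) low)))

    -- Switching commutes with a perturbation concentrated in one diagonal entry.
    rank-diagonal-≤ : ∀ (s t : Carrier) (δ : Fin n → Carrier) → (∃ λ v → ∀ j → j ≢ v → δ j ≈ 0#) →
      rank (λ i j → weighted G g i j +ᴷ δ i *ᴷ t *ᴷ δ j) ≤
      suc (rank (λ i j → weighted G ones i j +ᴷ δ i *ᴷ s *ᴷ δ j) + (cyclomatic G + cyclomatic G))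
    rank-diagonal-≤ s t δ (v , δ≈0) with switching G g unit
    ... | b , b+n≤ , d , d⁻¹ , inv , low = proj₂ (hasRank-rank _) _
      (rankAtMost-≤ (s≤s (ℕₚ.+-monoʳ-≤ (rank B) (double-mono (ℕₚ.m+n≤o⇒m≤o∸n b b+n≤))))
        (rankAtMost-cong entry
          -- The two loops carry unrelated weights; their difference `t - s` is an outer product and
          -- accounts for the `suc` in the bound.
          (rankAtMost-+ (rankAtMost-outer (λ i → δ i *ᴷ (t +ᴷ -ᴷ s)) δ)
            (rankAtMost-+ (rankAtMost-scale d d⁻¹ (proj₁ (hasRank-rank B))) low))))
      where
      B : Matrix n n
      B i j = weighted G ones i j +ᴷ δ i *ᴷ s *ᴷ δ j
      invariant : ∀ i j → d i *ᴷ (δ i *ᴷ s *ᴷ δ j) *ᴷ d⁻¹ j ≈ δ i *ᴷ s *ᴷ δ j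
      invariant i j with i Finₚ.≟ v | j Finₚ.≟ v
      ... | yes ≡.refl | yes ≡.refl = trans
        (solve 3 (λ x y z → x :* y :* z := x :* z :* y) refl (d v) (δ v *ᴷ s *ᴷ δ v) (d⁻¹ v))
        (trans (*-congʳ (inv v)) (*-identityˡ _))
      ... | no i≢v | _ = trans (*-congʳ (*-congˡ (*-congʳ (*-congʳ (δ≈0 i i≢v)))))
        (trans (solve 4 (λ x y z u → x :* (con (+ 0) :* y :* z) :* u := con (+ 0) :* y :* z) refl _ _ _ _)
          (sym (*-congʳ (*-congʳ (δ≈0 i i≢v)))))
      ... | yes _ | no j≢v = trans (*-congʳ (*-congˡ (*-congˡ (δ≈0 j j≢v))))
        (trans (solve 3 (λ x y u → x :* (y :* con (+ 0)) :* u := y :* con (+ 0)) refl _ _ _)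
          (sym (*-congˡ (δ≈0 j j≢v))))
      entry : ∀ i j → δ i *ᴷ (t +ᴷ -ᴷ s) *ᴷ δ j +ᴷ (d i *ᴷ B i j *ᴷ d⁻¹ j
                +ᴷ (weighted G g i j +ᴷ -ᴷ (d i *ᴷ weighted G ones i j *ᴷ d⁻¹ j))) ≈
              weighted G g i j +ᴷ δ i *ᴷ t *ᴷ δ j
      entry i j = trans
        (solve 8 (λ x s t y p a q m →
          x :* (t :+ :- s) :* y :+ (p :* (a :+ x :* s :* y) :* q :+ (m :+ :- (p :* a :* q))) :=
          m :+ x :* t :* y :+ (p :* (x :* s :* y) :* q :+ :- (x :* s :* y))) refl
          (δ i) s t (δ j) (d i) (weighted G ones i j) (d⁻¹ j) (weighted G g i j))
        (trans (+-congˡ (trans (+-congʳ (invariant i j)) (-‿inverseʳ _))) (+-identityʳ _))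

CharacteristicNot2 : ∀ {c ℓ} → DiscreteField c ℓ → Set ℓ
CharacteristicNot2 K = ¬ (1# +ᴷ 1# ≈ 0#)
  where open DiscreteField K using (1#; 0#; _≈_) renaming (_+_ to _+ᴷ_)

-- Case distinction on `p` modulo 4

module ExtremalRank {c ℓ} (K : DiscreteField c ℓ) (2≉0 : CharacteristicNot2 K)
                {n} (G : Graph n) {m} (C : PendantCycle G (suc m))
                (g : LinearAlgebra.Matrix K n n) (unit : Switching.UnitWeights K G g) where
  open DiscreteField K using (_≈_; 1#; -_; refl; sym; trans; *-identityˡ; -‿inverseˡ; +-congʳ; -‿cong; *-rawMonoid; ring; _≟_; Carrier)
    renaming (_+_ to _+ᴷ_; _*_ to _*ᴷ_)
  open RingProperties ring using (-‿involutive; -1*x≈-x)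
  open RawMonoidOps *-rawMonoid using () renaming (sum to product; _×_ to power)
  open LinearAlgebra K using (Matrix; rank)
  open Switching K
  open PendantCycle C using (V[F]; V[H])
  open Pendant G C
  open PendantRank K G C
  open RankBounds K

  private
    1s : Matrix n n
    1s = ones G

    gᴴ : Matrix ∣ V[H] ∣ ∣ V[H] ∣
    gᴴ i j = g (member V[H] i) (member V[H] j)

    gᶠ : Matrix ∣ V[F] ∣ ∣ V[F] ∣
    gᶠ i j = g (member V[F] i) (member V[F] j)

    rΦ = rank (weighted G g)
    rG = rank (weighted G 1s)
    rFᵠ = rank (weighted (G [ V[F] ]) gᶠ)
    rF = rank (weighted (G [ V[F] ]) (ones (G [ V[F] ])))
    rHᵠ = rank (weighted (G [ V[H] ]) gᴴ)
    rH = rank (weighted (G [ V[H] ]) (ones (G [ V[H] ])))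
    tG = cyclomatic G
    tF = cyclomatic (G [ V[F] ])
    tH = cyclomatic (G [ V[H] ])

    tF<tG : suc tF ≤ tG
    tF<tG = cyclomatic-F (order≤edges+ω (G [ V[F] ]))

    tH<tG : suc tH ≤ tG
    tH<tG = cyclomatic-H (order≤edges+ω (G [ V[H] ]))

    F-bound : rFᵠ ≤ rF + (tF + tF)
    F-bound = rank-≤ (G [ V[F] ]) gᶠ (λ i j → unit _ _)

    H-bound : rHᵠ ≤ rH + (tH + tH)
    H-bound = rank-≤ (G [ V[H] ]) gᴴ (λ i j → unit _ _)

    product-ones : ∀ k → product {k} (λ _ → 1#) ≈ 1#
    product-ones zero    = refl
    product-ones (suc k) = trans (*-identityˡ _) (product-ones k)

    power-even : ∀ s → power (s * 2) (- 1#) ≈ 1#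
    power-even zero    = refl
    power-even (suc s) = trans (-1*x≈-x _) (trans (-‿cong (-1*x≈-x _)) (trans (-‿involutive _) (power-even s)))

    power-odd : ∀ s → ¬ (1# ≈ power (suc (s * 2)) (- 1#))
    power-odd s eq = 2≉0 (trans (+-congʳ (trans eq (trans (-1*x≈-x _) (-‿cong (power-even s))))) (-‿inverseˡ 1#))

    gain : _
    gain = cycleProduct g unit

  module _ (extremal : rΦ ≡ rG + (tG + tG)) where

    -- Both graphs reduce to `H` with a loop at `v`. Unequal loop weights cost one, still less than
    -- the 2 gained from `θ(H) < θ(G)`.
    not-odd : ∀ q → m ≢ q * 2
    not-odd q m≡ with rank-odd g unit q m≡ | rank-odd 1s (ones-unit G) q m≡
    ... | t , eqΦ | s , eqG = gap {b = rG} {tH} {tG} extremal (begin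
      rΦ                                  ≡⟨ eqΦ ⟩
      q * 2 + ρ gᴴ t                      ≤⟨ ℕₚ.+-monoʳ-≤ (q * 2) (rank-diagonal-≤ (G [ V[H] ]) gᴴ (λ i j → unit _ _) s t δ δ-support) ⟩
      q * 2 + suc (ρ 1ᴴ s + (tH + tH))    ≡⟨ ℕₚ.+-suc (q * 2) (ρ 1ᴴ s + (tH + tH)) ⟩
      suc (q * 2 + (ρ 1ᴴ s + (tH + tH)))  ≡⟨ ≡.cong suc (≡.sym (ℕₚ.+-assoc (q * 2) (ρ 1ᴴ s) (tH + tH))) ⟩
      suc (q * 2 + ρ 1ᴴ s + (tH + tH))    ≡⟨ ≡.cong (λ x → suc (x + (tH + tH))) (≡.sym eqG) ⟩
      suc (rG + (tH + tH))                ∎) tH<tG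
      where
      open ℕₚ.≤-Reasoning
      1ᴴ = ones (G [ V[H] ])
      ρ : Matrix ∣ V[H] ∣ ∣ V[H] ∣ → Carrier → ℕ
      ρ h x = rank (λ i j → weighted (G [ V[H] ]) h i j +ᴷ δ i *ᴷ x *ᴷ δ j)

    G-typeA : ∀ q → m ≡ suc (q * 2) → ∀ s → suc q ≡ s * 2 → rG ≡ q * 2 + rH
    G-typeA q m≡ s q≡ = rank-typeA 1s (ones-unit G) q m≡ (trans (product-ones (suc m))
      (≡.subst (λ h → 1# ≈ power h (- 1#)) (≡.sym q≡) (sym (power-even s))))

    -- The cycle of `G` has product 1, not -1, so `G` reduces to `F`. The rank of Φ is at most
    -- `p + r(Fᵠ)` in either case: if its cycle is not of Type B, restoring `v` to `F` adds at most
    -- 2, which makes up for `p - 2`.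
    not-2-mod-4 : ∀ q → m ≡ suc (q * 2) → ∀ s → suc q ≢ suc (s * 2)
    not-2-mod-4 q m≡ s q≡ = gap {b = rG} {tF} {tG} extremal (begin
      rΦ                           ≤⟨ upper ⟩
      suc q * 2 + rFᵠ              ≤⟨ ℕₚ.+-monoʳ-≤ (suc q * 2) F-bound ⟩
      suc q * 2 + (rF + (tF + tF)) ≡⟨ ≡.sym (ℕₚ.+-assoc (suc q * 2) rF (tF + tF)) ⟩
      suc q * 2 + rF + (tF + tF)   ≡⟨ ≡.cong (_+ (tF + tF)) (≡.sym G-typeB) ⟩
      rG + (tF + tF)               ≤⟨ ℕₚ.n≤1+n _ ⟩
      suc (rG + (tF + tF))         ∎) tF<tG
      where
      open ℕₚ.≤-Reasoning
      G-typeB : rG ≡ suc q * 2 + rF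
      G-typeB = rank-typeB 1s (ones-unit G) q m≡ λ eq → power-odd s
        (≡.subst (λ h → 1# ≈ power h (- 1#)) q≡ (trans (sym (product-ones (suc m))) eq))
      upper : rΦ ≤ suc q * 2 + rFᵠ
      upper with gain ≟ power (suc q) (- 1#)
      ... | no  neq = ℕₚ.≤-reflexive (rank-typeB g unit q m≡ neq)
      ... | yes eq  = begin
        rΦ                    ≡⟨ rank-typeA g unit q m≡ eq ⟩
        q * 2 + rHᵠ           ≤⟨ ℕₚ.+-monoʳ-≤ (q * 2) (rank-H≤2+F g unit) ⟩
        q * 2 + (2 + rFᵠ)     ≡⟨ ≡.sym (ℕₚ.+-assoc (q * 2) 2 rFᵠ) ⟩
        q * 2 + 2 + rFᵠ       ≡⟨ ≡.cong (_+ rFᵠ) (ℕₚ.+-comm (q * 2) 2) ⟩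
        suc q * 2 + rFᵠ       ∎

    -- Otherwise Φ and `G` would both reduce to `H` with the same summand `p - 2`, and `θ(H) < θ(G)`
    -- would leave their ranks too close.
    typeB : ∀ q → m ≡ suc (q * 2) → ∀ s → suc q ≡ s * 2 → ¬ (gain ≈ power (suc q) (- 1#))
    typeB q m≡ s q≡ eq = gap {b = rG} {tH} {tG} extremal (begin
      rΦ                       ≡⟨ rank-typeA g unit q m≡ eq ⟩
      q * 2 + rHᵠ              ≤⟨ ℕₚ.+-monoʳ-≤ (q * 2) H-bound ⟩
      q * 2 + (rH + (tH + tH)) ≡⟨ ≡.sym (ℕₚ.+-assoc (q * 2) rH (tH + tH)) ⟩
      q * 2 + rH + (tH + tH)   ≡⟨ ≡.cong (_+ (tH + tH)) (≡.sym (G-typeA q m≡ s q≡)) ⟩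
      rG + (tH + tH)           ≤⟨ ℕₚ.n≤1+n _ ⟩
      suc (rG + (tH + tH))     ∎) tH<tG
      where open ℕₚ.≤-Reasoning

    conclusion : ((2 ∣ suc m × ¬ (gain ≈ power (suc m / 2) (- 1#))) × 4 ∣ suc m) ×
      (rHᵠ ≡ rH + (tH + tH) × rFᵠ ≡ rF + (tF + tF)) ×
      (rΦ ≡ suc m + rFᵠ × rFᵠ ≡ rHᵠ × rG ≡ (suc m ∸ 2) + rH × rF ≡ rH)
    conclusion with parity m
    ... | q , inj₁ m≡ = ⊥-elim (not-odd q m≡)
    ... | q , inj₂ m≡ with parity (suc q)
    ...   | s , inj₂ q≡ = ⊥-elim (not-2-mod-4 q m≡ s q≡)
    ...   | s , inj₁ q≡ =
        ((divides (suc q) p≡ , notA ∘ ≡.subst (λ h → gain ≈ power h (- 1#)) half)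
        , divides s (≡.trans p≡ (≡.trans (≡.cong (_* 2) q≡) (ℕₚ.*-assoc s 2 2))))
      , (proj₁ (proj₂ sq) , proj₁ sq)
      , (≡.trans Φ≡ (≡.cong (_+ rFᵠ) (≡.sym p≡)) , proj₁ (proj₂ (proj₂ sq))
        , ≡.trans G≡ (≡.cong (λ x → (x ∸ 2) + rH) (≡.sym p≡)) , proj₂ (proj₂ (proj₂ sq)))
      where
      p≡ : suc m ≡ suc q * 2
      p≡ = ≡.cong suc m≡
      half : suc m / 2 ≡ suc q
      half = ≡.trans (≡.cong (_/ 2) p≡) (m*n/n≡m (suc q) 2)
      notA = typeB q m≡ s q≡
      Φ≡ : rΦ ≡ suc q * 2 + rFᵠ
      Φ≡ = rank-typeB g unit q m≡ notA
      G≡ : rG ≡ q * 2 + rH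
      G≡ = G-typeA q m≡ s q≡
      -- The summand `p - 2` is cancelled between `r(Φ) = p + r(Fᵠ)` and `r(G) = p - 2 + r(H)`; the
      -- two `suc` are what is left of `p`.
      balance : suc (suc rFᵠ) ≡ rH + (tG + tG)
      balance = ℕₚ.+-cancelˡ-≡ (q * 2) _ _ (≡.trans
        (≡.trans (ℕₚ.+-suc (q * 2) (suc rFᵠ)) (≡.cong suc (ℕₚ.+-suc (q * 2) rFᵠ)))
        (≡.trans (≡.sym Φ≡) (≡.trans extremal (≡.trans (≡.cong (_+ (tG + tG)) G≡) (ℕₚ.+-assoc (q * 2) rH (tG + tG))))))
      sq = squeeze {x = tF} {y = tH} {z = tG} balance F-bound (rank-F≤H 1s (ones-unit G)) (rank-F≤H g unit) H-bound tF<tG tH<tG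

-- Specialisation to complex unit gains

theorem4p5 : ∀ {c ℓ₁ ℓ₂} (ℝ : RealNumbers c ℓ₁ ℓ₂) →
    let open GainGraphs ℝ
        open GainGraph using (graph)
        open Graph using (θ)
    in
    {n : ℕ} (Φ : GainGraph n) {p : ℕ} (C : PendantCycle (graph Φ) p) →
    let open PendantCycle C
        G  = graph Φ
        Fᵠ = Φ ⟦ V[F] ⟧
        F  = graph Fᵠ
        Hᵠ = Φ ⟦ V[H] ⟧
        H  = graph Hᵠ
    in
    + rᵠ Φ ≡ + r G +ℤ + 2 *ℤ θ G →
    (TypeB Φ cycle × 4 ∣ p)
    × (+ rᵠ Hᵠ ≡ + r H +ℤ + 2 *ℤ θ H × + rᵠ Fᵠ ≡ + r F +ℤ + 2 *ℤ θ F)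
    × (rᵠ Φ ≡ p + rᵠ Fᵠ × rᵠ Fᵠ ≡ rᵠ Hᵠ × r G ≡ (p ∸ 2) + r H × r F ≡ r H)
theorem4p5 ℝ Φ {zero} C with PendantCycle.root C
... | ()
theorem4p5 ℝ Φ {suc m} C hyp =
    proj₁ result
  , ( toℤ (graph [ V[H] ]) {b = r (graph [ V[H] ])} (proj₁ (proj₁ (proj₂ result)))
    , toℤ (graph [ V[F] ]) {b = r (graph [ V[F] ])} (proj₂ (proj₁ (proj₂ result))) )
  , proj₂ (proj₂ result)
  where
  open GainGraphs ℝ
  open GainGraph Φ using (graph; gain; gain-unit; gain-conj)
  open ComplexNumbers ℝ using (ℂ)
  module R = RealNumbers ℝ
  module ℂ = DiscreteField ℂ
  open PendantCycle C
  open IntegerSolver R.commutativeRing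

  2≉0 : CharacteristicNot2 ℂ
  2≉0 (2≈0 , _) with R.total R.0# R.1#
  ... | inj₁ 0≤1 = R.1≉0 (R.antisym
    (R.≤-respˡ-≈ (R.+-identityʳ R.1#) (R.≤-respʳ-≈ 2≈0 (R.+-monoʳ-≤ᴿ R.1# 0≤1))) 0≤1)
  ... | inj₂ 1≤0 = R.1≉0 (R.antisym 1≤0
    (R.≤-respˡ-≈ 2≈0 (R.≤-respʳ-≈ (R.+-identityʳ R.1#) (R.+-monoʳ-≤ᴿ R.1# 1≤0))))

  -- Modulus one and Hermitian symmetry enter the proof only here, through `z` times its conjugate
  -- being `re² + im² = 1`.
  unit : Switching.UnitWeights ℂ graph gain
  unit i j adj with gain i j | gain-unit i j adj | gain-conj i j adj
  ... | (a , b) | _ , 1≈a²+b² | eq = ℂ.trans (ℂ.*-congˡ eq)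
    ( R.trans (solve 2 (λ a b → a :* a :+ :- (b :* :- b) := a :* a :+ b :* b) R.refl a b)
        (R.trans (R.sym 1≈a²+b²) (R.*-identityˡ R.1#))
    , solve 2 (λ a b → a :* :- b :+ b :* a := con (+ 0)) R.refl a b )

  open ExtremalRank ℂ 2≉0 graph C gain unit

  θ≡ : ∀ {k} (G : Graph k) → Graph.θ G ≡ + cyclomatic G
  θ≡ G = θ≡cyclomatic G (RankBounds.order≤edges+ω ℂ G)

  twice : ∀ a t → + (a + (t + t)) ≡ + a +ℤ + 2 *ℤ + t
  twice a t = ≡.trans (≡.cong (λ x → + (a + (t + x))) (≡.sym (ℕₚ.+-identityʳ t)))
    (≡.cong (λ x → + a +ℤ x) (ℤₚ.pos-* 2 t))

  toℤ : ∀ {k} (G : Graph k) {a b} → a ≡ b + (cyclomatic G + cyclomatic G) → + a ≡ + b +ℤ + 2 *ℤ Graph.θ G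
  toℤ G {b = b} eq = ≡.trans (≡.cong +_ eq) (≡.trans (twice b (cyclomatic G)) (≡.cong (λ t → + b +ℤ + 2 *ℤ t) (≡.sym (θ≡ G))))

  extremal : rᵠ Φ ≡ r graph + (cyclomatic graph + cyclomatic graph)
  extremal = ℤₚ.+-injective (≡.trans hyp
    (≡.trans (≡.cong (λ t → + r graph +ℤ + 2 *ℤ t) (θ≡ graph)) (≡.sym (twice (r graph) (cyclomatic graph)))))

  result = conclusion extremal
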